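{- Let $c$ be an integer, let $N_c=11-c$, and let $n$ denote a positive integer. Then the following hold. (1) If $c>4$, then $B(n,n-c)=\emptyset$, except for $n=c$, in which case $B(n,0)$ consists of all the linear betweenness structures of order $n$. (2) If $2\le c\le4$, then $B(n,n-c)\ne\emptyset$ if and only if $n\ge c$. Further, if $n\ge N_c$, then the betweenness structures $\mathcal{B}\in B(n,n-c)$ are characterized, up to isomorphism, as follows: - if $c=4$, then $\mathcal{B}$ is isomorphic to either $\mathcal{R}_{n,i}^4$ (for some $i\in I_n^4$) or $\mathcal{S}_n^4$; - if $c=3$, then $\mathcal{B}$ is isomorphic to either $\mathcal{Q}_n^3$, $\mathcal{R}_{n,i}^3$ (for some $i\in I_n^3$) or $\mathcal{S}_n^3$; - if $c=2$, then $\mathcal{B}$ is isomorphic to either $\mathcal{Q}_n^2$, $\mathcal{R}_{n,i}^2$ (for some $i\in I_n^2$) or $\mathcal{S}_n^2$. (3) If $c<2$ and $n\ge N_c$, then $B(n,n-c)=\emptyset$. (4) If $c\le4$ and $n=N_c-1$, then $B(n,n-c)\ne\emptyset$. Moreover, there exists a betweenness structure $\mathcal{B}\in B(n,n-c)$ such that $\mathcal{H}(\mathcal{B})$ is not a tight star.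
   Context: A betweenness structure is a pair $\mathcal{B}=(X,\beta)$ where $X$ is a nonempty finite set and $\beta\subseteq X^3$; write $(x\ y\ z)$ for $(x,y,z)\in\beta$. All betweenness structures are assumed to be almost-metrizable, i.e. for all $x,y,z,w\in X$: (P1) $(x\ x\ z)$; (P2) $(x\ y\ z)\Rightarrow(z\ y\ x)$; (P3) $(x\ y\ z)\wedge(y\ x\ z)\Rightarrow x=y$; (P4) $(x\ y\ z)\wedge(x\ w\ y)\Rightarrow(x\ w\ z)\wedge(w\ y\ z)$. The order of $\mathcal{B}$ is $|X|$. A set of three distinct points is collinear if some ordering of it is in $\beta$; otherwise it is a triangle. The co-size of $\mathcal{B}$ is its number of triangles; $\mathcal{B}$ is linear if its co-size is $0$. $\mathcal{H}(\mathcal{B})$ is the $3$-uniform hypergraph on $X$ whose edges are the triangles of $\mathcal{B}$. $B(n,m)$ is the set of betweenness structures of order $n$ and co-size $m$ (empty if $m<0$). Isomorphisms are bijections of ground sets preserving betweenness in both directions. A $3$-uniform hypergraph is a $\Delta$-star if there is a set $K$ of vertices (the kernel) such that $E\cap F=K$ for any two distinct edges $E,F$; it is a tight star if it is a $\Delta$-star with kernel of size $2$. A hypergraph with exactly one edge is regarded as a tight star. Graphs are connected with positive real edge weights (weight $1$ unless specified). For a graph $W$ with shortest-path metric $d_W$ (path length is the sum of edge weights), the betweenness structure $\mathcal{B}(W)$ induced by $W$ lives on the vertex set and has $(x\ y\ z)$ iff $d_W(x,z)=d_W(x,y)+d_W(y,z)$. Let $I_n^2=I_n^4=\{i\in\mathbb{N}:1\le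 i\le\lceil\frac{n-3}{2}\rceil\}$ and $I_n^3=\{i\in\mathbb{N}:1\le i\le n-3\}$. The following graphs have vertex set $\{x_1,\dots,x_{n-2},y,z\}$ and are obtained from the path $P=x_1x_2\ldots x_{n-2}$: - $R_{n,i}^4$ ($n\ge5$, $i\in I_n^4$): delete edge $\{x_i,x_{i+1}\}$ and add edges $\{y,x_i\},\{z,x_i\},\{y,x_{i+1}\},\{z,x_{i+1}\}$; - $S_n^4$ ($n\ge5$): add edges $\{x_1,y\},\{x_{n-2},z\}$, and add edge $\{y,z\}$ of weight $n-3$; - $Q_n^3$ ($n\ge4$): add edges $\{y,x_1\}$ and $\{z,x_1\}$; - $R_{n,i}^3$ ($n\ge4$, $i\in I_n^3$): delete edge $\{x_i,x_{i+1}\}$, add edges $\{y,x_i\},\{z,x_i\}$, and add edges $\{y,x_{i+1}\},\{z,x_{i+1}\}$ of weight $2$; - $S_n^3$ ($n\ge4$): add edge $\{x_1,y\}$, and add edge $\{x_{n-2},z\}$ of weight $2$ and edge $\{y,z\}$ of weight $n-2$; - $Q_n^2$ ($n\ge3$): add edges $\{y,x_1\},\{z,x_1\}$ and $\{y,z\}$; - $R_{n,i}^2$ ($n\ge4$, $i\in I_n^2$): delete edge $\{x_i,x_{i+1}\}$, and add edges $\{y,x_i\},\{z,x_i\},\{y,x_{i+1}\},\{z,x_{i+1}\}$ and $\{y,z\}$; - $S_n^2$ ($n\ge3$): add edges $\{x_1,y\},\{x_{n-2},z\}$, and add edge $\{y,z\}$ of weight $n-2$. $\mathcal{Q}_n^c,\mathcal{R}_{n,i}^c,\mathcal{S}_n^c$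 are the betweenness structures induced by $Q_n^c,R_{n,i}^c,S_n^c$. -}

module Defs where

open import Data.Bool using (if_then_else_)
import Data.Bool.Properties as Bool
open import Data.Fin using (Fin; zero; suc; toℕ; inject₁; fromℕ; fromℕ<)
open import Data.Fin.Induction using (<-weakInduction)
open import Data.Fin.Permutation using (Permutation; _⟨$⟩ʳ_)
open import Data.Fin.Properties using (_≟_; any?; suc-injective; toℕ-inject₁)
open import Data.Fin.Subset using (Subset; inside; outside; ∣_∣; _∩_; _∪_; ⁅_⁆)
open import Data.Integer using (ℤ; +_)
open import Data.List using (List; []; _∷_; _++_; map; filter; length)
open import Data.Maybe using (Maybe; just; nothing)
open import Data.Nat using (ℕ; zero; suc; _+_; _∸_; _≤_; _<_; z≤n; s≤s; NonZero; >-nonZero⁻¹; ⌈_/2⌉)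
open import Data.Nat.Induction using (<-rec)
import Data.Nat.Properties as ℕ
open import Data.Product using (Σ; ∃; _×_; _,_; proj₁; proj₂)
open import Data.Sum as Sum using (_⊎_; inj₁; inj₂)
import Data.Vec as Vec
open import Data.Vec.Properties using (≡-dec)
open import Function using (_⇔_; _|>_)
open import Relation.Binary.PropositionalEquality
open import Relation.Nullary using (Dec; yes; no; ¬_; ¬?; does; contradiction; _×-dec_; _⊎-dec_)
open import Relation.Nullary.Decidable using (False; toWitnessFalse; map′)
open import Relation.Unary using (Decidable)

-- The ground set of a structure of order n is Fin n, and its ternary relation
-- is decidable, as a subset of a finite set is classically.
record BetweennessStructure (n : ℕ) : Set₁ where
  field
    nonEmpty : NonZero n
    β        : Fin n → Fin n → Fin n → Set
    β?       : ∀ x y z → Dec (β x y z)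
    P1       : ∀ x z → β x x z
    P2       : ∀ x y z → β x y z → β z y x
    P3       : ∀ x y z → β x y z → β y x z → x ≡ y
    P4       : ∀ x y z w → β x y z → β x w y → β x w z × β w y z

open BetweennessStructure

infix 4 _≅_

record _≅_ {m n : ℕ} (𝓐 : BetweennessStructure m) (𝓑 : BetweennessStructure n) : Set where
  field
    bijection : Permutation m n
    preserves : ∀ x y z →
      β 𝓐 x y z ⇔ β 𝓑 (bijection ⟨$⟩ʳ x) (bijection ⟨$⟩ʳ y) (bijection ⟨$⟩ʳ z)

record Hypergraph (n : ℕ) : Set₁ where
  field
    Edge    : Subset n → Set
    Edge?   : Decidable Edge
    uniform : ∀ e → Edge e → ∣ e ∣ ≡ 3

open Hypergraph

subsets : ∀ n → List (Subset n)
subsets zero    = Vec.[] ∷ []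
subsets (suc n) = map (outside Vec.∷_) (subsets n) ++ map (inside Vec.∷_) (subsets n)

size : ∀ {n} → Hypergraph n → ℕ
size {n} H = length (filter (Edge? H) (subsets n))

IsKernel : ∀ {n} → Hypergraph n → Subset n → Set
IsKernel H K = ∀ e f → Edge H e → Edge H f → e ≢ f → e ∩ f ≡ K

TightStar : ∀ {n} → Hypergraph n → Set
TightStar H = (∃ λ K → IsKernel H K × ∣ K ∣ ≡ 2) ⊎ size H ≡ 1

module _ {n : ℕ} (𝓑 : BetweennessStructure n) where

  -- For |p| = 3 the points x, y, z below are automatically distinct.
  Collinear : Subset n → Set
  Collinear p = ∃ λ x → ∃ λ y → ∃ λ z → ⁅ x ⁆ ∪ ⁅ y ⁆ ∪ ⁅ z ⁆ ≡ p × β 𝓑 x y z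

  collinear? : Decidable Collinear
  collinear? p = any? λ x → any? λ y → any? λ z →
    ≡-dec Bool._≟_ (⁅ x ⁆ ∪ ⁅ y ⁆ ∪ ⁅ z ⁆) p ×-dec β? 𝓑 x y z

  Triangle : Subset n → Set
  Triangle p = ∣ p ∣ ≡ 3 × ¬ Collinear p

  triangle? : Decidable Triangle
  triangle? p = (∣ p ∣ ℕ.≟ 3) ×-dec ¬? (collinear? p)

  ℋ : Hypergraph n
  ℋ = record { Edge = Triangle ; Edge? = triangle? ; uniform = λ _ → proj₁ }

  coSize : ℕ
  coSize = size ℋ

  Linear : Set
  Linear = coSize ≡ 0

HasCoSize : ∀ {n} → BetweennessStructure n → ℤ → Set
HasCoSize 𝓑 m = + coSize 𝓑 ≡ m

B : ℕ → ℤ → Set₁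
B n m = Σ (BetweennessStructure n) λ 𝓑 → HasCoSize 𝓑 m

-- `weight u v` is `nothing` exactly when {u,v} is not an edge.  Natural number
-- weights suffice for the graphs below.  Connectedness is a separate predicate,
-- so that a graph can be built up edge by edge.
record WeightedGraph (n : ℕ) : Set where
  field
    weight      : Fin n → Fin n → Maybe ℕ
    irreflexive : ∀ u → weight u u ≡ nothing
    symmetric   : ∀ u v → weight u v ≡ weight v u
    positive    : ∀ u v {w} → weight u v ≡ just w → 0 < w

open WeightedGraph

-- Walks of given total weight.  As weights are positive, a shortest walk
-- is a shortest path.
data Walk {n} (G : WeightedGraph n) : Fin n → Fin n → ℕ → Set where
  []  : ∀ {u} → Walk G u u 0
  _∷_ : ∀ {u v t w ℓ} → weight G u t ≡ just w → Walk G t v ℓ → Walk G u v (w + ℓ)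

Connected : ∀ {n} → WeightedGraph n → Set
Connected G = ∀ u v → ∃ (Walk G u v)

module _ {n : ℕ} (G : WeightedGraph n) where

  infixr 5 _⊕_

  _⊕_ : ∀ {u v t k ℓ} → Walk G u v k → Walk G v t ℓ → Walk G u t (k + ℓ)
  []                 ⊕ q = q
  _∷_ {w = w} e p ⊕ q = subst (Walk G _ _) (sym (ℕ.+-assoc w _ _)) (e ∷ (p ⊕ q))

  edge : ∀ {u v w} → weight G u v ≡ just w → Walk G u v w
  edge e = subst (Walk G _ _) (ℕ.+-identityʳ _) (e ∷ [])

  reverse : ∀ {u v ℓ} → Walk G u v ℓ → Walk G v u ℓ
  reverse []                       = []
  reverse (_∷_ {w = w} {ℓ = ℓ} e p) = subst (Walk G _ _) (ℕ.+-comm ℓ w)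
    (reverse p ⊕ edge (trans (symmetric G _ _) e))

  walk-0 : ∀ {u v} → Walk G u v 0 → u ≡ v
  walk-0 p = go p refl
    where
    go : ∀ {u v ℓ} → Walk G u v ℓ → ℓ ≡ 0 → u ≡ v
    go []      _  = refl
    go (_∷_ {w = w} e _) eq =
      contradiction (positive G _ _ e) (ℕ.<-irrefl (sym (ℕ.m+n≡0⇒m≡0 w eq)))

  FirstStep : Fin n → Fin n → ℕ → Fin n → Set
  FirstStep u v ℓ t = ∃ λ w → weight G u t ≡ just w × w ≤ ℓ × Walk G t v (ℓ ∸ w)

  walk? : ∀ ℓ u v → Dec (Walk G u v ℓ)
  walk? = <-rec _ step
    where
    step : ∀ ℓ → (∀ {k} → k < ℓ → ∀ u v → Dec (Walk G u v k)) → ∀ u v → Dec (Walk G u v ℓ)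
    step ℓ rec u v = map′ to from (((ℓ ℕ.≟ 0) ×-dec (u ≟ v)) ⊎-dec any? first?)
      where
      first? : ∀ t → Dec (FirstStep u v ℓ t)
      first? t with weight G u t in eq
      ... | nothing = no λ ()
      ... | just w with w ℕ.≤? ℓ
      ...   | no  w≰ℓ = no λ { (_ , refl , w≤ℓ , _) → w≰ℓ w≤ℓ }
      ...   | yes w≤ℓ = map′ (λ p → w , refl , w≤ℓ , p) (λ { (_ , refl , _ , p) → p })
                          (rec (ℕ.∸-monoʳ-< (positive G u t eq) w≤ℓ) t v)
      to : (ℓ ≡ 0 × u ≡ v) ⊎ ∃ (FirstStep u v ℓ) → Walk G u v ℓ
      to (inj₁ (refl , refl))             = []
      to (inj₂ (t , w , e , w≤ℓ , p)) = subst (Walk G u v) (ℕ.m+[n∸m]≡n w≤ℓ) (e ∷ p)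
      from : Walk G u v ℓ → (ℓ ≡ 0 × u ≡ v) ⊎ ∃ (FirstStep u v ℓ)
      from []                             = inj₁ (refl , refl)
      from (_∷_ {t = t} {w} {k} e p) = inj₂ (t , w , e , ℕ.m≤m+n w k ,
                                             subst (Walk G t v) (sym (ℕ.m+n∸m≡n w k)) p)

Least : (ℕ → Set) → ℕ → Set
Least P m = P m × (∀ k → P k → m ≤ k)

least : ∀ {P : ℕ → Set} → Decidable P → ∃ P → ∃ (Least P)
least {P} P? (ℓ , p) = search ℓ 0 (subst P (sym (ℕ.+-identityʳ ℓ)) p) (λ _ _ → z≤n)
  where
  search : ∀ fuel m → P (fuel + m) → (∀ k → P k → m ≤ k) → ∃ (Least P)
  search zero       m p lower = m , p , lower
  search (suc fuel) m p lower with P? m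
  ... | yes q = m , q , lower
  ... | no ¬q = search fuel (suc m) (subst P (sym (ℕ.+-suc fuel m)) p)
                  (λ k r → ℕ.≤∧≢⇒< (lower k r) (λ { refl → ¬q r }))

module Induced {n : ℕ} (G : WeightedGraph n) (conn : Connected G) where

  shortest : ∀ u v → ∃ (Least (Walk G u v))
  shortest u v = least (λ ℓ → walk? G ℓ u v) (conn u v)

  d : Fin n → Fin n → ℕ
  d u v = proj₁ (shortest u v)

  d-walk : ∀ u v → Walk G u v (d u v)
  d-walk u v = proj₁ (proj₂ (shortest u v))

  d-least : ∀ {u v ℓ} → Walk G u v ℓ → d u v ≤ ℓ
  d-least = proj₂ (proj₂ (shortest _ _)) _

  d-refl : ∀ u → d u u ≡ 0
  d-refl u = ℕ.n≤0⇒n≡0 (d-least [])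

  d-sym : ∀ u v → d u v ≡ d v u
  d-sym u v = ℕ.≤-antisym (d-least (reverse G (d-walk v u))) (d-least (reverse G (d-walk u v)))

  d-triangle : ∀ u v t → d u t ≤ d u v + d v t
  d-triangle u v t = d-least (_⊕_ G (d-walk u v) (d-walk v t))

  d-zero : ∀ u v → d u v ≡ 0 → u ≡ v
  d-zero u v eq = walk-0 G (subst (Walk G u v) eq (d-walk u v))

  Between : Fin n → Fin n → Fin n → Set
  Between x y z = d x z ≡ d x y + d y z

  structure : {{_ : NonZero n}} → BetweennessStructure n
  structure {{n≢0}} = record
    { nonEmpty = n≢0
    ; β  = Between
    ; β? = λ x y z → d x z ℕ.≟ d x y + d y z
    ; P1 = λ x z → sym (cong (_+ d x z) (d-refl x))
    ; P2 = λ x y z b → begin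
        d z x          ≡⟨ d-sym z x ⟩
        d x z          ≡⟨ b ⟩
        d x y + d y z  ≡⟨ ℕ.+-comm (d x y) (d y z) ⟩
        d y z + d x y  ≡⟨ cong₂ _+_ (d-sym y z) (d-sym x y) ⟩
        d z y + d y x  ∎
    ; P3 = λ x y z b c → d-zero x y (ℕ.m+n≡0⇒m≡0 (d x y) (ℕ.+-cancelʳ-≡ (d x z) _ 0 (p3 x y z b c)))
    ; P4 = p4
    }
    where
    open ≡-Reasoning
    p3 : ∀ x y z → Between x y z → Between y x z → (d x y + d x y) + d x z ≡ d x z
    p3 x y z b c = begin
      (d x y + d x y) + d x z  ≡⟨ ℕ.+-assoc (d x y) _ _ ⟩
      d x y + (d x y + d x z)  ≡⟨ cong (λ k → d x y + (k + d x z)) (d-sym x y) ⟩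
      d x y + (d y x + d x z)  ≡⟨ cong (λ k → d x y + k) (sym c) ⟩
      d x y + d y z            ≡⟨ sym b ⟩
      d x z                    ∎
    p4 : ∀ x y z w → Between x y z → Between x w y → Between x w z × Between w y z
    p4 x y z w b c = xwz , wyz
      where
      split : d x z ≡ d x w + (d w y + d y z)
      split = trans b (trans (cong (_+ d y z) c) (ℕ.+-assoc (d x w) _ _))
      wyz : Between w y z
      wyz = ℕ.≤-antisym (d-triangle w y z)
        (ℕ.+-cancelˡ-≤ (d x w) _ _ (subst (_≤ d x w + d w z) split (d-triangle x w z)))
      xwz : Between x w z
      xwz = trans split (cong (λ k → d x w + k) (sym wyz))

if-yes : ∀ {P A : Set} (p? : Dec P) {t e : A} → P → (if does p? then t else e) ≡ t
if-yes (yes _) _ = refl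
if-yes (no ¬p) p = contradiction p ¬p

if-no : ∀ {P A : Set} (p? : Dec P) {t e : A} → ¬ P → (if does p? then t else e) ≡ e
if-no (yes p) ¬p = contradiction p ¬p
if-no (no _)  _  = refl

if-⇔ : ∀ {P Q A : Set} (p? : Dec P) (q? : Dec Q) {t e e′ : A} → (P → Q) → (Q → P) → e ≡ e′ →
       (if does p? then t else e) ≡ (if does q? then t else e′)
if-⇔ p? q? {t} {e} {e′} f g eq with p?
... | yes p = sym (if-yes q? (f p))
... | no ¬p = trans eq (sym (if-no q? (λ q → ¬p (g q))))

if-ind : ∀ {P A : Set} (C : A → Set) (p? : Dec P) {t e : A} →
         (P → C t) → (¬ P → C e) → C (if does p? then t else e)
if-ind C (yes p) f g = f p
if-ind C (no ¬p) f g = g ¬p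

module _ {n : ℕ} where

  SamePair : (a b u v : Fin n) → Set
  SamePair a b u v = (u ≡ a × v ≡ b) ⊎ (u ≡ b × v ≡ a)

  samePair? : ∀ a b u v → Dec (SamePair a b u v)
  samePair? a b u v = ((u ≟ a) ×-dec (v ≟ b)) ⊎-dec ((u ≟ b) ×-dec (v ≟ a))

  setWeight : (a b : Fin n) → Maybe ℕ → (Fin n → Fin n → Maybe ℕ) → Fin n → Fin n → Maybe ℕ
  setWeight a b m f u v = if does (samePair? a b u v) then m else f u v

  samePair-sym : ∀ {a b u v} → SamePair a b u v → SamePair a b v u
  samePair-sym (inj₁ (p , q)) = inj₂ (q , p)
  samePair-sym (inj₂ (p , q)) = inj₁ (q , p)

  setWeight-sym : ∀ a b m f → (∀ u v → f u v ≡ f v u) →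
                  ∀ u v → setWeight a b m f u v ≡ setWeight a b m f v u
  setWeight-sym a b m f s u v = if-⇔ (samePair? a b u v) (samePair? a b v u) samePair-sym samePair-sym (s u v)

  delete : (a b : Fin n) → WeightedGraph n → WeightedGraph n
  delete a b G = record
    { weight      = setWeight a b nothing (weight G)
    ; irreflexive = irr
    ; symmetric   = setWeight-sym a b nothing (weight G) (symmetric G)
    ; positive    = pos
    }
    where
    irr : ∀ u → setWeight a b nothing (weight G) u u ≡ nothing
    irr u = if-ind (_≡ nothing) (samePair? a b u u) (λ _ → refl) (λ _ → irreflexive G u)
    pos : ∀ u v {w} → setWeight a b nothing (weight G) u v ≡ just w → 0 < w
    pos u v {w} = if-ind (λ m → m ≡ just w → 0 < w) (samePair? a b u v) (λ _ ()) (λ _ → positive G u v)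

  add : (a b : Fin n) {a≢b : False (a ≟ b)} (w : ℕ) .{{_ : NonZero w}} →
        WeightedGraph n → WeightedGraph n
  add a b {a≢b} w {{w≢0}} G = record
    { weight      = setWeight a b (just w) (weight G)
    ; irreflexive = irr
    ; symmetric   = setWeight-sym a b (just w) (weight G) (symmetric G)
    ; positive    = pos
    }
    where
    loop : ∀ {u} → ¬ SamePair a b u u
    loop (inj₁ (p , q)) = toWitnessFalse a≢b (trans (sym p) q)
    loop (inj₂ (p , q)) = toWitnessFalse a≢b (trans (sym q) p)
    irr : ∀ u → setWeight a b (just w) (weight G) u u ≡ nothing
    irr u = trans (if-no (samePair? a b u u) loop) (irreflexive G u)
    pos : ∀ u v {w′} → setWeight a b (just w) (weight G) u v ≡ just w′ → 0 < w′
    pos u v {w′} = if-ind (λ m → m ≡ just w′ → 0 < w′) (samePair? a b u v)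
                     (λ { _ refl → >-nonZero⁻¹ w }) (λ _ → positive G u v)

module _ {n : ℕ} where

  record Adjacent (G : WeightedGraph n) (u v : Fin n) : Set where
    constructor adjacent
    field
      w         : ℕ
      weight≡w  : weight G u v ≡ just w

  Reachable : WeightedGraph n → Fin n → Fin n → Set
  Reachable G u v = ∃ (Walk G u v)

  adjacent⇒reachable : ∀ G {u v} → Adjacent G u v → Reachable G u v
  adjacent⇒reachable G (adjacent w e) = w , edge G e

  reachable-trans : ∀ G {u v t} → Reachable G u v → Reachable G v t → Reachable G u t
  reachable-trans G (_ , p) (_ , q) = _ , _⊕_ G p q

  reachable-sym : ∀ G {u v} → Reachable G u v → Reachable G v u
  reachable-sym G (_ , p) = _ , reverse G p

  added : ∀ a b {a≢b : False (a ≟ b)} w .{{_ : NonZero w}} G → Adjacent (add a b {a≢b} w G) a b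
  added a b w G = adjacent w (if-yes (samePair? a b a b) (inj₁ (refl , refl)))

  kept : ∀ a b {a≢b : False (a ≟ b)} w .{{_ : NonZero w}} G {u v} →
         Adjacent G u v → Adjacent (add a b {a≢b} w G) u v
  kept a b w G {u} {v} (adjacent w₀ e) with samePair? a b u v
  ... | yes p = adjacent w (if-yes (samePair? a b u v) p)
  ... | no ¬p = adjacent w₀ (trans (if-no (samePair? a b u v) ¬p) e)

  undeleted : ∀ a b G {u v} → ¬ SamePair a b u v → Adjacent G u v → Adjacent (delete a b G) u v
  undeleted a b G {u} {v} ¬p (adjacent w e) =
    adjacent w (trans (if-no (samePair? a b u v) ¬p) e)

module Graphs (k : ℕ) where

  pattern y   = zero
  pattern z   = suc zero
  pattern x i = suc (suc i)

  V : Set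
  V = Fin (3 + k)

  -- Fin is 0-based: x₁ is `x zero` and x_{n-2} is `x (fromℕ k)`, where n = 3 + k.
  x-first x-last : V
  x-first = x zero
  x-last  = x (fromℕ k)

  -- The ends of the edge {x_{i+1}, x_{i+2}} of the path.
  x-left x-right : Fin k → V
  x-left  i = x (inject₁ i)
  x-right i = x (suc i)

  Consecutive : (i j : Fin (suc k)) → Set
  Consecutive i j = suc (toℕ i) ≡ toℕ j ⊎ suc (toℕ j) ≡ toℕ i

  consecutive? : ∀ i j → Dec (Consecutive i j)
  consecutive? i j = (suc (toℕ i) ℕ.≟ toℕ j) ⊎-dec (suc (toℕ j) ℕ.≟ toℕ i)

  pathWeight : V → V → Maybe ℕ
  pathWeight (x i) (x j) = if does (consecutive? i j) then just 1 else nothing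
  pathWeight _     _     = nothing

  -- The path x₁ x₂ … x_{n-2}, with y and z as isolated vertices.
  path : WeightedGraph (3 + k)
  path = record { weight = pathWeight ; irreflexive = irr ; symmetric = symm ; positive = pos }
    where
    irr : ∀ u → pathWeight u u ≡ nothing
    irr y = refl
    irr z = refl
    irr (x i) = if-no (consecutive? i i) (λ { (inj₁ p) → ℕ.1+n≢n p ; (inj₂ p) → ℕ.1+n≢n p })
    symm : ∀ u v → pathWeight u v ≡ pathWeight v u
    symm y     y     = refl
    symm y     z     = refl
    symm y     (x _) = refl
    symm z     y     = refl
    symm z     z     = refl
    symm z     (x _) = refl
    symm (x _) y     = refl
    symm (x _) z     = refl
    symm (x i) (x j) = if-⇔ (consecutive? i j) (consecutive? j i) Sum.swap Sum.swap refl
    pos : ∀ u v {w} → pathWeight u v ≡ just w → 0 < w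
    pos (x i) (x j) {w} = if-ind (λ m → m ≡ just w → 0 < w) (consecutive? i j)
                            (λ { _ refl → s≤s z≤n }) (λ _ ())
    pos y     _     ()
    pos z     _     ()
    pos (x _) y     ()
    pos (x _) z     ()

  R⁴ : Fin k → WeightedGraph (3 + k)
  R⁴ i = path
    |> delete (x-left i) (x-right i)
    |> add y (x-left i)  1
    |> add z (x-left i)  1
    |> add y (x-right i) 1
    |> add z (x-right i) 1

  S⁴ : .{{NonZero k}} → WeightedGraph (3 + k)
  S⁴ = path
    |> add y x-first 1
    |> add z x-last  1
    |> add y z       k

  Q³ : WeightedGraph (3 + k)
  Q³ = path
    |> add y x-first 1
    |> add z x-first 1

  R³ : Fin k → WeightedGraph (3 + k)
  R³ i = path
    |> delete (x-left i) (x-right i)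
    |> add y (x-left i)  1
    |> add z (x-left i)  1
    |> add y (x-right i) 2
    |> add z (x-right i) 2

  S³ : WeightedGraph (3 + k)
  S³ = path
    |> add y x-first 1
    |> add z x-last  2
    |> add y z       (1 + k)

  Q² : WeightedGraph (3 + k)
  Q² = path
    |> add y x-first 1
    |> add z x-first 1
    |> add y z       1

  R² : Fin k → WeightedGraph (3 + k)
  R² i = path
    |> delete (x-left i) (x-right i)
    |> add y (x-left i)  1
    |> add z (x-left i)  1
    |> add y (x-right i) 1
    |> add z (x-right i) 1
    |> add y z           1

  S² : WeightedGraph (3 + k)
  S² = path
    |> add y x-first 1
    |> add z x-last  1
    |> add y z       (1 + k)

  path-adjacent : ∀ j → Adjacent path (x-left j) (x-right j)
  path-adjacent j =
    adjacent 1 (if-yes (consecutive? (inject₁ j) (suc j)) (inj₁ (cong suc (toℕ-inject₁ j))))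

  connected : ∀ G → (∀ j → Reachable G (x-left j) (x-right j)) →
              (∃ λ i → Adjacent G y (x i)) → (∃ λ i → Adjacent G z (x i)) → Connected G
  connected G step (i , y~xi) (j , z~xj) u v =
    reachable-trans G (reachable-sym G (from-first u)) (from-first v)
    where
    along : ∀ i → Reachable G x-first (x i)
    along = <-weakInduction (λ i → Reachable G x-first (x i)) (_ , [])
              (λ i r → reachable-trans G r (step i))
    from-first : ∀ u → Reachable G x-first u
    from-first y = reachable-trans G (along i) (reachable-sym G (adjacent⇒reachable G y~xi))
    from-first z = reachable-trans G (along j) (reachable-sym G (adjacent⇒reachable G z~xj))
    from-first (x i) = along i

  add-connected : ∀ a b {a≢b : False (a ≟ b)} w .{{_ : NonZero w}} G →
                  Connected G → Connected (add a b {a≢b} w G)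
  add-connected a b {a≢b} w G conn u v = lift (proj₂ (conn u v))
    where
    G′ : WeightedGraph (3 + k)
    G′ = add a b {a≢b} w G
    lift : ∀ {u v ℓ} → Walk G u v ℓ → Reachable G′ u v
    lift []      = _ , []
    lift (e ∷ p) = reachable-trans G′ (adjacent⇒reachable G′ (kept a b {a≢b} w G (adjacent _ e)))
                                   (lift p)

  pendant-connected : ∀ i j a b .{{_ : NonZero a}} .{{_ : NonZero b}} →
    Connected (path |> add y (x i) a |> add z (x j) b)
  pendant-connected i j a b = connected G₂
    (λ l → adjacent⇒reachable G₂ (kept z (x j) b G₁ (kept y (x i) a path (path-adjacent l))))
    (i , kept z (x j) b G₁ (added y (x i) a path))
    (j , added z (x j) b G₁)
    where
    G₁ G₂ : WeightedGraph (3 + k)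
    G₁ = add y (x i) a path
    G₂ = add z (x j) b G₁

  R-connected : ∀ i a .{{_ : NonZero a}} →
    Connected (path |> delete (x-left i) (x-right i)
                    |> add y (x-left i) 1  |> add z (x-left i) 1
                    |> add y (x-right i) a |> add z (x-right i) a)
  R-connected i a = connected G₄ step (inject₁ i , y~left)
    (inject₁ i , kept z (x-right i) a G₃ (kept y (x-right i) a G₂ (added z (x-left i) 1 G₁)))
    where
    G₀ G₁ G₂ G₃ G₄ : WeightedGraph (3 + k)
    G₀ = delete (x-left i) (x-right i) path
    G₁ = add y (x-left i) 1 G₀
    G₂ = add z (x-left i) 1 G₁
    G₃ = add y (x-right i) a G₂
    G₄ = add z (x-right i) a G₃
    keep : ∀ {u v} → Adjacent G₀ u v → Adjacent G₄ u v
    keep e = kept z (x-right i) a G₃ (kept y (x-right i) a G₂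
               (kept z (x-left i) 1 G₁ (kept y (x-left i) 1 G₀ e)))
    y~left : Adjacent G₄ y (x-left i)
    y~left = kept z (x-right i) a G₃ (kept y (x-right i) a G₂
               (kept z (x-left i) 1 G₁ (added y (x-left i) 1 G₀)))
    y~right : Adjacent G₄ y (x-right i)
    y~right = kept z (x-right i) a G₃ (added y (x-right i) a G₂)
    other : ∀ {j} → j ≢ i → ¬ SamePair (x-left i) (x-right i) (x-left j) (x-right j)
    other j≢i (inj₁ (_ , refl)) = j≢i refl
    other {j} j≢i (inj₂ (p , q)) = ℕ.<-asym {toℕ i} {toℕ j}
      (ℕ.≤-reflexive (trans (sym (cong toℕ (suc-injective (suc-injective p)))) (toℕ-inject₁ j)))
      (ℕ.≤-reflexive (trans (cong toℕ (suc-injective (suc-injective q))) (toℕ-inject₁ i)))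
    step : ∀ j → Reachable G₄ (x-left j) (x-right j)
    step j with j ≟ i
    ... | yes refl = reachable-trans G₄ (reachable-sym G₄ (adjacent⇒reachable G₄ y~left))
                                        (adjacent⇒reachable G₄ y~right)
    ... | no j≢i   = adjacent⇒reachable G₄ (keep (undeleted _ _ path (other j≢i) (path-adjacent j)))

I² I³ I⁴ : ℕ → Set
I² n = ∃ λ i → 1 ≤ i × i ≤ ⌈ n ∸ 3 /2⌉
I³ n = ∃ λ i → 1 ≤ i × i ≤ n ∸ 3
I⁴ n = I² n

index³ : ∀ {k} → I³ (3 + k) → Fin k
index³ (suc i , _ , i<k) = fromℕ< i<k

index² : ∀ {k} → I² (3 + k) → Fin k
index² {k} (i , 1≤i , i≤) = index³ (i , 1≤i , ℕ.≤-trans i≤ (ℕ.⌈n/2⌉≤n k))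

open Graphs

𝓡⁴ : ∀ n → 5 ≤ n → I⁴ n → BetweennessStructure n
𝓡⁴ (suc (suc (suc k))) (s≤s (s≤s (s≤s _))) i = Induced.structure (R⁴ k (index² i)) (R-connected k (index² i) 1)

𝓢⁴ : ∀ n → 5 ≤ n → BetweennessStructure n
𝓢⁴ (suc (suc (suc k@(suc _)))) (s≤s (s≤s (s≤s _))) =
  Induced.structure (S⁴ k) (add-connected k _ _ k _ (pendant-connected k zero (fromℕ k) 1 1))

𝓠³ : ∀ n → 4 ≤ n → BetweennessStructure n
𝓠³ (suc (suc (suc k))) (s≤s (s≤s (s≤s _))) = Induced.structure (Q³ k) (pendant-connected k zero zero 1 1)

𝓡³ : ∀ n → 4 ≤ n → I³ n → BetweennessStructure n
𝓡³ (suc (suc (suc k))) (s≤s (s≤s (s≤s _))) i = Induced.structure (R³ k (index³ i)) (R-connected k (index³ i) 2)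

𝓢³ : ∀ n → 4 ≤ n → BetweennessStructure n
𝓢³ (suc (suc (suc k))) (s≤s (s≤s (s≤s _))) =
  Induced.structure (S³ k) (add-connected k _ _ (1 + k) _ (pendant-connected k zero (fromℕ k) 1 2))

𝓠² : ∀ n → 3 ≤ n → BetweennessStructure n
𝓠² (suc (suc (suc k))) (s≤s (s≤s (s≤s _))) =
  Induced.structure (Q² k) (add-connected k _ _ 1 _ (pendant-connected k zero zero 1 1))

𝓡² : ∀ n → 4 ≤ n → I² n → BetweennessStructure n
𝓡² (suc (suc (suc k))) (s≤s (s≤s (s≤s _))) i =
  Induced.structure (R² k (index² i)) (add-connected k _ _ 1 _ (R-connected k (index² i) 1))

𝓢² : ∀ n → 3 ≤ n → BetweennessStructure n
𝓢² (suc (suc (suc k))) (s≤s (s≤s (s≤s _))) =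
  Induced.structure (S² k) (add-connected k _ _ (1 + k) _ (pendant-connected k zero (fromℕ k) 1 1))

module Submission where

-- Let n be the order and τ the co-size.  If the points other than q form a path w, then P4
-- restricts how q can lie relative to the pairs of points of w.  If no point of w is in two
-- triangles with q, then, as inspection of five consecutive points shows, q can be inserted into
-- w; in particular linear structures of order at least 5 are paths.
--
-- By induction on n, if 0 < τ ≤ 2n - 11, then all triangles contain two common points.  A point p
-- can be deleted so that the bound is preserved, since n < 3τ if τ = 2n - 11, and then some point
-- is in two triangles.  If all triangles avoiding p contain y and z, then there are at least n - 5
-- of them, so at most n - 6 triangles avoid y; this is less than (n - 1) - 4, hence none does, and
-- the same holds for z.  If no triangle avoids p, another point is in two triangles and the
-- argument is repeated with it.
--
-- If all triangles contain y and z, then y and z can both be inserted into the path x of the other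
-- points, either at the same place or at opposite ends.  At most two of the x_j are collinear with
-- y and z, namely the neighbours of y and z or the ends of x, and these determine the structure
-- up to isomorphism and its co-size n - 4, n - 3 or n - 2.

open import Defs
open import Data.Bool using (Bool; true; false; if_then_else_)
open import Data.Empty using (⊥-elim; ⊥)
open import Data.Fin
  using (Fin; zero; suc; punchIn; punchOut; toℕ; opposite; fromℕ; fromℕ<; inject₁; remQuot;
    combine; splitAt)
open import Data.Fin.Induction using (<-weakInduction)
open import Data.Fin.Permutation using (Permutation; _⟨$⟩ʳ_; _⟨$⟩ˡ_)
open import Data.Fin.Subset
  using (Subset; inside; outside; ∣_∣; _∪_; ⁅_⁆) renaming (_∈_ to _∈ˢ_; _∉_ to _∉ˢ_)
open import Data.Fin.Subset.Properties using (x∈⁅x⁆; x∈⁅y⁆⇒x≡y; x∈p∪q⁺; x∈p∪q⁻; ⊆-antisym)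
open import Data.List using (List; []; _∷_; _++_; map; filter; length; allFin; lookup)
open import Data.List.Membership.Propositional using (_∈_; _∉_)
open import Data.List.Membership.Propositional.Properties
  using (∈-map⁺; ∈-map⁻; ∈-++⁺ˡ; ∈-++⁺ʳ; ∈-++⁻; ∈-filter⁺; ∈-filter⁻; ∈-allFin; ∈-∃++; ∈-lookup)
open import Data.List.Properties using (length-map; length-++; length-tabulate)
open import Data.List.Relation.Unary.All using ([]; _∷_)
open import Data.List.Relation.Unary.AllPairs using ([]; _∷_)
open import Data.List.Relation.Unary.Any using (here; there)
open import Data.List.Relation.Unary.Unique.Propositional using (Unique)
open import Data.Maybe using (just)
open import Data.Maybe.Properties using (just-injective)
open import Data.Nat using (ℕ; zero; suc; z≤n; s≤s; NonZero)
open import Data.Nat.Solver using (module +-*-Solver)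
open import Data.Product using (∃; _×_; _,_; proj₁; proj₂; ∃₂; uncurry; Σ-syntax)
open import Data.Sum using (_⊎_; inj₁; inj₂)
open import Function using (_∘_; id; mk⇔; Equivalence; _⇔_)
open import Relation.Binary.Definitions using (tri<; tri≈; tri>)
open import Relation.Binary.PropositionalEquality
open import Relation.Nullary using (Dec; yes; no; ¬_; ¬?; contradiction; _×-dec_; _⊎-dec_; does)
open import Relation.Nullary.Decidable using (False)
import Data.Fin.Permutation as Perm
import Data.Fin.Properties as Fin
import Data.Fin.Subset.Properties as Subset
import Data.Integer as ℤ
import Data.Integer.Properties as ℤ
import Data.List.Relation.Unary.All as All
import Data.List.Relation.Unary.All.Properties as All
import Data.List.Relation.Unary.Unique.Propositional.Properties as Unique
import Data.Nat as ℕ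
import Data.Nat.Properties as ℕ
import Data.Sum as Sum
import Data.Vec as Vec
import Data.Vec.Properties as Vec

-- The bound `τ ≤ 2 n - 11` is the origin of `N_c`: for `τ = n - c` it says `n ≥ 11 - c`. It is
-- sharp, because two pairs of twins on neighbouring levels of a line produce `2 n - 10` triangles,
-- two of them disjoint; this is the example for `n = N_c - 1`. For `c > 4` the bound is automatic
-- once there is a triangle, since then `n ≥ 6` and `τ ≤ n - 5`.
--
-- An obstacle is the 4-cycle, which has no triangle and yet is not a path. Three points of a path
-- therefore do not determine where a further point belongs, and windows of four or five points are
-- needed.
--
-- Isomorphisms with the families are not built one by one. An abstract structure and one induced by
-- a graph are both brought to a `Form`, which consists of two cuts of the path and a label for each
-- `xⱼ`; equal forms give isomorphic structures, and the co-size can be read off. The distances in a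
-- graph are squeezed: a metric that no edge undercuts bounds them from below, and walks along the
-- edges bound them from above.

-- Triangles, their number, and the deletion of a point

module Triangles where

  open import Data.Fin.Properties using (_≟_; punchIn-injective; punchIn-punchOut)
  open import Data.Nat using (_+_; _≤_)

  open BetweennessStructure

  module _ {A : Set} where

    Unique-⊆⇒length≤ : ∀ {xs ys : List A} → Unique xs → (∀ {v} → v ∈ xs → v ∈ ys) → length xs ≤ length ys
    Unique-⊆⇒length≤ []               sub = z≤n
    Unique-⊆⇒length≤ {xs = x ∷ xs} (x∉ ∷ u) sub with ∈-∃++ (sub (here refl))
    ... | as , bs , refl = subst (suc (length xs) ≤_) eq (s≤s (Unique-⊆⇒length≤ u sub′))
      where
      eq : suc (length (as ++ bs)) ≡ length (as ++ x ∷ bs)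
      eq = trans (cong suc (length-++ as)) (trans (sym (ℕ.+-suc (length as) _)) (sym (length-++ as)))
      sub′ : ∀ {v} → v ∈ xs → v ∈ as ++ bs
      sub′ v∈ with ∈-++⁻ as (sub (there v∈))
      ... | inj₁ p            = ∈-++⁺ˡ p
      ... | inj₂ (here refl)  = contradiction refl (All.lookup x∉ v∈)
      ... | inj₂ (there p)    = ∈-++⁺ʳ as p

    module _ {m} {f : Fin m → A} (f-injective : ∀ {i j} → f i ≡ f j → i ≡ j)
             {as : List A} {bs : List (Fin m)} (as! : Unique as) (bs! : Unique bs)
             (as⊆f : ∀ {a} → a ∈ as → ∃ λ j → a ≡ f j) (disjoint : ∀ {j} → f j ∈ as → j ∉ bs)
             (covered : ∀ j → f j ∈ as ⊎ j ∈ bs) where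

      -- Every exact co-size below is found in this way: `as` are the triangles, `f` enumerates the
      -- candidates, and `bs` lists the indices whose candidate is collinear.
      partition-length : length as + length bs ≡ m
      partition-length = trans (sym lhs) (trans
        (ℕ.≤-antisym (Unique-⊆⇒length≤ (Unique.++⁺ as! (Unique.map⁺ f-injective bs!) disjoint′) into)
                     (Unique-⊆⇒length≤ (Unique.map⁺ f-injective (Unique.allFin⁺ m)) onto)) rhs)
        where
        lhs : length (as ++ map f bs) ≡ length as + length bs
        lhs = trans (length-++ as) (cong (length as +_) (length-map f bs))
        rhs : length (map f (allFin m)) ≡ m
        rhs = trans (length-map f (allFin m)) (length-tabulate id)
        disjoint′ : ∀ {v} → ¬ (v ∈ as × v ∈ map f bs)
        disjoint′ (v∈ , v∈′) with ∈-map⁻ f v∈′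
        ... | j , j∈ , refl = disjoint v∈ j∈
        into : ∀ {v} → v ∈ as ++ map f bs → v ∈ map f (allFin m)
        into v∈ with ∈-++⁻ as v∈
        ... | inj₁ q with as⊆f q
        ...   | j , refl = ∈-map⁺ f (∈-allFin j)
        into v∈ | inj₂ q with ∈-map⁻ f q
        ...   | j , _ , refl = ∈-map⁺ f (∈-allFin j)
        onto : ∀ {v} → v ∈ map f (allFin m) → v ∈ as ++ map f bs
        onto v∈ with ∈-map⁻ f v∈
        ... | j , _ , refl with covered j
        ...   | inj₁ q = ∈-++⁺ˡ q
        ...   | inj₂ q = ∈-++⁺ʳ as (∈-map⁺ f q)

  private variable
    n : ℕ

  -- A value missed by `f` could be taken as the image of one more point, which would inject
  -- `Fin (suc n)` into `Fin n`.
  injective⇒surjective : ∀ {f : Fin n → Fin n} → (∀ {i j} → f i ≡ f j → i ≡ j) → ∀ v → ∃ λ i → f i ≡ v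
  injective⇒surjective {n} {f} f-injective v with Fin.any? (λ j → f j ≟ v)
  ... | yes found = found
  ... | no none = contradiction (Fin.injective⇒≤ {f = g} g-injective) ℕ.1+n≰n
    where
    g : Fin (suc n) → Fin n
    g zero    = v
    g (suc j) = f j
    g-injective : ∀ {i j} → g i ≡ g j → i ≡ j
    g-injective {zero}  {zero}  _  = refl
    g-injective {zero}  {suc j} eq = contradiction (j , sym eq) none
    g-injective {suc i} {zero}  eq = contradiction (i , eq) none
    g-injective {suc i} {suc j} eq = cong suc (f-injective eq)

  tset : Fin n → Fin n → Fin n → Subset n
  tset a b c = ⁅ a ⁆ ∪ ⁅ b ⁆ ∪ ⁅ c ⁆

  OneOf : Fin n → Fin n → Fin n → Fin n → Set
  OneOf v a b c = v ≡ a ⊎ v ≡ b ⊎ v ≡ c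

  oneOf? : (v a b c : Fin n) → Dec (OneOf v a b c)
  oneOf? v a b c = (v ≟ a) ⊎-dec (v ≟ b) ⊎-dec (v ≟ c)

  pattern 1st p = inj₁ p
  pattern 2nd p = inj₂ (inj₁ p)
  pattern 3rd p = inj₂ (inj₂ p)

  oneOf-converse : ∀ {a b c a′ b′ c′ : Fin n} → a ≢ b → a ≢ c → b ≢ c → OneOf a a′ b′ c′ →
    OneOf b a′ b′ c′ → OneOf c a′ b′ c′ →
         OneOf a′ a b c × OneOf b′ a b c × OneOf c′ a b c
  oneOf-converse _ _ _ (1st refl) (2nd refl) (3rd refl) = 1st refl , 2nd refl , 3rd refl
  oneOf-converse _ _ _ (1st refl) (3rd refl) (2nd refl) = 1st refl , 3rd refl , 2nd refl
  oneOf-converse _ _ _ (2nd refl) (1st refl) (3rd refl) = 2nd refl , 1st refl , 3rd refl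
  oneOf-converse _ _ _ (2nd refl) (3rd refl) (1st refl) = 3rd refl , 1st refl , 2nd refl
  oneOf-converse _ _ _ (3rd refl) (1st refl) (2nd refl) = 2nd refl , 3rd refl , 1st refl
  oneOf-converse _ _ _ (3rd refl) (2nd refl) (1st refl) = 3rd refl , 2nd refl , 1st refl
  oneOf-converse ne _ _ (1st refl) (1st refl) _ = contradiction refl ne
  oneOf-converse ne _ _ (2nd refl) (2nd refl) _ = contradiction refl ne
  oneOf-converse ne _ _ (3rd refl) (3rd refl) _ = contradiction refl ne
  oneOf-converse _ ne _ (1st refl) _ (1st refl) = contradiction refl ne
  oneOf-converse _ ne _ (2nd refl) _ (2nd refl) = contradiction refl ne
  oneOf-converse _ ne _ (3rd refl) _ (3rd refl) = contradiction refl ne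
  oneOf-converse _ _ ne _ (1st refl) (1st refl) = contradiction refl ne
  oneOf-converse _ _ ne _ (2nd refl) (2nd refl) = contradiction refl ne
  oneOf-converse _ _ ne _ (3rd refl) (3rd refl) = contradiction refl ne

  ∈-tset⁺ : ∀ {v a b c : Fin n} → OneOf v a b c → v ∈ˢ tset a b c
  ∈-tset⁺ {a = a}         (1st refl) = x∈p∪q⁺ (inj₁ (x∈⁅x⁆ a))
  ∈-tset⁺ {b = b}         (2nd refl) = x∈p∪q⁺ (inj₂ (x∈p∪q⁺ (inj₁ (x∈⁅x⁆ b))))
  ∈-tset⁺ {c = c}         (3rd refl) = x∈p∪q⁺ (inj₂ (x∈p∪q⁺ (inj₂ (x∈⁅x⁆ c))))

  ∈-tset⁻ : ∀ {v a b c : Fin n} → v ∈ˢ tset a b c → OneOf v a b c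
  ∈-tset⁻ {a = a} {b} {c} v∈ with x∈p∪q⁻ ⁅ a ⁆ (⁅ b ⁆ ∪ ⁅ c ⁆) v∈
  ... | inj₁ p = 1st (x∈⁅y⁆⇒x≡y a p)
  ... | inj₂ q with x∈p∪q⁻ ⁅ b ⁆ ⁅ c ⁆ q
  ...   | inj₁ p = 2nd (x∈⁅y⁆⇒x≡y b p)
  ...   | inj₂ p = 3rd (x∈⁅y⁆⇒x≡y c p)

  tset-⊆ : ∀ {a b c a′ b′ c′ : Fin n} → OneOf a a′ b′ c′ → OneOf b a′ b′ c′ → OneOf c a′ b′ c′ →
           ∀ {v} → v ∈ˢ tset a b c → v ∈ˢ tset a′ b′ c′
  tset-⊆ p q r v∈ with ∈-tset⁻ v∈
  ... | 1st refl = ∈-tset⁺ p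
  ... | 2nd refl = ∈-tset⁺ q
  ... | 3rd refl = ∈-tset⁺ r

  tset-≡ : ∀ {a b c a′ b′ c′ : Fin n} →
           OneOf a a′ b′ c′ → OneOf b a′ b′ c′ → OneOf c a′ b′ c′ →
           OneOf a′ a b c → OneOf b′ a b c → OneOf c′ a b c → tset a b c ≡ tset a′ b′ c′
  tset-≡ p q r p′ q′ r′ = ⊆-antisym (tset-⊆ p q r) (tset-⊆ p′ q′ r′)

  elements : Subset n → List (Fin n)
  elements Vec.[]            = []
  elements (outside Vec.∷ p) = map suc (elements p)
  elements (inside Vec.∷ p)  = zero ∷ map suc (elements p)

  length-elements : (p : Subset n) → length (elements p) ≡ ∣ p ∣
  length-elements Vec.[]            = refl
  length-elements (outside Vec.∷ p) = trans (length-map suc (elements p)) (length-elements p)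
  length-elements (inside Vec.∷ p)  = cong suc (trans (length-map suc (elements p)) (length-elements p))

  ∈-elements⁺ : ∀ {v} {p : Subset n} → v ∈ˢ p → v ∈ elements p
  ∈-elements⁺ {p = inside Vec.∷ p}  Vec.here       = here refl
  ∈-elements⁺ {p = outside Vec.∷ p} (Vec.there v∈) = ∈-map⁺ suc (∈-elements⁺ v∈)
  ∈-elements⁺ {p = inside Vec.∷ p}  (Vec.there v∈) = there (∈-map⁺ suc (∈-elements⁺ v∈))

  ∈-elements⁻ : ∀ {v} {p : Subset n} → v ∈ elements p → v ∈ˢ p
  ∈-elements⁻ {p = outside Vec.∷ p} v∈ with ∈-map⁻ suc v∈
  ... | _ , w∈ , refl = Vec.there (∈-elements⁻ w∈)
  ∈-elements⁻ {p = inside Vec.∷ p} (here refl) = Vec.here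
  ∈-elements⁻ {p = inside Vec.∷ p} (there v∈) with ∈-map⁻ suc v∈
  ... | _ , w∈ , refl = Vec.there (∈-elements⁻ w∈)

  elements-unique : (p : Subset n) → Unique (elements p)
  elements-unique Vec.[]            = []
  elements-unique (outside Vec.∷ p) = Unique.map⁺ Fin.suc-injective (elements-unique p)
  elements-unique (inside Vec.∷ p)  =
    All.map⁺ (All.tabulate (λ _ ())) ∷ Unique.map⁺ Fin.suc-injective (elements-unique p)

  ∣tset∣ : ∀ {a b c : Fin n} → a ≢ b → a ≢ c → b ≢ c → ∣ tset a b c ∣ ≡ 3
  ∣tset∣ {a = a} {b} {c} a≢b a≢c b≢c = trans (sym (length-elements (tset a b c)))
    (ℕ.≤-antisym (Unique-⊆⇒length≤ (elements-unique (tset a b c)) (to ∘ ∈-tset⁻ ∘ ∈-elements⁻))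
                 (Unique-⊆⇒length≤ ((a≢b ∷ a≢c ∷ []) ∷ (b≢c ∷ []) ∷ [] ∷ []) (∈-elements⁺ ∘ ∈-tset⁺ ∘ from)))
    where
    to : ∀ {v} → OneOf v a b c → v ∈ a ∷ b ∷ c ∷ []
    to (1st p) = here p
    to (2nd p) = there (here p)
    to (3rd p) = there (there (here p))
    from : ∀ {v} → v ∈ a ∷ b ∷ c ∷ [] → OneOf v a b c
    from (here p)                 = 1st p
    from (there (here p))         = 2nd p
    from (there (there (here p))) = 3rd p

  ∣p∣≡3⇒tset : ∀ (p : Subset n) → ∣ p ∣ ≡ 3 →
               ∃ λ a → ∃ λ b → ∃ λ c → p ≡ tset a b c × a ≢ b × a ≢ c × b ≢ c
  ∣p∣≡3⇒tset {n} p ∣p∣≡3 =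
    go (elements p) ∈-elements⁺ ∈-elements⁻ (elements-unique p) (trans (length-elements p) ∣p∣≡3)
    where
    go : (xs : List (Fin n)) → (∀ {v} → v ∈ˢ p → v ∈ xs) → (∀ {v} → v ∈ xs → v ∈ˢ p) → Unique xs → length xs ≡ 3 →
         ∃ λ a → ∃ λ b → ∃ λ c → p ≡ tset a b c × a ≢ b × a ≢ c × b ≢ c
    go (a ∷ b ∷ c ∷ []) in⁺ in⁻ ((a≢b ∷ a≢c ∷ []) ∷ (b≢c ∷ []) ∷ _) _ =
      a , b , c , ⊆-antisym (λ v∈ → ∈-tset⁺ (to (in⁺ v∈))) (λ v∈ → in⁻ (from (∈-tset⁻ v∈))) , a≢b , a≢c , b≢c
      where
      to : ∀ {v} → v ∈ a ∷ b ∷ c ∷ [] → OneOf v a b c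
      to (here q)                 = 1st q
      to (there (here q))         = 2nd q
      to (there (there (here q))) = 3rd q
      from : ∀ {v} → OneOf v a b c → v ∈ a ∷ b ∷ c ∷ []
      from (1st q) = here q
      from (2nd q) = there (here q)
      from (3rd q) = there (there (here q))

  subsets-complete : (p : Subset n) → p ∈ subsets n
  subsets-complete Vec.[]            = here refl
  subsets-complete (outside Vec.∷ p) = ∈-++⁺ˡ (∈-map⁺ (outside Vec.∷_) (subsets-complete p))
  subsets-complete {suc n} (inside Vec.∷ p) =
    ∈-++⁺ʳ (map (outside Vec.∷_) (subsets n)) (∈-map⁺ (inside Vec.∷_) (subsets-complete p))

  subsets-unique : ∀ n → Unique (subsets n)
  subsets-unique zero    = [] ∷ []
  subsets-unique (suc n) = Unique.++⁺ (Unique.map⁺ Vec.∷-injectiveʳ (subsets-unique n))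
                                      (Unique.map⁺ Vec.∷-injectiveʳ (subsets-unique n)) disjoint
    where
    disjoint : ∀ {v} → ¬ (v ∈ map (outside Vec.∷_) (subsets n) × v ∈ map (inside Vec.∷_) (subsets n))
    disjoint (p , q) with ∈-map⁻ (outside Vec.∷_) p | ∈-map⁻ (inside Vec.∷_) q
    ... | _ , _ , refl | _ , _ , ()

  module _ (𝓑 : BetweennessStructure n) where

    β-ends : ∀ {x y} → β 𝓑 x y x → x ≡ y
    β-ends {x} {y} b = P3 𝓑 x y x b (P2 𝓑 x x y (P1 𝓑 x y))

    -- The points are distinct, since degenerate triples are in β.
    Tri : Fin n → Fin n → Fin n → Set
    Tri a b c = ¬ β 𝓑 a b c × ¬ β 𝓑 b a c × ¬ β 𝓑 a c b

    tri? : ∀ a b c → Dec (Tri a b c)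
    tri? a b c = ¬? (β? 𝓑 a b c) ×-dec ¬? (β? 𝓑 b a c) ×-dec ¬? (β? 𝓑 a c b)

    collinear-or-tri : ∀ a b c → (β 𝓑 a b c ⊎ β 𝓑 b a c ⊎ β 𝓑 a c b) ⊎ Tri a b c
    collinear-or-tri a b c with β? 𝓑 a b c | β? 𝓑 b a c | β? 𝓑 a c b
    ... | yes p | _     | _     = inj₁ (1st p)
    ... | no _  | yes p | _     = inj₁ (2nd p)
    ... | no _  | no _  | yes p = inj₁ (3rd p)
    ... | no p  | no q  | no r  = inj₂ (p , q , r)

    tri-distinct : ∀ {a b c} → Tri a b c → a ≢ b × a ≢ c × b ≢ c
    tri-distinct {a} {b} {c} (p , q , r) =
      (λ { refl → p (P1 𝓑 a c) }) , (λ { refl → q (P2 𝓑 _ _ _ (P1 𝓑 a b)) }) , (λ { refl → p (P2 𝓑 _ _ _ (P1 𝓑 b a)) })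

    tri-swap : ∀ {a b c} → Tri a b c → Tri b a c
    tri-swap (p , q , r) = q , p , r ∘ P2 𝓑 _ _ _

    tri-rot : ∀ {a b c} → Tri a b c → Tri b c a
    tri-rot (p , q , r) = r ∘ P2 𝓑 _ _ _ , p ∘ P2 𝓑 _ _ _ , q

    tri-perm : ∀ {a b c x y z} → Tri a b c → OneOf a x y z → OneOf b x y z → OneOf c x y z → Tri x y z
    tri-perm t p q r with tri-distinct t | p | q | r
    ... | _ | 1st refl | 2nd refl | 3rd refl = t
    ... | _ | 1st refl | 3rd refl | 2nd refl = tri-swap (tri-rot (tri-rot t))
    ... | _ | 2nd refl | 1st refl | 3rd refl = tri-swap t
    ... | _ | 2nd refl | 3rd refl | 1st refl = tri-rot (tri-rot t)
    ... | _ | 3rd refl | 1st refl | 2nd refl = tri-rot t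
    ... | _ | 3rd refl | 2nd refl | 1st refl = tri-swap (tri-rot t)
    ... | ne , _ | 1st refl | 1st refl | _ = contradiction refl ne
    ... | ne , _ | 2nd refl | 2nd refl | _ = contradiction refl ne
    ... | ne , _ | 3rd refl | 3rd refl | _ = contradiction refl ne
    ... | _ , ne , _ | 1st refl | _ | 1st refl = contradiction refl ne
    ... | _ , ne , _ | 2nd refl | _ | 2nd refl = contradiction refl ne
    ... | _ , ne , _ | 3rd refl | _ | 3rd refl = contradiction refl ne
    ... | _ , _ , ne | _ | 1st refl | 1st refl = contradiction refl ne
    ... | _ , _ , ne | _ | 2nd refl | 2nd refl = contradiction refl ne
    ... | _ , _ , ne | _ | 3rd refl | 3rd refl = contradiction refl ne

    tri⇒triangle : ∀ {a b c} → Tri a b c → Triangle 𝓑 (tset a b c)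
    tri⇒triangle {a} {b} {c} t = ∣tset∣ (proj₁ ds) (proj₁ (proj₂ ds)) (proj₂ (proj₂ ds)) , ¬collinear
      where
      ds = tri-distinct t
      ¬collinear : ¬ Collinear 𝓑 (tset a b c)
      ¬collinear (x , y , z , eq , xyz) = proj₁ (tri-perm t (in′ (1st refl)) (in′ (2nd refl)) (in′ (3rd refl))) xyz
        where
        in′ : ∀ {v} → OneOf v a b c → OneOf v x y z
        in′ {v} o = ∈-tset⁻ (subst (v ∈ˢ_) (sym eq) (∈-tset⁺ o))

    triangle⇒tri : ∀ {p} → Triangle 𝓑 p → ∃ λ a → ∃ λ b → ∃ λ c → p ≡ tset a b c × Tri a b c
    triangle⇒tri {p} (∣p∣≡3 , ¬col) with ∣p∣≡3⇒tset p ∣p∣≡3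
    ... | a , b , c , refl , _ = a , b , c , refl ,
      ( (λ q → ¬col (a , b , c , refl , q))
      , (λ q → ¬col (b , a , c , tset-≡ (2nd refl) (1st refl) (3rd refl) (2nd refl) (1st refl) (3rd refl) , q))
      , (λ q → ¬col (a , c , b , tset-≡ (1st refl) (3rd refl) (2nd refl) (1st refl) (3rd refl) (2nd refl) , q)) )

    triangle-members : ∀ {a b c} → Triangle 𝓑 (tset a b c) → Tri a b c
    triangle-members {a} {b} {c} tr with triangle⇒tri tr
    ... | x , y , z , eq , t = tri-perm t (in′ (1st refl)) (in′ (2nd refl)) (in′ (3rd refl))
      where
      in′ : ∀ {v} → OneOf v x y z → OneOf v a b c
      in′ {v} o = ∈-tset⁻ (subst (v ∈ˢ_) (sym eq) (∈-tset⁺ o))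

    -- Opaque, since `subsets n` is exponentially long.
    opaque

      triangles : List (Subset n)
      triangles = filter (triangle? 𝓑) (subsets n)

      triangles-unique : Unique triangles
      triangles-unique = Unique.filter⁺ (triangle? 𝓑) (subsets-unique n)

      ∈-triangles⁺ : ∀ {p} → Triangle 𝓑 p → p ∈ triangles
      ∈-triangles⁺ {p} = ∈-filter⁺ (triangle? 𝓑) (subsets-complete p)

      ∈-triangles⁻ : ∀ {p} → p ∈ triangles → Triangle 𝓑 p
      ∈-triangles⁻ p∈ = proj₂ (∈-filter⁻ (triangle? 𝓑) {xs = subsets n} p∈)

      coSize≡∣triangles∣ : coSize 𝓑 ≡ length triangles
      coSize≡∣triangles∣ = refl

    τ : ℕ
    τ = length triangles

    length≤τ : ∀ {xs} → Unique xs → (∀ {p} → p ∈ xs → Triangle 𝓑 p) → length xs ≤ τ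
    length≤τ u tr = Unique-⊆⇒length≤ u (∈-triangles⁺ ∘ tr)

    τ≤length : ∀ {xs} → (∀ {p} → Triangle 𝓑 p → p ∈ xs) → τ ≤ length xs
    τ≤length sub = Unique-⊆⇒length≤ triangles-unique (sub ∘ ∈-triangles⁻)

    NoTri : Set
    NoTri = ∀ {a b c} → ¬ Tri a b c

    τ≡0⇒noTri : τ ≡ 0 → NoTri
    τ≡0⇒noTri eq {a} {b} {c} t =
      contradiction (subst (1 ≤_) eq (length≤τ {xs = tset a b c ∷ []} ([] ∷ []) λ { (here refl) → tri⇒triangle t })) λ ()

    noTri⇒τ≡0 : NoTri → τ ≡ 0
    noTri⇒τ≡0 none =
      ℕ.n≤0⇒n≡0 (τ≤length {xs = []} λ tr → ⊥-elim (none (proj₂ (proj₂ (proj₂ (proj₂ (triangle⇒tri tr)))))))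

    τ≢0⇒tri : τ ≢ 0 → ∃ λ a → ∃ λ b → ∃ λ c → Tri a b c
    τ≢0⇒tri ne with triangles | ∈-triangles⁻
    ... | []    | _  = contradiction refl ne
    ... | p ∷ _ | tr with triangle⇒tri (tr (here refl))
    ...   | a , b , c , _ , t = a , b , c , t

  module _ (𝓑 : BetweennessStructure (suc (suc n))) where

    infixl 6 _∖_

    _∖_ : Fin (suc (suc n)) → BetweennessStructure (suc n)
    _∖_ p = record
      { nonEmpty = _
      ; β  = λ x y z → β 𝓑 (punchIn p x) (punchIn p y) (punchIn p z)
      ; β? = λ x y z → β? 𝓑 (punchIn p x) (punchIn p y) (punchIn p z)
      ; P1 = λ x z → P1 𝓑 _ _
      ; P2 = λ x y z → P2 𝓑 _ _ _
      ; P3 = λ x y z b c → punchIn-injective p x y (P3 𝓑 _ _ _ b c)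
      ; P4 = λ x y z w → P4 𝓑 _ _ _ _
      }

    module _ (p : Fin (suc (suc n))) where

      embed : Subset (suc n) → Subset (suc (suc n))
      embed e = Vec.insertAt e p outside

      embed-injective : ∀ {e f} → embed e ≡ embed f → e ≡ f
      embed-injective {e} {f} eq =
        trans (sym (Vec.removeAt-insertAt e p outside)) (trans (cong (λ g → Vec.removeAt g p) eq) (Vec.removeAt-insertAt f p outside))

      p∉embed : ∀ e → p ∉ˢ embed e
      p∉embed e p∈ = contradiction (trans (sym (Vec.insertAt-lookup e p outside)) (Vec.[]=⇒lookup p∈)) λ ()

      ∈-embed⁺ : ∀ {e j} → j ∈ˢ e → punchIn p j ∈ˢ embed e
      ∈-embed⁺ {e} {j} j∈ = Vec.lookup⇒[]= _ _ (trans (Vec.insertAt-punchIn e p outside j) (Vec.[]=⇒lookup j∈))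

      ∈-embed⁻ : ∀ {e j} → punchIn p j ∈ˢ embed e → j ∈ˢ e
      ∈-embed⁻ {e} {j} j∈ =
        Vec.lookup⇒[]= _ _ (trans (sym (Vec.insertAt-punchIn e p outside j)) (Vec.[]=⇒lookup j∈))

      embed-tset : ∀ a b c → embed (tset a b c) ≡ tset (punchIn p a) (punchIn p b) (punchIn p c)
      embed-tset a b c = ⊆-antisym to from
        where
        to : ∀ {v} → v ∈ˢ embed (tset a b c) → v ∈ˢ tset (punchIn p a) (punchIn p b) (punchIn p c)
        to {v} v∈ with p ≟ v
        ... | yes refl = contradiction v∈ (p∉embed (tset a b c))
        ... | no p≢v with punchOut p≢v | punchIn-punchOut p≢v
        ...   | j | refl with ∈-tset⁻ (∈-embed⁻ {tset a b c} {j} v∈)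
        ...     | 1st refl = ∈-tset⁺ (1st refl)
        ...     | 2nd refl = ∈-tset⁺ (2nd refl)
        ...     | 3rd refl = ∈-tset⁺ (3rd refl)
        from : ∀ {v} → v ∈ˢ tset (punchIn p a) (punchIn p b) (punchIn p c) → v ∈ˢ embed (tset a b c)
        from v∈ with ∈-tset⁻ v∈
        ... | 1st refl = ∈-embed⁺ {tset a b c} (∈-tset⁺ (1st refl))
        ... | 2nd refl = ∈-embed⁺ {tset a b c} (∈-tset⁺ (2nd refl))
        ... | 3rd refl = ∈-embed⁺ {tset a b c} (∈-tset⁺ (3rd refl))

      embed-triangle : ∀ {e} → Triangle (_∖_ p) e → Triangle 𝓑 (embed e)
      embed-triangle tr with triangle⇒tri (_∖_ p) tr
      ... | a , b , c , refl , t = subst (Triangle 𝓑) (sym (embed-tset a b c)) (tri⇒triangle 𝓑 t)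

      embedded : List (Subset (suc (suc n)))
      embedded = map embed (triangles (_∖_ p))

      embedded-unique : Unique embedded
      embedded-unique = Unique.map⁺ embed-injective (triangles-unique (_∖_ p))

      ∈-embedded⁻ : ∀ {e} → e ∈ embedded → Triangle 𝓑 e × p ∉ˢ e
      ∈-embedded⁻ e∈ with ∈-map⁻ embed e∈
      ... | f , f∈ , refl = embed-triangle (∈-triangles⁻ (_∖_ p) f∈) , p∉embed f

      length-embedded : length embedded ≡ τ (_∖_ p)
      length-embedded = length-map embed (triangles (_∖_ p))

      -- The embedded triangles of `𝓑 ∖ p` avoid `p` while those in `xs` contain it, so the two
      -- lists can be joined without repetition.
      τ-∖ : ∀ {xs} → Unique xs → (∀ {e} → e ∈ xs → Triangle 𝓑 e × p ∈ˢ e) →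
                 τ (_∖_ p) + length xs ≤ τ 𝓑
      τ-∖ {xs} u tr = subst (_≤ τ 𝓑) (trans (length-++ embedded) (cong (_+ length xs) length-embedded))
        (length≤τ 𝓑 (Unique.++⁺ embedded-unique u (λ (q , r) → proj₂ (∈-embedded⁻ q) (proj₂ (tr r)))) both)
        where
        both : ∀ {e} → e ∈ embedded ++ xs → Triangle 𝓑 e
        both e∈ with ∈-++⁻ embedded e∈
        ... | inj₁ q = proj₁ (∈-embedded⁻ q)
        ... | inj₂ q = proj₁ (tr q)

      τ-∖₁ : ∀ {e} → Triangle 𝓑 e → p ∈ˢ e → τ (_∖_ p) + 1 ≤ τ 𝓑
      τ-∖₁ {e} tr p∈ = τ-∖ {e ∷ []} ([] ∷ []) λ { (here refl) → tr , p∈ }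

      τ-∖₂ : ∀ {e f} → e ≢ f → Triangle 𝓑 e → p ∈ˢ e → Triangle 𝓑 f → p ∈ˢ f → τ (_∖_ p) + 2 ≤ τ 𝓑
      τ-∖₂ {e} {f} e≢f tr p∈ tr′ p∈′ = τ-∖ {e ∷ f ∷ []} ((e≢f ∷ []) ∷ [] ∷ [])
        λ { (here refl) → tr , p∈ ; (there (here refl)) → tr′ , p∈′ }

    -- The triangles that avoid `p` all contain `z`, so none of them is counted among those that
    -- avoid `z`.
    τ-∖-∖ : ∀ p z → (∀ {e} → Triangle (_∖_ p) e → z ∈ˢ embed p e) → τ (_∖_ z) + τ (_∖_ p) ≤ τ 𝓑
    τ-∖-∖ p z all∋z = subst (λ l → τ (_∖_ z) + l ≤ τ 𝓑) (length-embedded p)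
      (τ-∖ z (embedded-unique p) both)
      where
      both : ∀ {e} → e ∈ embedded p → Triangle 𝓑 e × z ∈ˢ e
      both e∈ with ∈-map⁻ (embed p) e∈
      ... | f , f∈ , refl = embed-triangle p (∈-triangles⁻ (_∖_ p) f∈) , all∋z (∈-triangles⁻ (_∖_ p) f∈)

-- The position of a point relative to a path

module PathStates where

  open Triangles
  open import Data.Nat using (>-nonZero; pred; _+_; _∸_; _≤_; _<_)

  open BetweennessStructure

  -- The position of a point q relative to w i, w j with i < j: before both (L),
  -- between them (M), after both (R), or in a triangle with them (T).
  data State : Set where
    L M R T : State

  -- The states of (i,j), (j,k), (i,k), for i < j < k, when none of the three is T.
  data Okᴸᴹᴿ : State → State → State → Set where
    mlm : Okᴸᴹᴿ M L M
    rmm : Okᴸᴹᴿ R M M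
    lll : Okᴸᴹᴿ L L L
    rrr : Okᴸᴹᴿ R R R
    lrm : Okᴸᴹᴿ L R M

  -- The same when at most one of the three is T.
  data Okᵀ : State → State → State → Set where
    mlm : Okᵀ M L M
    rmm : Okᵀ R M M
    lll : Okᵀ L L L
    rrr : Okᵀ R R R
    lrm : Okᵀ L R M
    ltm : Okᵀ L T M
    trm : Okᵀ T R M
    rlt : Okᵀ R L T
    lrt : Okᵀ L R T

  -- Exhaustive case analysis over the states of four, respectively five, consecutive points.
  window₄ : ∀ {s01 s02 s03 s12 s13 s23} →
    Okᴸᴹᴿ s01 s12 s02 → Okᴸᴹᴿ s12 s23 s13 → Okᴸᴹᴿ s01 s13 s03 → Okᴸᴹᴿ s02 s23 s03 →
    s01 ≡ M ⊎ s12 ≡ M ⊎ s23 ≡ M ⊎ s03 ≡ L ⊎ s03 ≡ R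
  window₄ mlm lll mlm mlm = inj₁ refl
  window₄ mlm lrm () _
  window₄ rmm mlm rmm mlm = inj₂ (inj₁ refl)
  window₄ lll lll lll lll = inj₂ (inj₂ (inj₂ (inj₁ refl)))
  window₄ lll lrm () _
  window₄ rrr rmm rmm rmm = inj₂ (inj₂ (inj₁ refl))
  window₄ rrr rrr rrr rrr = inj₂ (inj₂ (inj₂ (inj₂ refl)))
  window₄ lrm rmm () _
  window₄ lrm rrr lrm ()

  window₅ : ∀ {s01 s02 s03 s04 s12 s13 s14 s23 s24 s34} →
    Okᵀ s01 s13 s03 → Okᵀ s03 s34 s04 → Okᵀ s12 s23 s13 → Okᵀ s01 s12 s02 → Okᵀ s23 s34 s24 → Okᵀ s12 s24 s14 → Okᵀ s13 s34 s14 → Okᵀ s01 s14 s04 → Okᵀ s02 s24 s04 → Okᵀ s02 s23 s03 →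
    s01 ≡ M ⊎ s12 ≡ M ⊎ s23 ≡ M ⊎ s34 ≡ M ⊎ s04 ≡ L ⊎ s04 ≡ R
  window₅ mlm mlm lll mlm lll lll lll mlm mlm mlm = inj₁ refl
  window₅ rmm mlm mlm rmm lll mlm mlm rmm mlm mlm = inj₂ (inj₁ refl)
  window₅ rmm mlm rmm rrr mlm rmm mlm rmm rmm rmm = inj₂ (inj₂ (inj₁ refl))
  window₅ rmm mlm lrm rlt rlt ltm mlm rmm () _
  window₅ rmm mlm ltm rlt () _ _ _ _ _
  window₅ rmm mlm trm () _ _ _ _ _ _
  window₅ lll lll lll lll lll lll lll lll lll lll = inj₂ (inj₂ (inj₂ (inj₂ (inj₁ refl))))
  window₅ lll lrm lll lll lrm () _ _ _ _
  window₅ lll lrm lll lll lrt ltm lrm () _ _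
  window₅ lll ltm lll lll ltm () _ _ _ _
  window₅ lll lrt lll lll lrm () _ _ _ _
  window₅ lll lrt lll lll lrt ltm lrm () _ _
  window₅ rrr rmm rrr rrr rmm rmm rmm rmm rmm rrr = inj₂ (inj₂ (inj₂ (inj₁ refl)))
  window₅ rrr rrr rrr rrr rrr rrr rrr rrr rrr rrr = inj₂ (inj₂ (inj₂ (inj₂ (inj₂ refl))))
  window₅ rrr rlt rrr rrr rlt () _ _ _ _
  window₅ lrm mlm rrr lrm rlt () _ _ _ _
  window₅ lrm mlm rrr lrt rlt () _ _ _ _
  window₅ ltm mlm rlt lrm lll rlt () _ _ _
  window₅ ltm mlm rlt lrt lll rlt () _ _ _
  window₅ ltm mlm lrt lll rlt ltm () _ _ _
  window₅ trm mlm rrr trm rlt () _ _ _ _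
  window₅ rlt trm lll rlt lrm () _ _ _ _
  window₅ rlt trm lll rlt lrt ltm lrm rmm () _
  window₅ lrt trm rrr lrm rrr rrr rrr lrm () _
  window₅ lrt trm rrr lrt rrr rrr rrr lrm trm ()

  module _ {n : ℕ} (𝓑 : BetweennessStructure n) where

    -- The points are indexed by all natural numbers, so that subpaths are obtained by composition;
    -- only the values below `m` are constrained.
    record Path (m : ℕ) (w : ℕ → Fin n) : Set where
      field
        distinct : ∀ {i j} → i < j → j < m → w i ≢ w j
        ordered  : ∀ {i j k} → i < j → j < k → k < m → β 𝓑 (w i) (w j) (w k)

    open Path

    -- `c` counts the points of the path that precede `q`. The last three fields are exactly the
    -- triples with `q` that the path gains when `q` is inserted there.
    record Cut (m : ℕ) (w : ℕ → Fin n) (q : Fin n) (c : ℕ) : Set where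
      field
        c≤m    : c ≤ m
        after  : ∀ {i j} → i < j → j < c → β 𝓑 (w i) (w j) q
        across : ∀ {i j} → i < c → c ≤ j → j < m → β 𝓑 (w i) q (w j)
        before : ∀ {i j} → i < j → c ≤ i → j < m → β 𝓑 q (w i) (w j)

    open Cut

    cut⇒¬tri : ∀ {m w q c} → Cut m w q c → ∀ {i j} → i < j → j < m → ¬ Tri 𝓑 q (w i) (w j)
    cut⇒¬tri {c = c} C {i} {j} i<j j<m (t₁ , t₂ , t₃) with j ℕ.<? c | i ℕ.<? c
    ... | yes j<c | _       = t₃ (P2 𝓑 _ _ _ (after C i<j j<c))
    ... | no j≮c  | yes i<c = t₂ (across C i<c (ℕ.≮⇒≥ j≮c) j<m)
    ... | no _    | no i≮c  = t₁ (before C i<j (ℕ.≮⇒≥ i≮c) j<m)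

    path-∘ : ∀ {m m′ w} {φ : ℕ → ℕ} → (∀ {i j} → i < j → φ i < φ j) → (∀ {j} → j < m′ → φ j < m) →
             Path m w → Path m′ (w ∘ φ)
    path-∘ mono bound P = record
      { distinct = λ i<j j<m → distinct P (mono i<j) (bound j<m)
      ; ordered  = λ i<j j<k k<m → ordered P (mono i<j) (mono j<k) (bound k<m)
      }

    path-injective : ∀ {m w} → Path m w → ∀ {i j} → i < m → j < m → w i ≡ w j → i ≡ j
    path-injective P {i} {j} i<m j<m eq with ℕ.<-cmp i j
    ... | tri< i<j _ _ = contradiction eq (distinct P i<j j<m)
    ... | tri≈ _ i≡j _ = i≡j
    ... | tri> _ _ j<i = contradiction (sym eq) (distinct P j<i i<m)

    module Extension {m : ℕ} {w : ℕ → Fin n} (P : Path m w) {q : Fin n} (q∉ : ∀ {j} → j < m → q ≢ w j) where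

      Is : State → ℕ → ℕ → Set
      Is L i j = β 𝓑 q (w i) (w j)
      Is M i j = β 𝓑 (w i) q (w j)
      Is R i j = β 𝓑 (w i) (w j) q
      Is T i j = Tri 𝓑 q (w i) (w j)

      state : ∀ i j → ∃ λ s → Is s i j
      state i j with collinear-or-tri 𝓑 q (w i) (w j)
      ... | inj₁ (1st p) = L , p
      ... | inj₁ (2nd p) = M , p
      ... | inj₁ (3rd p) = R , P2 𝓑 _ _ _ p
      ... | inj₂ t       = T , t

      st : ℕ → ℕ → State
      st i j = proj₁ (state i j)

      is-st : ∀ i j {s} → st i j ≡ s → Is s i j
      is-st i j refl = proj₂ (state i j)

      exclusive : ∀ {i j} → i < j → j < m → ∀ a b → Is a i j → Is b i j → a ≡ b
      exclusive i<j j<m L L p q = refl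
      exclusive i<j j<m M M p q = refl
      exclusive i<j j<m R R p q = refl
      exclusive i<j j<m T T p q = refl
      exclusive i<j j<m L M p q = contradiction (P3 𝓑 _ _ _ p q) (q∉ (ℕ.<-trans i<j j<m))
      exclusive i<j j<m M L p q = contradiction (P3 𝓑 _ _ _ q p) (q∉ (ℕ.<-trans i<j j<m))
      exclusive i<j j<m L R p q = contradiction (P3 𝓑 _ _ _ q (P2 𝓑 _ _ _ p)) (distinct P i<j j<m)
      exclusive i<j j<m R L p q = contradiction (P3 𝓑 _ _ _ p (P2 𝓑 _ _ _ q)) (distinct P i<j j<m)
      exclusive i<j j<m M R p q = contradiction (sym (P3 𝓑 _ _ _ (P2 𝓑 _ _ _ p) (P2 𝓑 _ _ _ q))) (q∉ j<m)
      exclusive i<j j<m R M p q = contradiction (sym (P3 𝓑 _ _ _ (P2 𝓑 _ _ _ q) (P2 𝓑 _ _ _ p))) (q∉ j<m)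
      exclusive i<j j<m L T p q = contradiction p (proj₁ q)
      exclusive i<j j<m T L p q = contradiction q (proj₁ p)
      exclusive i<j j<m M T p q = contradiction p (proj₁ (proj₂ q))
      exclusive i<j j<m T M p q = contradiction q (proj₁ (proj₂ p))
      exclusive i<j j<m R T p q = contradiction (P2 𝓑 _ _ _ p) (proj₂ (proj₂ q))
      exclusive i<j j<m T R p q = contradiction (P2 𝓑 _ _ _ q) (proj₂ (proj₂ p))

      module _ {i j k} (i<j : i < j) (j<k : j < k) (k<m : k < m) where

        private
          ijk : β 𝓑 (w i) (w j) (w k)
          ijk = ordered P i<j j<k k<m
          j<m : j < m
          j<m = ℕ.<-trans j<k k<m
          i<k : i < k
          i<k = ℕ.<-trans i<j j<k

        Mˡ⇒ : Is M i j → Is M i k × Is L j k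
        Mˡ⇒ p = P4 𝓑 _ _ _ _ ijk p

        Mʳ⇒ : Is M j k → Is M i k × Is R i j
        Mʳ⇒ p with P4 𝓑 _ _ _ _ (P2 𝓑 _ _ _ ijk) (P2 𝓑 _ _ _ p)
        ... | a , b = P2 𝓑 _ _ _ a , P2 𝓑 _ _ _ b

        L⇒ : Is L i k → Is L i j × Is L j k
        L⇒ p with P4 𝓑 _ _ _ _ (P2 𝓑 _ _ _ p) (P2 𝓑 _ _ _ ijk)
        ... | a , b = P2 𝓑 _ _ _ b , P2 𝓑 _ _ _ a

        R⇒ : Is R i k → Is R i j × Is R j k
        R⇒ p = P4 𝓑 _ _ _ _ p ijk

        LL⇒ : Is L i j → Is L j k → Is L i k
        LL⇒ p q = proj₁ (P4 𝓑 _ _ _ _ q p)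

        RR⇒ : Is R i j → Is R j k → Is R i k
        RR⇒ p q = P2 𝓑 _ _ _ (proj₁ (P4 𝓑 _ _ _ _ (P2 𝓑 _ _ _ p) (P2 𝓑 _ _ _ q)))

        MR⇒ : Is M i k → Is R i j → Is M j k
        MR⇒ p q = proj₂ (P4 𝓑 _ _ _ _ p q)

        ML⇒ : Is M i k → Is L j k → Is M i j
        ML⇒ p q = P2 𝓑 _ _ _ (proj₂ (P4 𝓑 _ _ _ _ (P2 𝓑 _ _ _ p) (P2 𝓑 _ _ _ q)))

        -- By P4, the state M on `(i,j)` or on `(j,k)`, and the states L and R on `(i,k)`, each
        -- determine the other two states. The remaining combinations are cut down by `LL⇒`, `RR⇒`,
        -- `MR⇒` and `ML⇒`; what is left is listed in `Okᵀ` or contains two T's.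
        okᵀ : ∀ a b c → Is a i j → Is b j k → Is c i k →
              Okᵀ a b c ⊎ (a ≡ T × b ≡ T) ⊎ (a ≡ T × c ≡ T) ⊎ (b ≡ T × c ≡ T)
        okᵀ M b c p q r with exclusive i<k k<m M c (proj₁ (Mˡ⇒ p)) r | exclusive j<k k<m L b (proj₂ (Mˡ⇒ p)) q
        ... | refl | refl = inj₁ mlm
        okᵀ a M c p q r with exclusive i<k k<m M c (proj₁ (Mʳ⇒ q)) r | exclusive i<j j<m R a (proj₂ (Mʳ⇒ q)) p
        ... | refl | refl = inj₁ rmm
        okᵀ a b L p q r with exclusive i<j j<m L a (proj₁ (L⇒ r)) p | exclusive j<k k<m L b (proj₂ (L⇒ r)) q
        ... | refl | refl = inj₁ lll
        okᵀ a b R p q r with exclusive i<j j<m R a (proj₁ (R⇒ r)) p | exclusive j<k k<m R b (proj₂ (R⇒ r)) q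
        ... | refl | refl = inj₁ rrr
        okᵀ R b M p q r with exclusive j<k k<m M b (MR⇒ r p) q
        ... | refl = inj₁ rmm
        okᵀ a L M p q r with exclusive i<j j<m M a (ML⇒ r q) p
        ... | refl = inj₁ mlm
        okᵀ L R M p q r = inj₁ lrm
        okᵀ L T M p q r = inj₁ ltm
        okᵀ T R M p q r = inj₁ trm
        okᵀ L L T p q r with exclusive i<k k<m L T (LL⇒ p q) r
        ... | ()
        okᵀ R R T p q r with exclusive i<k k<m R T (RR⇒ p q) r
        ... | ()
        okᵀ L R T p q r = inj₁ lrt
        okᵀ R L T p q r = inj₁ rlt
        okᵀ T T c p q r = inj₂ (1st (refl , refl))
        okᵀ T b T p q r = inj₂ (2nd (refl , refl))
        okᵀ a T T p q r = inj₂ (3rd (refl , refl))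

      L-inner : ∀ {a i j b} → a ≤ i → i < j → j ≤ b → b < m → Is L a b → Is L i j
      L-inner {a} {i} {j} {b} a≤i i<j j≤b b<m p = shrinkʳ (ℕ.m≤n⇒m<n∨m≡n j≤b) (shrinkˡ (ℕ.m≤n⇒m<n∨m≡n a≤i))
        where
        shrinkˡ : a < i ⊎ a ≡ i → Is L i b
        shrinkˡ (inj₁ a<i)  = proj₂ (L⇒ a<i (ℕ.<-≤-trans i<j j≤b) b<m p)
        shrinkˡ (inj₂ refl) = p
        shrinkʳ : j < b ⊎ j ≡ b → Is L i b → Is L i j
        shrinkʳ (inj₁ j<b)  q = proj₁ (L⇒ i<j j<b b<m q)
        shrinkʳ (inj₂ refl) q = q

      R-inner : ∀ {a i j b} → a ≤ i → i < j → j ≤ b → b < m → Is R a b → Is R i j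
      R-inner {a} {i} {j} {b} a≤i i<j j≤b b<m p = shrinkʳ (ℕ.m≤n⇒m<n∨m≡n j≤b) (shrinkˡ (ℕ.m≤n⇒m<n∨m≡n a≤i))
        where
        shrinkˡ : a < i ⊎ a ≡ i → Is R i b
        shrinkˡ (inj₁ a<i)  = proj₂ (R⇒ a<i (ℕ.<-≤-trans i<j j≤b) b<m p)
        shrinkˡ (inj₂ refl) = p
        shrinkʳ : j < b ⊎ j ≡ b → Is R i b → Is R i j
        shrinkʳ (inj₁ j<b)  q = proj₁ (R⇒ i<j j<b b<m q)
        shrinkʳ (inj₂ refl) q = q

      M-outer : ∀ {a i j b} → a ≤ i → i < j → j ≤ b → b < m → Is M i j → Is M a b
      M-outer {a} {i} {j} {b} a≤i i<j j≤b b<m p = growˡ (ℕ.m≤n⇒m<n∨m≡n a≤i) (growʳ (ℕ.m≤n⇒m<n∨m≡n j≤b))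
        where
        growʳ : j < b ⊎ j ≡ b → Is M i b
        growʳ (inj₁ j<b)  = proj₁ (Mˡ⇒ i<j j<b b<m p)
        growʳ (inj₂ refl) = p
        growˡ : a < i ⊎ a ≡ i → Is M i b → Is M a b
        growˡ (inj₁ a<i)  q = proj₁ (Mʳ⇒ a<i (ℕ.<-≤-trans i<j j≤b) b<m q)
        growˡ (inj₂ refl) q = q

      -- One edge with `q` in it suffices: `M-outer` carries the state M to all pairs around this
      -- edge, and comparing such a pair with a further point on one side yields R or L for the
      -- pairs on that side.
      M⇒cut : ∀ {i} → suc i < m → Is M i (suc i) → Cut m w q (suc i)
      M⇒cut {i} i+1<m p = record
        { c≤m    = ℕ.<⇒≤ i+1<m
        ; after  = λ a<b b≤i → proj₂ (Mʳ⇒ a<b b≤i i+1<m (M-outer (ℕ.≤-pred b≤i) (ℕ.n<1+n i) ℕ.≤-refl i+1<m p))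
        ; across = λ a≤i i<b b<m → M-outer (ℕ.≤-pred a≤i) (ℕ.n<1+n i) i<b b<m p
        ; before = λ a<b i<a b<m → proj₂ (Mˡ⇒ i<a a<b b<m (M-outer ℕ.≤-refl (ℕ.n<1+n i) i<a (ℕ.<-trans a<b b<m) p))
        }

      L⇒cut : ∀ {k} → m ≡ suc k → Is L 0 k → Cut m w q 0
      L⇒cut refl p = record
        { c≤m = z≤n
        ; after = λ _ ()
        ; across = λ ()
        ; before = λ a<b _ b<m → L-inner z≤n a<b (ℕ.≤-pred b<m) (ℕ.n<1+n _) p
        }

      R⇒cut : ∀ {k} → m ≡ suc k → Is R 0 k → Cut m w q m
      R⇒cut refl p = record
        { c≤m = ℕ.≤-refl
        ; after = λ a<b b<m → R-inner z≤n a<b (ℕ.≤-pred b<m) (ℕ.n<1+n _) p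
        ; across = λ _ m≤j j<m → contradiction j<m (ℕ.≤⇒≯ m≤j)
        ; before = λ a<b m≤a b<m → contradiction (ℕ.<-trans a<b b<m) (ℕ.≤⇒≯ m≤a)
        }

      AdjacentM : Set
      AdjacentM = ∃ λ i → suc i < m × Is M i (suc i)

      Window : ℕ → ℕ → Set
      Window a r = AdjacentM ⊎ Is L a (r + a) ⊎ Is R a (r + a)

      -- Overlapping windows share an edge of the path, so they agree on L or R.
      windows⇒cut : ∀ r → 2 ≤ r → r < m → (∀ a → r + a < m → Window a r) → ∃ (Cut m w q)
      windows⇒cut r 2≤r r<m win =
        conclude (total k (ℕ.≤-pred (subst (r <_) m≡1+k r<m)) (ℕ.≤-reflexive (sym m≡1+k)))
        where
        k : ℕ
        k = pred m
        m≡1+k : m ≡ suc k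
        m≡1+k = sym (ℕ.suc-pred m {{>-nonZero (ℕ.≤-<-trans z≤n r<m)}})
        total : ∀ b → r ≤ b → b < m → AdjacentM ⊎ Is L 0 b ⊎ Is R 0 b
        total b r≤b b<m = subst (λ x → AdjacentM ⊎ Is L 0 x ⊎ Is R 0 x) (ℕ.m+[n∸m]≡n r≤b)
          (grow (b ∸ r) (subst (_< m) (sym (ℕ.m+[n∸m]≡n r≤b)) b<m))
          where
          grow : ∀ a → r + a < m → AdjacentM ⊎ Is L 0 (r + a) ⊎ Is R 0 (r + a)
          grow zero    r<m = win 0 r<m
          grow (suc a) r+1+a<m = next (grow a r+a<m) (win (suc a) r+1+a<m)
            where
            r+a<m : r + a < m
            r+a<m = ℕ.<-trans (ℕ.+-monoʳ-< r (ℕ.n<1+n a)) r+1+a<m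
            2+a≤r+a : 2 + a ≤ r + a
            2+a≤r+a = ℕ.+-monoˡ-≤ a 2≤r
            2+a≤r+1+a : 2 + a ≤ r + suc a
            2+a≤r+1+a = ℕ.≤-trans 2+a≤r+a (ℕ.+-monoʳ-≤ r (ℕ.n≤1+n a))
            2+a<m : 2 + a < m
            2+a<m = ℕ.≤-<-trans 2+a≤r+a r+a<m
            clash : Is L (suc a) (2 + a) → Is R (suc a) (2 + a) → ⊥
            clash p q = contradiction (exclusive (ℕ.n<1+n _) 2+a<m L R p q) λ ()
            next : AdjacentM ⊎ Is L 0 (r + a) ⊎ Is R 0 (r + a) → Window (suc a) r →
                   AdjacentM ⊎ Is L 0 (r + suc a) ⊎ Is R 0 (r + suc a)
            next (1st p) _       = 1st p
            next (2nd _) (1st q) = 1st q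
            next (3rd _) (1st q) = 1st q
            next (2nd p) (2nd q) = 2nd (LL⇒ (s≤s z≤n) (ℕ.≤-trans (ℕ.n<1+n _) 2+a≤r+1+a) r+1+a<m
              (L-inner z≤n (s≤s z≤n) (ℕ.<⇒≤ 2+a≤r+a) r+a<m p) q)
            next (3rd p) (3rd q) = 3rd (RR⇒ (s≤s z≤n) (ℕ.≤-trans (ℕ.n<1+n _) 2+a≤r+1+a) r+1+a<m
              (R-inner z≤n (s≤s z≤n) (ℕ.<⇒≤ 2+a≤r+a) r+a<m p) q)
            next (2nd p) (3rd q) = ⊥-elim (clash (L-inner z≤n (ℕ.n<1+n _) 2+a≤r+a r+a<m p)
                                                 (R-inner ℕ.≤-refl (ℕ.n<1+n _) 2+a≤r+1+a r+1+a<m q))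
            next (3rd p) (2nd q) = ⊥-elim (clash (L-inner ℕ.≤-refl (ℕ.n<1+n _) 2+a≤r+1+a r+1+a<m q)
                                                 (R-inner z≤n (ℕ.n<1+n _) 2+a≤r+a r+a<m p))
        conclude : AdjacentM ⊎ Is L 0 k ⊎ Is R 0 k → ∃ (Cut m w q)
        conclude (1st (i , i+1<m , p)) = suc i , M⇒cut i+1<m p
        conclude (2nd p)               = 0 , L⇒cut m≡1+k p
        conclude (3rd p)               = m , R⇒cut m≡1+k p

      okᴸᴹᴿ : (∀ {i j} → i < j → j < m → ¬ Is T i j) → ∀ {i j k} → i < j → j < k → k < m →
        Okᴸᴹᴿ (st i j) (st j k) (st i k)
      okᴸᴹᴿ noT {i} {j} {k} i<j j<k k<m = go (okᵀ i<j j<k k<m _ _ _ sᵢⱼ sⱼₖ sᵢₖ) sᵢⱼ sⱼₖ sᵢₖ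
        where
        sᵢⱼ = is-st i j refl
        sⱼₖ = is-st j k refl
        sᵢₖ = is-st i k refl
        ¬ij = noT i<j (ℕ.<-trans j<k k<m)
        ¬jk = noT j<k k<m
        ¬ik = noT (ℕ.<-trans i<j j<k) k<m
        go : ∀ {a b c} → Okᵀ a b c ⊎ (a ≡ T × b ≡ T) ⊎ (a ≡ T × c ≡ T) ⊎ (b ≡ T × c ≡ T) →
             Is a i j → Is b j k → Is c i k → Okᴸᴹᴿ a b c
        go (inj₁ mlm) _ _ _ = mlm
        go (inj₁ rmm) _ _ _ = rmm
        go (inj₁ lll) _ _ _ = lll
        go (inj₁ rrr) _ _ _ = rrr
        go (inj₁ lrm) _ _ _ = lrm
        go (inj₁ ltm) _ t _ = contradiction t ¬jk
        go (inj₁ trm) t _ _ = contradiction t ¬ij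
        go (inj₁ rlt) _ _ t = contradiction t ¬ik
        go (inj₁ lrt) _ _ t = contradiction t ¬ik
        go (inj₂ (1st (refl , refl))) t _ _ = contradiction t ¬ij
        go (inj₂ (2nd (refl , refl))) t _ _ = contradiction t ¬ij
        go (inj₂ (3rd (refl , refl))) _ t _ = contradiction t ¬jk

      -- Four points are required because on three of them the states L, R, M of a 4-cycle are
      -- consistent; `window₄` shows that a fourth point refutes them.
      linear⇒cut : 4 ≤ m → (∀ {i j} → i < j → j < m → ¬ Is T i j) → ∃ (Cut m w q)
      linear⇒cut 4≤m noT = windows⇒cut 3 (s≤s (s≤s z≤n)) 4≤m window
        where
        window : ∀ a → 3 + a < m → Window a 3
        window a a₃<m with window₄ (okᴸᴹᴿ noT <₁ <₁ a₂<m) (okᴸᴹᴿ noT <₁ <₁ a₃<m)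
                       (okᴸᴹᴿ noT <₁ <₂ a₃<m) (okᴸᴹᴿ noT <₂ <₁ a₃<m)
          where
          <₁ : ∀ {x} → x < 1 + x
          <₁ = ℕ.≤-refl
          <₂ : ∀ {x} → x < 2 + x
          <₂ = ℕ.n≤1+n _
          a₂<m : 2 + a < m
          a₂<m = ℕ.<⇒≤ a₃<m
        ... | inj₁ e = inj₁ (_ , (ℕ.<⇒≤ (ℕ.<⇒≤ a₃<m)) , is-st a (1 + a) e)
        ... | inj₂ (inj₁ e) = inj₁ (_ , (ℕ.<⇒≤ a₃<m) , is-st (1 + a) (2 + a) e)
        ... | inj₂ (inj₂ (inj₁ e)) = inj₁ (_ , a₃<m , is-st (2 + a) (3 + a) e)
        ... | inj₂ (inj₂ (inj₂ (inj₁ e))) = inj₂ (inj₁ (is-st a (3 + a) e))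
        ... | inj₂ (inj₂ (inj₂ (inj₂ e))) = inj₂ (inj₂ (is-st a (3 + a) e))

      -- The pairs in state T, seen as edges on the indices, form a matching, so no point of `w` is
      -- in two triangles with `q`. Two edges with a common end span some `i < j < k`, which gives
      -- the three exclusions.
      Matching : Set
      Matching = ∀ {i j k} → i < j → j < k → k < m →
        ¬ (Is T i j × Is T j k) × ¬ (Is T i j × Is T i k) × ¬ (Is T j k × Is T i k)

      matching⇒cut : 5 ≤ m → Matching → ∃ (Cut m w q)
      matching⇒cut 5≤m match = windows⇒cut 4 (s≤s (s≤s z≤n)) 5≤m window
        where
        ok : ∀ {i j k} → i < j → j < k → k < m → Okᵀ (st i j) (st j k) (st i k)
        ok {i} {j} {k} i<j j<k k<m with okᵀ i<j j<k k<m _ _ _ (is-st i j refl) (is-st j k refl) (is-st i k refl)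
        ... | inj₁ o = o
        ... | inj₂ (1st (e , f)) = contradiction (is-st i j e , is-st j k f) (proj₁ (match i<j j<k k<m))
        ... | inj₂ (2nd (e , f)) = contradiction (is-st i j e , is-st i k f) (proj₁ (proj₂ (match i<j j<k k<m)))
        ... | inj₂ (3rd (e , f)) = contradiction (is-st j k e , is-st i k f) (proj₂ (proj₂ (match i<j j<k k<m)))
        window : ∀ a → 4 + a < m → Window a 4
        window a a₄<m with window₅ (ok <₁ <₂ a₃<m) (ok <₃ <₁ a₄<m) (ok <₁ <₁ a₃<m)
                       (ok <₁ <₁ a₂<m) (ok <₁ <₁ a₄<m) (ok <₁ <₂ a₄<m)
                       (ok <₂ <₁ a₄<m) (ok <₁ <₃ a₄<m) (ok <₂ <₂ a₄<m)
                       (ok <₂ <₁ a₃<m)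
          where
          <₁ : ∀ {x} → x < 1 + x
          <₁ = ℕ.≤-refl
          <₂ : ∀ {x} → x < 2 + x
          <₂ = ℕ.n≤1+n _
          <₃ : ∀ {x} → x < 3 + x
          <₃ = ℕ.m≤n+m _ 2
          a₃<m : 3 + a < m
          a₃<m = ℕ.<⇒≤ a₄<m
          a₂<m : 2 + a < m
          a₂<m = ℕ.<⇒≤ a₃<m
        ... | inj₁ e = inj₁ (_ , (ℕ.<⇒≤ (ℕ.<⇒≤ (ℕ.<⇒≤ a₄<m))) , is-st a (1 + a) e)
        ... | inj₂ (inj₁ e) = inj₁ (_ , (ℕ.<⇒≤ (ℕ.<⇒≤ a₄<m)) , is-st (1 + a) (2 + a) e)
        ... | inj₂ (inj₂ (inj₁ e)) = inj₁ (_ , (ℕ.<⇒≤ a₄<m) , is-st (2 + a) (3 + a) e)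
        ... | inj₂ (inj₂ (inj₂ (inj₁ e))) = inj₁ (_ , a₄<m , is-st (3 + a) (4 + a) e)
        ... | inj₂ (inj₂ (inj₂ (inj₂ (inj₁ e)))) = inj₂ (inj₁ (is-st a (4 + a) e))
        ... | inj₂ (inj₂ (inj₂ (inj₂ (inj₂ e)))) = inj₂ (inj₂ (is-st a (4 + a) e))

-- Linear structures of order at least five are paths

module LinearStructures where

  open Triangles
  open PathStates
  open import Data.Nat using (_+_; _≤_; _<_)

  open BetweennessStructure

  module _ {A : Set} where

    insert : ℕ → A → (ℕ → A) → ℕ → A
    insert zero    q w zero    = q
    insert zero    q w (suc j) = w j
    insert (suc c) q w zero    = w 0
    insert (suc c) q w (suc j) = insert c q (w ∘ suc) j

    -- Ties an index to its value without mentioning `insert`, so that one match reveals both the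
    -- region of the index and the point found there.
    data InsertView (c : ℕ) (q : A) (w : ℕ → A) : ℕ → A → Set where
      below : ∀ {j} → j < c → InsertView c q w j (w j)
      at    : InsertView c q w c q
      above : ∀ {j} → c ≤ j → InsertView c q w (suc j) (w j)

    insertView : ∀ c q w j → InsertView c q w j (insert c q w j)
    insertView zero    q w zero    = at
    insertView zero    q w (suc j) = above z≤n
    insertView (suc c) q w zero    = below (s≤s z≤n)
    insertView (suc c) q w (suc j) with insertView c q (w ∘ suc) j
    ... | v = shift v
      where
      shift : ∀ {j v} → InsertView c q (w ∘ suc) j v → InsertView (suc c) q w (suc j) v
      shift (below j<c) = below (s≤s j<c)
      shift at          = at
      shift (above c≤j) = above (s≤s c≤j)

  module _ {n : ℕ} (𝓑 : BetweennessStructure n) where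

    open Path
    open Cut

    insert-path : ∀ {m w q c} → Path 𝓑 m w → (∀ {j} → j < m → q ≢ w j) → Cut 𝓑 m w q c →
      Path 𝓑 (suc m) (insert c q w)
    insert-path {m} {w} {q} {c} P q∉ C = record
      { distinct = λ {i} {j} i<j j≤m → distinct′ (insertView c q w i) (insertView c q w j) i<j j≤m
      ; ordered  = λ {i} {j} {k} → ordered′ (insertView c q w i) (insertView c q w j) (insertView c q w k)
      }
      where
      View = InsertView c q w
      absurd : ∀ {i j} {X : Set} → i < j → j ≤ i → X
      absurd p q = contradiction q (ℕ.<⇒≱ p)
      distinct′ : ∀ {i j a b} → View i a → View j b → i < j → j < suc m → a ≢ b
      distinct′ (below _)   (below j<c) i<j _   = distinct P i<j (ℕ.<-≤-trans j<c (c≤m C))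
      distinct′ (below i<c) at          _   _   = q∉ (ℕ.<-≤-trans i<c (c≤m C)) ∘ sym
      distinct′ (below i<c) (above c≤j) _   j<m = distinct P (ℕ.<-≤-trans i<c c≤j) (ℕ.≤-pred j<m)
      distinct′ at          (below j<c) c<j _   = absurd c<j (ℕ.<⇒≤ j<c)
      distinct′ at          at          c<c _   = absurd c<c ℕ.≤-refl
      distinct′ at          (above _)   _   j<m = q∉ (ℕ.≤-pred j<m)
      distinct′ (above c≤i) (below j<c) i<j _   = absurd i<j (ℕ.≤-trans (ℕ.<⇒≤ j<c) (ℕ.≤-trans c≤i (ℕ.n≤1+n _)))
      distinct′ (above c≤i) at          i<c _   = absurd i<c (ℕ.≤-trans c≤i (ℕ.n≤1+n _))
      distinct′ (above _)   (above _)   i<j j<m = distinct P (ℕ.≤-pred i<j) (ℕ.≤-pred j<m)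
      ordered′ : ∀ {i j k a b d} → View i a → View j b → View k d → i < j → j < k → k < suc m → β 𝓑 a b d
      ordered′ (below _)   (below _)   (below k<c) i<j j<k _   = ordered P i<j j<k (ℕ.<-≤-trans k<c (c≤m C))
      ordered′ (below _)   (below j<c) at          i<j _   _   = after C i<j j<c
      ordered′ (below _)   (below j<c) (above c≤k) i<j _   k<m = ordered P i<j (ℕ.<-≤-trans j<c c≤k) (ℕ.≤-pred k<m)
      ordered′ (below i<c) at          (above c≤k) _   _   k<m = across C i<c c≤k (ℕ.≤-pred k<m)
      ordered′ (below i<c) (above c≤j) (above _)   _   j<k k<m =
        ordered P (ℕ.<-≤-trans i<c c≤j) (ℕ.≤-pred j<k) (ℕ.≤-pred k<m)
      ordered′ at          (above c≤j) (above _)   _   j<k k<m = before C (ℕ.≤-pred j<k) c≤j (ℕ.≤-pred k<m)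
      ordered′ (above _)   (above _)   (above _)   i<j j<k k<m =
        ordered P (ℕ.≤-pred i<j) (ℕ.≤-pred j<k) (ℕ.≤-pred k<m)
      ordered′ at          (below j<c) _           c<j _   _   = absurd c<j (ℕ.<⇒≤ j<c)
      ordered′ at          at          _           c<c _   _   = absurd c<c ℕ.≤-refl
      ordered′ (above c≤i) (below j<c) _           i<j _   _   =
        absurd i<j (ℕ.≤-trans (ℕ.<⇒≤ j<c) (ℕ.≤-trans c≤i (ℕ.n≤1+n _)))
      ordered′ (above c≤i) at          _           i<c _   _   = absurd i<c (ℕ.≤-trans c≤i (ℕ.n≤1+n _))
      ordered′ _           at          (below k<c) _   c<k _   = absurd c<k (ℕ.<⇒≤ k<c)
      ordered′ _           at          at          _   c<c _   = absurd c<c ℕ.≤-refl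
      ordered′ _           (above c≤j) (below k<c) _   j<k _   =
        absurd j<k (ℕ.≤-trans (ℕ.<⇒≤ k<c) (ℕ.≤-trans c≤j (ℕ.n≤1+n _)))
      ordered′ _           (above c≤j) at          _   j<c _   = absurd j<c (ℕ.≤-trans c≤j (ℕ.n≤1+n _))

    triple : Fin n → Fin n → Fin n → ℕ → Fin n
    triple a b c 0 = a
    triple a b c 1 = b
    triple a b c _ = c

    triple-path : ∀ {a b c} → a ≢ b → a ≢ c → b ≢ c → β 𝓑 a b c → Path 𝓑 3 (triple a b c)
    triple-path {a} {b} {c} a≢b a≢c b≢c abc = record { distinct = dist ; ordered = ord }
      where
      dist : ∀ {i j} → i < j → j < 3 → triple a b c i ≢ triple a b c j
      dist {0} {1} _ _ = a≢b
      dist {0} {2} _ _ = a≢c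
      dist {1} {2} _ _ = b≢c
      dist {1} {1} (s≤s ())
      dist {suc (suc _)} {1} (s≤s ())
      dist {suc (suc _)} {2} (s≤s (s≤s ()))
      dist {_} {suc (suc (suc _))} _ (s≤s (s≤s (s≤s ())))
      ord : ∀ {i j k} → i < j → j < k → k < 3 → β 𝓑 (triple a b c i) (triple a b c j) (triple a b c k)
      ord {0} {1} {2} _ _ _ = abc
      ord {1} {1} (s≤s ())
      ord {suc (suc _)} {1} (s≤s ())
      ord {_} {suc _} {1} _ (s≤s ())
      ord {_} {suc (suc _)} {2} _ (s≤s (s≤s ()))
      ord {_} {_} {suc (suc (suc _))} _ _ (s≤s (s≤s (s≤s ())))

    module _ (none : NoTri 𝓑) where

      ∉triple : ∀ {q a b c} → q ≢ a → q ≢ b → q ≢ c → ∀ {j} → j < 3 → q ≢ triple a b c j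
      ∉triple p _ _ {0} _ = p
      ∉triple _ p _ {1} _ = p
      ∉triple _ _ p {2} _ = p
      ∉triple _ _ _ {suc (suc (suc _))} (s≤s (s≤s (s≤s ())))

      -- The second alternative is the 4-cycle a b c q.
      extend-triple : ∀ {a b c q} (P : Path 𝓑 3 (triple a b c)) → q ≢ a → q ≢ b → q ≢ c →
        ∃ (Cut 𝓑 3 (triple a b c) q) ⊎ (β 𝓑 a q c × β 𝓑 q a b × β 𝓑 b c q)
      extend-triple {a} {b} {c} {q} P q≢a q≢b q≢c =
        go (okᴸᴹᴿ (λ _ _ → none) (s≤s z≤n) (s≤s (s≤s z≤n)) (s≤s (s≤s (s≤s z≤n)))) (is-st 0 1 refl) (is-st 1 2 refl) (is-st 0 2 refl)
        where
        open Extension 𝓑 P (∉triple q≢a q≢b q≢c)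
        go : ∀ {s t u} → Okᴸᴹᴿ s t u → Is s 0 1 → Is t 1 2 → Is u 0 2 →
             ∃ (Cut 𝓑 3 (triple a b c) q) ⊎ (β 𝓑 a q c × β 𝓑 q a b × β 𝓑 b c q)
        go mlm p _ _ = inj₁ (1 , M⇒cut (s≤s (s≤s z≤n)) p)
        go rmm _ p _ = inj₁ (2 , M⇒cut (s≤s (s≤s (s≤s z≤n))) p)
        go lll _ _ p = inj₁ (0 , L⇒cut refl p)
        go rrr _ _ p = inj₁ (3 , R⇒cut refl p)
        go lrm p q r = inj₂ (r , p , q)

      extend : ∀ {m w q} → 4 ≤ m → Path 𝓑 m w → (∀ {j} → j < m → q ≢ w j) → ∃ λ c → Path 𝓑 (suc m) (insert c q w)
      extend 4≤m P q∉ with Extension.linear⇒cut 𝓑 P q∉ 4≤m (λ _ _ → none)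
      ... | c , C = c , insert-path P q∉ C

      ∉insert : ∀ {p m c q w} → p ≢ q → (∀ {j} → j < m → p ≢ w j) → Cut 𝓑 m w q c →
                ∀ {j} → j < suc m → p ≢ insert c q w j
      ∉insert {p} {m} {c} {q} {w} p≢q p∉ C {j} = go (insertView c q w j)
        where
        go : ∀ {j v} → InsertView c q w j v → j < suc m → p ≢ v
        go (below j<c) _   = p∉ (ℕ.<-≤-trans j<c (c≤m C))
        go at          _   = p≢q
        go (above _)   j<m = p∉ (ℕ.≤-pred j<m)

      -- If every attempt to obtain a path on four points fails, then `a b c d`, `a b c e` and
      -- `c d a e` are 4-cycles. Together they are the betweenness of the complete bipartite graph
      -- with parts `a c` and `b d e`, in which `b`, `d`, `e` would form a triangle.
      five-points : ∀ {a b c d e} → a ≢ b → a ≢ c → b ≢ c → d ≢ a → d ≢ b → d ≢ c → e ≢ a → e ≢ b → e ≢ c → e ≢ d →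
                    β 𝓑 a b c → ∃ (Path 𝓑 5)
      five-points {a} {b} {c} {d} {e} a≢b a≢c b≢c d≢a d≢b d≢c e≢a e≢b e≢c e≢d abc
        with extend-triple (triple-path a≢b a≢c b≢c abc) d≢a d≢b d≢c
      ... | inj₁ (_ , C) =
        _ , proj₂ (extend ℕ.≤-refl (insert-path (triple-path a≢b a≢c b≢c abc) (∉triple d≢a d≢b d≢c) C)
                                  (∉insert e≢d (∉triple e≢a e≢b e≢c) C))
      ... | inj₂ (adc , dab , bcd)
        with extend-triple (triple-path a≢b a≢c b≢c abc) e≢a e≢b e≢c
      ...   | inj₁ (_ , C) =
        _ , proj₂ (extend ℕ.≤-refl (insert-path (triple-path a≢b a≢c b≢c abc) (∉triple e≢a e≢b e≢c) C)
                                  (∉insert (e≢d ∘ sym) (∉triple d≢a d≢b d≢c) C))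
      -- The third attempt inserts `e` into `c d a`, the other half of the first cycle.
      ...   | inj₂ (aec , eab , bce)
        with extend-triple (triple-path (d≢c ∘ sym) (a≢c ∘ sym) d≢a (P2 𝓑 _ _ _ adc)) e≢c e≢d e≢a
      ...     | inj₁ (_ , C) =
        _ , proj₂ (extend ℕ.≤-refl (insert-path (triple-path (d≢c ∘ sym) (a≢c ∘ sym) d≢a (P2 𝓑 _ _ _ adc))
                                          (∉triple e≢c e≢d e≢a) C)
                                  (∉insert (e≢b ∘ sym) (∉triple b≢c (d≢b ∘ sym) (a≢b ∘ sym)) C))
      ...     | inj₂ (cea , ecd , dae) with collinear-or-tri 𝓑 b d e
      ...       | inj₁ (1st bde) = contradiction (P3 𝓑 _ _ _ dae (proj₂ (P4 𝓑 _ _ _ _ bde (P2 𝓑 _ _ _ dab)))) d≢a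
      ...       | inj₁ (2nd dbe) = contradiction (P3 𝓑 _ _ _ (proj₂ (P4 𝓑 _ _ _ _ dbe dab)) (P2 𝓑 _ _ _ eab)) a≢b
      ...       | inj₁ (3rd bed) =
        contradiction (P3 𝓑 _ _ _ (P2 𝓑 _ _ _ dae) (proj₂ (P4 𝓑 _ _ _ _ bed (P2 𝓑 _ _ _ eab)))) e≢a
      ...       | inj₂ t = ⊥-elim (none t)

  path-covers : ∀ {n} {𝓑 : BetweennessStructure n} {w} → Path 𝓑 n w → ∀ v → ∃ λ j → j < n × w j ≡ v
  path-covers {𝓑 = 𝓑} {w} P v
    with injective⇒surjective {f = w ∘ toℕ}
           (λ {i} {j} eq → Fin.toℕ-injective (path-injective 𝓑 P (Fin.toℕ<n i) (Fin.toℕ<n j) eq)) v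
  ... | i , eq = toℕ i , Fin.toℕ<n i , eq

  -- The induction has to start at order 5, since the 4-cycle is linear without being a path. From
  -- there on, `linear⇒cut` inserts the deleted point.
  linear⇒path : ∀ k (𝓑 : BetweennessStructure (5 + k)) → NoTri 𝓑 → ∃ (Path 𝓑 (5 + k))
  linear⇒path zero 𝓑 none = go (collinear-or-tri 𝓑 a b c)
    where
    a b c d e : Fin 5
    a = zero
    b = suc zero
    c = suc (suc zero)
    d = suc (suc (suc zero))
    e = suc (suc (suc (suc zero)))
    go : (β 𝓑 a b c ⊎ β 𝓑 b a c ⊎ β 𝓑 a c b) ⊎ Tri 𝓑 a b c → ∃ (Path 𝓑 5)
    go (inj₁ (1st p)) =
      five-points 𝓑 none {a} {b} {c} {d} {e} (λ ()) (λ ()) (λ ()) (λ ()) (λ ()) (λ ()) (λ ()) (λ ()) (λ ()) (λ ()) p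
    go (inj₁ (2nd p)) =
      five-points 𝓑 none {b} {a} {c} {d} {e} (λ ()) (λ ()) (λ ()) (λ ()) (λ ()) (λ ()) (λ ()) (λ ()) (λ ()) (λ ()) p
    go (inj₁ (3rd p)) =
      five-points 𝓑 none {a} {c} {b} {d} {e} (λ ()) (λ ()) (λ ()) (λ ()) (λ ()) (λ ()) (λ ()) (λ ()) (λ ()) (λ ()) p
    go (inj₂ t)       = ⊥-elim (none t)
  linear⇒path (suc k) 𝓑 none with linear⇒path k (𝓑 ∖ zero) none
  ... | w , P = _ , proj₂ (extend 𝓑 none {q = zero} (s≤s (s≤s (s≤s (s≤s z≤n)))) P′ (λ _ ()))
    where
    P′ : Path 𝓑 (5 + k) (suc ∘ w)
    P′ =
      record { distinct = λ i<j j<m eq → Path.distinct P i<j j<m (Fin.suc-injective eq) ; ordered = Path.ordered P }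

  linear⇒path′ : ∀ {n} → 5 ≤ n → (𝓑 : BetweennessStructure n) → NoTri 𝓑 → ∃ (Path 𝓑 n)
  linear⇒path′ (s≤s (s≤s (s≤s (s≤s (s≤s _))))) = linear⇒path _

-- Normal forms: a path with two further points

module Forms where

  open Triangles
  open import Data.Nat using (_+_; _∸_; _≤_; _<_)

  open BetweennessStructure

  pattern yᵛ = zero
  pattern zᵛ = suc zero
  pattern xᵛ i = suc (suc i)

  -- Which of y, z, xⱼ is between the other two.
  data Middle : Set where
    ofˣ ofʸ ofᶻ missing : Middle

  none? : ∀ a → Dec (a ≡ missing)
  none? ofˣ  = no λ ()
  none? ofʸ  = no λ ()
  none? ofᶻ  = no λ ()
  none? missing = yes refl

  swapʸᶻ : Middle → Middle
  swapʸᶻ ofˣ  = ofˣ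
  swapʸᶻ ofʸ  = ofᶻ
  swapʸᶻ ofᶻ  = ofʸ
  swapʸᶻ missing = missing

  module _ {k : ℕ} where

    V : Set
    V = Fin (3 + k)

    -- y and z are inserted into the path of the x's after its first by and bz points.
    module _ (by bz : ℕ) where

      data _≺_ : V → V → Set where
        x≺x : ∀ {i j} → toℕ i < toℕ j → xᵛ i ≺ xᵛ j
        x≺y : ∀ {i} → toℕ i < by → xᵛ i ≺ yᵛ
        y≺x : ∀ {i} → by ≤ toℕ i → yᵛ ≺ xᵛ i
        x≺z : ∀ {i} → toℕ i < bz → xᵛ i ≺ zᵛ
        z≺x : ∀ {i} → bz ≤ toℕ i → zᵛ ≺ xᵛ i

      -- The `xᵛ i` receive odd ranks and the cuts even ones, so a point inserted after `c` of them
      -- falls strictly between its neighbours. The rank serves to exclude cycles of `≺`; hence `yᵛ`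
      -- and `zᵛ`, which are never compared, may share a rank.
      rank : V → ℕ
      rank yᵛ     = by + by
      rank zᵛ     = bz + bz
      rank (xᵛ i) = suc (toℕ i + toℕ i)

      rank-mono : ∀ {u v} → u ≺ v → rank u < rank v
      rank-mono (x≺x i<j) = s≤s (ℕ.+-mono-< i<j i<j)
      rank-mono (x≺y {i} i<b) = subst (_≤ by + by) (cong suc (ℕ.+-suc (toℕ i) (toℕ i))) (ℕ.+-mono-≤ i<b i<b)
      rank-mono (y≺x b≤i) = s≤s (ℕ.+-mono-≤ b≤i b≤i)
      rank-mono (x≺z {i} i<b) = subst (_≤ bz + bz) (cong suc (ℕ.+-suc (toℕ i) (toℕ i))) (ℕ.+-mono-≤ i<b i<b)
      rank-mono (z≺x b≤i) = s≤s (ℕ.+-mono-≤ b≤i b≤i)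

      data YZ : V → V → Set where
        yz : YZ yᵛ zᵛ
        zy : YZ zᵛ yᵛ

      compare : ∀ u v → u ≢ v → (u ≺ v ⊎ v ≺ u) ⊎ YZ u v
      compare yᵛ     yᵛ     ne = contradiction refl ne
      compare yᵛ     zᵛ     ne = inj₂ yz
      compare zᵛ     yᵛ     ne = inj₂ zy
      compare zᵛ     zᵛ     ne = contradiction refl ne
      compare yᵛ     (xᵛ j) ne = inj₁ (Sum.map y≺x x≺y (ℕ.≤-<-connex by (toℕ j)))
      compare (xᵛ i) yᵛ     ne = inj₁ (Sum.map x≺y y≺x (ℕ.<-≤-connex (toℕ i) by))
      compare zᵛ     (xᵛ j) ne = inj₁ (Sum.map z≺x x≺z (ℕ.≤-<-connex bz (toℕ j)))
      compare (xᵛ i) zᵛ     ne = inj₁ (Sum.map x≺z z≺x (ℕ.<-≤-connex (toℕ i) bz))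
      compare (xᵛ i) (xᵛ j) ne with ℕ.<-cmp (toℕ i) (toℕ j)
      ... | tri< i<j _ _ = inj₁ (inj₁ (x≺x i<j))
      ... | tri≈ _ eq _  = contradiction (cong (λ i → suc (suc i)) (Fin.toℕ-injective eq)) ne
      ... | tri> _ _ j<i = inj₁ (inj₂ (x≺x j<i))

    module _ (by bz : ℕ) (mid : Fin (suc k) → Middle) where

      private
        _⊏_ = _≺_ by bz

      -- `chain` demands all three comparisons because `≺` is not transitive: `yᵛ ≺ xᵛ j` and
      -- `xᵛ j ≺ zᵛ` do not make `yᵛ` and `zᵛ` comparable. Triples with both of these are governed
      -- by `mid` alone.
      data Spec : V → V → V → Set where
        start : ∀ {u w} → Spec u u w
        flip  : ∀ {u v w} → Spec u v w → Spec w v u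
        chain : ∀ {u v w} → u ⊏ v → v ⊏ w → u ⊏ w → Spec u v w
        midˣ  : ∀ {j} → mid j ≡ ofˣ → Spec yᵛ (xᵛ j) zᵛ
        midʸ  : ∀ {j} → mid j ≡ ofʸ → Spec zᵛ yᵛ (xᵛ j)
        midᶻ  : ∀ {j} → mid j ≡ ofᶻ → Spec yᵛ zᵛ (xᵛ j)

      Ordered : V → V → V → Set
      Ordered u v w = Spec u v w ⊎ Spec v u w ⊎ Spec u w v

      yzx-ordered : ∀ j → Ordered yᵛ zᵛ (xᵛ j) ⊎ mid j ≡ missing
      yzx-ordered j with mid j in eq
      ... | ofˣ  = inj₁ (3rd (midˣ eq))
      ... | ofʸ  = inj₁ (2nd (midʸ eq))
      ... | ofᶻ  = inj₁ (1st (midᶻ eq))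
      ... | missing = inj₂ refl

      chain-ordered : ∀ {u v w} → u ⊏ v ⊎ v ⊏ u → u ⊏ w ⊎ w ⊏ u → v ⊏ w ⊎ w ⊏ v → Ordered u v w
      chain-ordered (inj₁ p) (inj₁ q) (inj₁ r) = 1st (chain p r q)
      chain-ordered (inj₁ p) (inj₁ q) (inj₂ r) = 3rd (chain q r p)
      chain-ordered (inj₁ p) (inj₂ q) (inj₁ r) =
        contradiction (ℕ.<-trans (rank-mono by bz p) (rank-mono by bz r)) (ℕ.<-asym (rank-mono by bz q))
      chain-ordered (inj₁ p) (inj₂ q) (inj₂ r) = 2nd (flip (chain q p r))
      chain-ordered (inj₂ p) (inj₁ q) (inj₁ r) = 2nd (chain p q r)
      chain-ordered (inj₂ p) (inj₁ q) (inj₂ r) =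
        contradiction (ℕ.<-trans (rank-mono by bz p) (rank-mono by bz q)) (ℕ.<-asym (rank-mono by bz r))
      chain-ordered (inj₂ p) (inj₂ q) (inj₁ r) = 3rd (flip (chain r q p))
      chain-ordered (inj₂ p) (inj₂ q) (inj₂ r) = 1st (flip (chain r p q))

      NoneAmong : V → V → V → Set
      NoneAmong u v w = ∃ λ j → mid j ≡ missing × OneOf yᵛ u v w × OneOf zᵛ u v w × OneOf (xᵛ j) u v w

      -- Only the pair of `yᵛ` and `zᵛ` is incomparable. Hence three distinct vertices either are
      -- ordered by `≺` or contain this pair, and then the label of the remaining `xᵛ j` decides.
      ordered-or-none : ∀ u v w → u ≢ v → u ≢ w → v ≢ w → Ordered u v w ⊎ NoneAmong u v w
      ordered-or-none u v w u≢v u≢w v≢w with compare by bz u v u≢v | compare by bz u w u≢w | compare by bz v w v≢w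
      ... | inj₁ p  | inj₁ q | inj₁ r = inj₁ (chain-ordered p q r)
      ordered-or-none .yᵛ .zᵛ yᵛ _ u≢w _ | inj₂ yz | _ | _ = contradiction refl u≢w
      ordered-or-none .yᵛ .zᵛ zᵛ _ _ v≢w | inj₂ yz | _ | _ = contradiction refl v≢w
      ordered-or-none .yᵛ .zᵛ (xᵛ j) _ _ _ | inj₂ yz | _ | _ =
        Sum.map id (λ e → j , e , 1st refl , 2nd refl , 3rd refl) (yzx-ordered j)
      ordered-or-none .zᵛ .yᵛ yᵛ _ _ v≢w | inj₂ zy | _ | _ = contradiction refl v≢w
      ordered-or-none .zᵛ .yᵛ zᵛ _ u≢w _ | inj₂ zy | _ | _ = contradiction refl u≢w
      ordered-or-none .zᵛ .yᵛ (xᵛ j) _ _ _ | inj₂ zy | _ | _ =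
        Sum.map (λ { (1st s) → 2nd s ; (2nd s) → 1st s ; (3rd s) → 3rd (flip s) })
                (λ e → j , e , 2nd refl , 1st refl , 3rd refl) (yzx-ordered j)
      ordered-or-none .yᵛ yᵛ .zᵛ u≢v _ _ | inj₁ _ | inj₂ yz | _ = contradiction refl u≢v
      ordered-or-none .yᵛ zᵛ .zᵛ _ _ v≢w | inj₁ _ | inj₂ yz | _ = contradiction refl v≢w
      ordered-or-none .yᵛ (xᵛ j) .zᵛ _ _ _ | inj₁ _ | inj₂ yz | _ =
        Sum.map (λ { (1st s) → 3rd s ; (2nd s) → 2nd (flip s) ; (3rd s) → 1st s })
                (λ e → j , e , 1st refl , 3rd refl , 2nd refl) (yzx-ordered j)
      ordered-or-none .zᵛ yᵛ .yᵛ _ _ v≢w | inj₁ _ | inj₂ zy | _ = contradiction refl v≢w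
      ordered-or-none .zᵛ zᵛ .yᵛ u≢v _ _ | inj₁ _ | inj₂ zy | _ = contradiction refl u≢v
      ordered-or-none .zᵛ (xᵛ j) .yᵛ _ _ _ | inj₁ _ | inj₂ zy | _ =
        Sum.map (λ { (1st s) → 2nd (flip s) ; (2nd s) → 3rd s ; (3rd s) → 1st (flip s) })
                (λ e → j , e , 3rd refl , 1st refl , 2nd refl) (yzx-ordered j)
      ordered-or-none yᵛ .yᵛ .zᵛ u≢v _ _ | inj₁ _ | inj₁ _ | inj₂ yz = contradiction refl u≢v
      ordered-or-none zᵛ .yᵛ .zᵛ _ u≢w _ | inj₁ _ | inj₁ _ | inj₂ yz = contradiction refl u≢w
      ordered-or-none (xᵛ j) .yᵛ .zᵛ _ _ _ | inj₁ _ | inj₁ _ | inj₂ yz =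
        Sum.map (λ { (1st s) → 3rd (flip s) ; (2nd s) → 1st (flip s) ; (3rd s) → 2nd s })
                (λ e → j , e , 2nd refl , 3rd refl , 1st refl) (yzx-ordered j)
      ordered-or-none yᵛ .zᵛ .yᵛ _ u≢w _ | inj₁ _ | inj₁ _ | inj₂ zy = contradiction refl u≢w
      ordered-or-none zᵛ .zᵛ .yᵛ u≢v _ _ | inj₁ _ | inj₁ _ | inj₂ zy = contradiction refl u≢v
      ordered-or-none (xᵛ j) .zᵛ .yᵛ _ _ _ | inj₁ _ | inj₁ _ | inj₂ zy =
        Sum.map (λ { (1st s) → 1st (flip s) ; (2nd s) → 3rd (flip s) ; (3rd s) → 2nd (flip s) })
                (λ e → j , e , 3rd refl , 2nd refl , 1st refl) (yzx-ordered j)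

    -- Coordinates in which an abstract structure and one induced by a graph can be compared: `σ`
    -- names the points, and the other two fields say that `Spec` is the whole betweenness relation.
    record Form (𝓑 : BetweennessStructure (3 + k)) (by bz : ℕ) (mid : Fin (suc k) → Middle) : Set where
      field
        σ        : Permutation (3 + k) (3 + k)
        sound    : ∀ {u v w} → Spec by bz mid u v w → β 𝓑 (σ ⟨$⟩ʳ u) (σ ⟨$⟩ʳ v) (σ ⟨$⟩ʳ w)
        complete : ∀ {u v w} → β 𝓑 (σ ⟨$⟩ʳ u) (σ ⟨$⟩ʳ v) (σ ⟨$⟩ʳ w) → Spec by bz mid u v w

    open Form

    form⇒≅ : ∀ {𝓐 𝓑 by bz mid} → Form 𝓐 by bz mid → Form 𝓑 by bz mid → 𝓐 ≅ 𝓑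
    form⇒≅ {𝓐} {𝓑} F G = record
      { bijection = Perm.flip (σ F) Perm.∘ₚ σ G
      ; preserves = λ a b c → mk⇔
          (sound G ∘ complete F ∘ subst₃ (β 𝓐) (sym (back a)) (sym (back b)) (sym (back c)))
          (subst₃ (β 𝓐) (back a) (back b) (back c) ∘ sound F ∘ complete G)
      }
      where
      back : ∀ a → σ F ⟨$⟩ʳ (σ F ⟨$⟩ˡ a) ≡ a
      back a = Perm.inverseʳ (σ F)
      subst₃ : (P : V → V → V → Set) → ∀ {a a′ b b′ c c′} → a ≡ a′ → b ≡ b′ → c ≡ c′ → P a b c → P a′ b′ c′
      subst₃ P refl refl refl p = p

    module _ {𝓑 : BetweennessStructure (3 + k)} {by bz : ℕ} {mid : Fin (suc k) → Middle}
             (f : V → V) (f-injective : ∀ {u v} → f u ≡ f v → u ≡ v)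
             (chains : ∀ {u v w} → _≺_ by bz u v → _≺_ by bz v w → _≺_ by bz u w → β 𝓑 (f u) (f v) (f w))
             (mids : ∀ {j} → (mid j ≡ ofˣ → β 𝓑 (f yᵛ) (f (xᵛ j)) (f zᵛ)) × (mid j ≡ ofʸ → β 𝓑 (f zᵛ) (f yᵛ) (f (xᵛ j))) ×
                             (mid j ≡ ofᶻ → β 𝓑 (f yᵛ) (f zᵛ) (f (xᵛ j))) × (mid j ≡ missing → Tri 𝓑 (f yᵛ) (f zᵛ) (f (xᵛ j))))
      where

      private
        f-sound : ∀ {u v w} → Spec by bz mid u v w → β 𝓑 (f u) (f v) (f w)
        f-sound start         = P1 𝓑 _ _
        f-sound (flip s)      = P2 𝓑 _ _ _ (f-sound s)
        f-sound (chain p q r) = chains p q r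
        f-sound (midˣ e)      = proj₁ mids e
        f-sound (midʸ e)      = proj₁ (proj₂ mids) e
        f-sound (midᶻ e)      = proj₁ (proj₂ (proj₂ mids)) e

        f-oneOf : ∀ {a u v w} → OneOf a u v w → OneOf (f a) (f u) (f v) (f w)
        f-oneOf (1st refl) = 1st refl
        f-oneOf (2nd refl) = 2nd refl
        f-oneOf (3rd refl) = 3rd refl

        f-complete : ∀ {u v w} → β 𝓑 (f u) (f v) (f w) → Spec by bz mid u v w
        f-complete {u} {v} {w} b with u Fin.≟ v | v Fin.≟ w | u Fin.≟ w
        ... | yes refl | _ | _ = start
        ... | _ | yes refl | _ = flip start
        ... | no u≢v | _ | yes refl = contradiction (f-injective (β-ends 𝓑 b)) u≢v
        ... | no u≢v | no v≢w | no u≢w with ordered-or-none by bz mid u v w u≢v u≢w v≢w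
        ...   | inj₁ (1st s) = s
        ...   | inj₁ (2nd s) = contradiction (f-injective (P3 𝓑 _ _ _ b (f-sound s))) u≢v
        ...   | inj₁ (3rd s) =
          contradiction (f-injective (P3 𝓑 _ _ _ (P2 𝓑 _ _ _ b) (P2 𝓑 _ _ _ (f-sound s)))) (v≢w ∘ sym)
        ...   | inj₂ (j , e , p , q , r) =
          contradiction b (proj₁ (tri-perm 𝓑 (proj₂ (proj₂ (proj₂ mids)) e) (f-oneOf p) (f-oneOf q) (f-oneOf r)))

      -- Completeness follows from soundness. If β holds for distinct points and `Spec` puts a
      -- different one in the middle, P3 is violated; if `Spec` puts none there, the points form a
      -- triangle by assumption.
      mkForm : Form 𝓑 by bz mid
      mkForm = record
        { σ = Perm.permutation f (proj₁ ∘ onto) ((proj₂ ∘ onto)) (λ v → f-injective (proj₂ (onto (f v))))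
        ; sound = f-sound
        ; complete = f-complete
        }
        where onto = injective⇒surjective f-injective

    form-cong : ∀ {𝓑 by bz mid mid′} → (∀ j → mid j ≡ mid′ j) → Form 𝓑 by bz mid → Form 𝓑 by bz mid′
    form-cong {by = by} {bz} eq F = record
      { σ = σ F ; sound = sound F ∘ transfer (λ j → sym (eq j)) ; complete = transfer eq ∘ complete F }
      where
      transfer : ∀ {m m′} → (∀ j → m j ≡ m′ j) → ∀ {u v w} → Spec by bz m u v w → Spec by bz m′ u v w
      transfer e start         = start
      transfer e (flip s)      = flip (transfer e s)
      transfer e (chain p q r) = chain p q r
      transfer e (midˣ p)      = midˣ (trans (sym (e _)) p)
      transfer e (midʸ p)      = midʸ (trans (sym (e _)) p)
      transfer e (midᶻ p)      = midᶻ (trans (sym (e _)) p)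

    relabel : ∀ {𝓑 by bz by′ bz′ mid mid′} (τ : V → V) → (∀ v → τ (τ v) ≡ v) →
              (∀ {u v w} → Spec by bz mid u v w → Spec by′ bz′ mid′ (τ u) (τ v) (τ w)) →
              (∀ {u v w} → Spec by′ bz′ mid′ u v w → Spec by bz mid (τ u) (τ v) (τ w)) →
              Form 𝓑 by bz mid → Form 𝓑 by′ bz′ mid′
    relabel {by′ = by′} {bz′} {mid′ = mid′} τ ττ to from F = record
      { σ = Perm.permutation τ τ ττ ττ Perm.∘ₚ σ F
      ; sound = sound F ∘ from
      ; complete = λ b → back (to (complete F b))
      }
      where
      back : ∀ {u v w} → Spec by′ bz′ mid′ (τ (τ u)) (τ (τ v)) (τ (τ w)) → Spec by′ bz′ mid′ u v w
      back {u} {v} {w} s with τ (τ u) | τ (τ v) | τ (τ w) | ττ u | ττ v | ττ w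
      ... | _ | _ | _ | refl | refl | refl = s

    exchange : V → V
    exchange yᵛ     = zᵛ
    exchange zᵛ     = yᵛ
    exchange (xᵛ i) = xᵛ i

    form-exchange : ∀ {𝓑 by bz mid} → Form 𝓑 by bz mid → Form 𝓑 bz by (swapʸᶻ ∘ mid)
    form-exchange {mid = mid} = relabel exchange invol (spec (λ j → refl)) (spec (λ j → swap-swap (mid j)))
      where
      invol : ∀ v → exchange (exchange v) ≡ v
      invol yᵛ     = refl
      invol zᵛ     = refl
      invol (xᵛ _) = refl
      swap-swap : ∀ a → swapʸᶻ (swapʸᶻ a) ≡ a
      swap-swap ofˣ  = refl
      swap-swap ofʸ  = refl
      swap-swap ofᶻ  = refl
      swap-swap missing = refl
      ex-≺ : ∀ {by bz u v} → _≺_ by bz u v → _≺_ bz by (exchange u) (exchange v)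
      ex-≺ (x≺x p) = x≺x p
      ex-≺ (x≺y p) = x≺z p
      ex-≺ (y≺x p) = z≺x p
      ex-≺ (x≺z p) = x≺y p
      ex-≺ (z≺x p) = y≺x p
      spec : ∀ {by bz mid mid′} → (∀ j → swapʸᶻ (mid j) ≡ mid′ j) →
             ∀ {u v w} → Spec by bz mid u v w → Spec bz by mid′ (exchange u) (exchange v) (exchange w)
      spec e start         = start
      spec e (flip s)      = flip (spec e s)
      spec e (chain p q r) = chain (ex-≺ p) (ex-≺ q) (ex-≺ r)
      spec e (midˣ p)      = flip (midˣ (trans (sym (e _)) (cong swapʸᶻ p)))
      spec e (midʸ p)      = midᶻ (trans (sym (e _)) (cong swapʸᶻ p))
      spec e (midᶻ p)      = midʸ (trans (sym (e _)) (cong swapʸᶻ p))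

    backwards : V → V
    backwards yᵛ     = yᵛ
    backwards zᵛ     = zᵛ
    backwards (xᵛ i) = xᵛ (opposite i)

    form-reverse : ∀ {𝓑 by bz mid} → by ≤ suc k → bz ≤ suc k →
                   Form 𝓑 by bz mid → Form 𝓑 (suc k ∸ by) (suc k ∸ bz) (mid ∘ opposite)
    form-reverse {by = by} {bz} {mid} by≤ bz≤ =
      relabel backwards invol (spec by≤ bz≤ (λ j → cong mid (sym (Fin.opposite-involutive j))))
      -- The converse direction is the same map once more; it restores the cuts because
      -- `suc k ∸ (suc k ∸ b)` is `b` for `b ≤ suc k`.
      (subst₂ (λ a b → ∀ {u v w} → Spec (suc k ∸ by) (suc k ∸ bz) (mid ∘ opposite) u v w → Spec a b mid (backwards u) (backwards v) (backwards w))
        (ℕ.m∸[m∸n]≡n by≤) (ℕ.m∸[m∸n]≡n bz≤) (spec (ℕ.m∸n≤m (suc k) by) (ℕ.m∸n≤m (suc k) bz) (λ j → refl)))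
      where
      invol : ∀ v → backwards (backwards v) ≡ v
      invol yᵛ     = refl
      invol zᵛ     = refl
      invol (xᵛ i) = cong (λ i → suc (suc i)) (Fin.opposite-involutive i)
      op : ∀ (i : Fin (suc k)) → suc (toℕ (opposite i)) ≡ suc k ∸ toℕ i
      op i = trans (cong suc (Fin.opposite-prop i)) (sym (ℕ.+-∸-assoc 1 (ℕ.≤-pred (Fin.toℕ<n i))))
      <⇒ : ∀ {i b} → toℕ i < b → suc k ∸ b ≤ toℕ (opposite i)
      <⇒ {i} {b} i<b = subst (suc k ∸ b ≤_) (sym (Fin.opposite-prop i)) (ℕ.∸-monoʳ-≤ (suc k) i<b)
      ≤⇒ : ∀ {i b} → b ≤ suc k → b ≤ toℕ i → toℕ (opposite i) < suc k ∸ b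
      ≤⇒ {i} {b} _ b≤i = subst (_≤ suc k ∸ b) (sym (op i)) (ℕ.∸-monoʳ-≤ (suc k) b≤i)
      op-< : ∀ {i j : Fin (suc k)} → toℕ i < toℕ j → toℕ (opposite j) < toℕ (opposite i)
      op-< {i} {j} i<j = subst₂ _≤_ (sym (op j)) (sym (Fin.opposite-prop i)) (ℕ.∸-monoʳ-≤ (suc k) i<j)
      rev-≺ : ∀ {by bz u v} → by ≤ suc k → bz ≤ suc k → _≺_ by bz u v →
        _≺_ (suc k ∸ by) (suc k ∸ bz) (backwards v) (backwards u)
      rev-≺ _ _ (x≺x {i} {j} p) = x≺x (op-< {i} {j} p)
      rev-≺ _ _ (x≺y {i} p) = y≺x (<⇒ {i} p)
      rev-≺ b _ (y≺x {i} p) = x≺y (≤⇒ {i} b p)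
      rev-≺ _ _ (x≺z {i} p) = z≺x (<⇒ {i} p)
      rev-≺ _ b (z≺x {i} p) = x≺z (≤⇒ {i} b p)
      spec : ∀ {by bz mid mid′} → by ≤ suc k → bz ≤ suc k → (∀ j → mid j ≡ mid′ (opposite j)) →
             ∀ {u v w} → Spec by bz mid u v w → Spec (suc k ∸ by) (suc k ∸ bz) mid′ (backwards u) (backwards v) (backwards w)
      spec a b e start         = start
      spec a b e (flip s)      = flip (spec a b e s)
      spec a b e (chain p q r) = flip (chain (rev-≺ a b q) (rev-≺ a b p) (rev-≺ a b r))
      spec a b e (midˣ p)      = midˣ (trans (sym (e _)) p)
      spec a b e (midʸ p)      = midʸ (trans (sym (e _)) p)
      spec a b e (midᶻ p)      = midᶻ (trans (sym (e _)) p)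

    -- By `ordered-or-none` a triangle consists of `y`, `z` and an `xⱼ` with label `missing`. So the
    -- `k + 1` candidates for `xⱼ` split into the triangles and `bad`.
    form-τ : ∀ {𝓑 by bz mid} → Form 𝓑 by bz mid → (bad : List (Fin (suc k))) → Unique bad →
                  (∀ {j} → mid j ≢ missing → j ∈ bad) → (∀ {j} → j ∈ bad → mid j ≢ missing) →
                  τ 𝓑 + length bad ≡ suc k
    form-τ {𝓑} {by} {bz} {mid} F bad bad! bad⁺ bad⁻ = partition-length f-injective (triangles-unique 𝓑) bad!
      (triangle⇒f ∘ ∈-triangles⁻ 𝓑) (λ f∈ j∈ → bad⁻ j∈ (tri⇒missing (triangle-members 𝓑 (∈-triangles⁻ 𝓑 f∈)))) covered
      where
      s : V → V
      s v = σ F ⟨$⟩ʳ v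
      s-injective : ∀ {u v} → s u ≡ s v → u ≡ v
      s-injective eq = trans (sym (Perm.inverseˡ (σ F))) (trans (cong (σ F ⟨$⟩ˡ_) eq) (Perm.inverseˡ (σ F)))
      f : Fin (suc k) → _
      f j = tset (s yᵛ) (s zᵛ) (s (xᵛ j))
      f-injective : ∀ {i j} → f i ≡ f j → i ≡ j
      f-injective {i} {j} eq with ∈-tset⁻ (subst (λ p → s (xᵛ i) ∈ˢ p) eq (∈-tset⁺ {a = s yᵛ} {s zᵛ} (3rd refl)))
      ... | 1st e with () ← s-injective {xᵛ i} {yᵛ} e
      ... | 2nd e with () ← s-injective {xᵛ i} {zᵛ} e
      ... | 3rd e = Fin.suc-injective (Fin.suc-injective (s-injective e))
      ordered⇒¬tri : ∀ {u v w} → Ordered by bz mid u v w → ¬ Tri 𝓑 (s u) (s v) (s w)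
      ordered⇒¬tri (1st o) t = proj₁ t (sound F o)
      ordered⇒¬tri (2nd o) t = proj₁ (proj₂ t) (sound F o)
      ordered⇒¬tri (3rd o) t = proj₂ (proj₂ t) (sound F o)
      missing⇒tri : ∀ {j} → mid j ≡ missing → Tri 𝓑 (s yᵛ) (s zᵛ) (s (xᵛ j))
      missing⇒tri {j} e with collinear-or-tri 𝓑 (s yᵛ) (s zᵛ) (s (xᵛ j))
      ... | inj₂ t = t
      ... | inj₁ col = ⊥-elim (noSpec col)
        where
        missing≢ : ∀ {a} → mid j ≡ a → a ≡ missing
        missing≢ e′ = trans (sym e′) e
        -- All six arrangements are listed so that the family is closed under `flip` and the
        -- induction over `Spec` goes through.
        data YZX : V → V → V → Set where
          is₁ : YZX yᵛ zᵛ (xᵛ j)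
          is₂ : YZX zᵛ yᵛ (xᵛ j)
          is₃ : YZX yᵛ (xᵛ j) zᵛ
          is₄ : YZX (xᵛ j) zᵛ yᵛ
          is₅ : YZX (xᵛ j) yᵛ zᵛ
          is₆ : YZX zᵛ (xᵛ j) yᵛ
        YZX-flip : ∀ {u v w} → YZX u v w → YZX w v u
        YZX-flip is₁ = is₄
        YZX-flip is₂ = is₅
        YZX-flip is₃ = is₆
        YZX-flip is₄ = is₁
        YZX-flip is₅ = is₂
        YZX-flip is₆ = is₃
        no-spec : ∀ {u v w} → Spec by bz mid u v w → ¬ YZX u v w
        no-spec start ()
        no-spec (flip p) i = no-spec p (YZX-flip i)
        no-spec (chain () _ _) is₁
        no-spec (chain () _ _) is₂
        no-spec (chain _ _ ()) is₃
        no-spec (chain _ () _) is₄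
        no-spec (chain _ () _) is₅
        no-spec (chain _ _ ()) is₆
        no-spec (midˣ e′) is₃ with () ← missing≢ e′
        no-spec (midʸ e′) is₂ with () ← missing≢ e′
        no-spec (midᶻ e′) is₁ with () ← missing≢ e′
        noSpec : ¬ (β 𝓑 (s yᵛ) (s zᵛ) (s (xᵛ j)) ⊎ β 𝓑 (s zᵛ) (s yᵛ) (s (xᵛ j)) ⊎ β 𝓑 (s yᵛ) (s (xᵛ j)) (s zᵛ))
        noSpec (1st b) = no-spec (complete F b) is₁
        noSpec (2nd b) = no-spec (complete F b) is₂
        noSpec (3rd b) = no-spec (complete F b) is₃
      tri⇒missing : ∀ {j} → Tri 𝓑 (s yᵛ) (s zᵛ) (s (xᵛ j)) → mid j ≡ missing
      tri⇒missing {j} t with yzx-ordered by bz mid j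
      ... | inj₁ o = contradiction t (ordered⇒¬tri o)
      ... | inj₂ e = e
      s-oneOf : ∀ {a u v w} → OneOf a u v w → OneOf (s a) (s u) (s v) (s w)
      s-oneOf (1st refl) = 1st refl
      s-oneOf (2nd refl) = 2nd refl
      s-oneOf (3rd refl) = 3rd refl
      triangle⇒f : ∀ {p} → Triangle 𝓑 p → ∃ λ j → p ≡ f j
      triangle⇒f tr with triangle⇒tri 𝓑 tr
      ... | a , b , c , refl , t =
        go (σ F ⟨$⟩ˡ a) (σ F ⟨$⟩ˡ b) (σ F ⟨$⟩ˡ c) (Perm.inverseʳ (σ F)) (Perm.inverseʳ (σ F)) (Perm.inverseʳ (σ F))
        where
        go : ∀ u v w → s u ≡ a → s v ≡ b → s w ≡ c → ∃ λ j → tset a b c ≡ f j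
        go u v w refl refl refl with tri-distinct 𝓑 t
        ... | p , q , r with ordered-or-none by bz mid u v w (p ∘ cong s) (q ∘ cong s) (r ∘ cong s)
        ...   | inj₁ o = contradiction t (ordered⇒¬tri o)
        ...   | inj₂ (j , _ , oy , oz , ox) with oneOf-converse (λ ()) (λ ()) (λ ()) oy oz ox
        ...     | ou , ov , ow =
          j , tset-≡ (s-oneOf ou) (s-oneOf ov) (s-oneOf ow) (s-oneOf oy) (s-oneOf oz) (s-oneOf ox)
      covered : ∀ j → f j ∈ triangles 𝓑 ⊎ j ∈ bad
      covered j = go (none? (mid j))
        where
        go : Dec (mid j ≡ missing) → f j ∈ triangles 𝓑 ⊎ j ∈ bad
        go (yes e) = inj₁ (∈-triangles⁺ 𝓑 (tri⇒triangle 𝓑 (missing⇒tri e)))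
        go (no ¬e) = inj₂ (bad⁺ ¬e)

-- Two points with cuts in the same path

module TwoInsertions where

  open Triangles
  open PathStates
  open LinearStructures
  open Forms
  open import Data.Nat using (_+_; _≤_; _<_)

  open BetweennessStructure
  open Path
  open Cut

  module _ {A : Set} where

    insert-below : ∀ {c j} (q : A) w → j < c → insert c q w j ≡ w j
    insert-below {suc c} {zero}  q w _         = refl
    insert-below {suc c} {suc j} q w (s≤s j<c) = insert-below q (w ∘ suc) j<c

    insert-at : ∀ c (q : A) w → insert c q w c ≡ q
    insert-at zero    q w = refl
    insert-at (suc c) q w = insert-at c q (w ∘ suc)

    insert-above : ∀ {c j} (q : A) w → c ≤ j → insert c q w (suc j) ≡ w j
    insert-above {zero}          q w _         = refl
    insert-above {suc c} {suc j} q w (s≤s c≤j) = insert-above q (w ∘ suc) c≤j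

  -- `punchIn` for natural numbers: the increasing enumeration of all indices except `i`.
  skip : ℕ → ℕ → ℕ
  skip zero    j       = suc j
  skip (suc i) zero    = zero
  skip (suc i) (suc j) = suc (skip i j)

  skip-below : ∀ {i j} → j < i → skip i j ≡ j
  skip-below {suc i} {zero}  _         = refl
  skip-below {suc i} {suc j} (s≤s j<i) = cong suc (skip-below j<i)

  skip-above : ∀ {i j} → i ≤ j → skip i j ≡ suc j
  skip-above {zero}          _         = refl
  skip-above {suc i} {suc j} (s≤s i≤j) = cong suc (skip-above i≤j)

  skip-mono : ∀ i {j k} → j < k → skip i j < skip i k
  skip-mono zero            j<k       = s≤s j<k
  skip-mono (suc i) {zero}  {suc k} _ = s≤s z≤n
  skip-mono (suc i) {suc j} (s≤s j<k) = s≤s (skip-mono i j<k)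

  skip-bound : ∀ i {j m} → j < m → skip i j < suc m
  skip-bound i {j} j<m with ℕ.<-≤-connex j i
  ... | inj₁ j<i = subst (_< _) (sym (skip-below j<i)) (ℕ.<-trans j<m (ℕ.n<1+n _))
  ... | inj₂ i≤j = subst (_< _) (sym (skip-above i≤j)) (s≤s j<m)

  skip≢ : ∀ i j → skip i j ≢ i
  skip≢ zero    j       ()
  skip≢ (suc i) zero    ()
  skip≢ (suc i) (suc j) eq = skip≢ i j (ℕ.suc-injective eq)

  module _ {n : ℕ} (𝓑 : BetweennessStructure n) where

    remove-path : ∀ {m w i} → i < suc m → Path 𝓑 (suc m) w → Path 𝓑 m (w ∘ skip i) × Cut 𝓑 m (w ∘ skip i) (w i) i
    remove-path {m} {w} {i} i≤m P = path-∘ 𝓑 (skip-mono i) (skip-bound i) P , record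
      { c≤m    = ℕ.≤-pred i≤m
      ; after  =
        λ {a} {b} a<b b<i → subst₂ (λ s t → β 𝓑 (w s) (w t) (w i)) (sym (skip-below (ℕ.<-trans a<b b<i))) (sym (skip-below b<i))
                   (ordered P a<b b<i i≤m)
      ; across =
        λ {a} {b} a<i i≤b b<m → subst₂ (λ s t → β 𝓑 (w s) (w i) (w t)) (sym (skip-below a<i)) (sym (skip-above i≤b))
                   (ordered P a<i (s≤s i≤b) (s≤s b<m))
      ; before =
        λ {a} {b} a<b i≤a b<m → subst₂ (λ s t → β 𝓑 (w i) (w s) (w t)) (sym (skip-above i≤a)) (sym (skip-above (ℕ.≤-trans i≤a (ℕ.<⇒≤ a<b))))
                   (ordered P (s≤s i≤a) (s≤s a<b) (s≤s b<m))
      }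

    module TwoCuts {m : ℕ} {x : ℕ → Fin n} (P : Path 𝓑 (suc m) x) (0<m : 0 < m) {y z : Fin n} {by bz : ℕ}
      (Cy : Cut 𝓑 (suc m) x y by) (Cz : Cut 𝓑 (suc m) x z bz)
      (y∉ : ∀ {j} → j < suc m → y ≢ x j) (z∉ : ∀ {j} → j < suc m → z ≢ x j) (y≢z : y ≢ z)
      (triangle : ∃ λ j → j < suc m × Tri 𝓑 y z (x j)) where

      w : ℕ → Fin n
      w = insert bz z x

      W : Path 𝓑 (2 + m) w
      W = insert-path 𝓑 P z∉ Cz

      y∉w : ∀ {j} → j < 2 + m → y ≢ w j
      y∉w {j} = go (insertView bz z x j)
        where
        go : ∀ {j v} → InsertView bz z x j v → j < 2 + m → y ≢ v
        go (below j<b) _   = y∉ (ℕ.<-≤-trans j<b (c≤m Cz))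
        go at          _   = y≢z
        go (above _)   j<m = y∉ (ℕ.≤-pred j<m)

      open Extension 𝓑 W y∉w

      w-below : ∀ {j} → j < bz → w j ≡ x j
      w-below = insert-below z x
      w-at : w bz ≡ z
      w-at = insert-at bz z x
      w-above : ∀ {j} → bz ≤ j → w (suc j) ≡ x j
      w-above = insert-above z x

      -- A cut of `y` in `w` would make `y` collinear with `z` and every `xⱼ`, against `triangle`.
      -- The following lemmas are proved by inserting `y` into `w`.
      nonlinear : ∀ {c} → ¬ Cut 𝓑 (2 + m) w y c
      nonlinear C = go (proj₂ triangle)
        where
        go : ∀ {j} → j < suc m × Tri 𝓑 y z (x j) → ⊥
        go {j} (j<m , t) with ℕ.<-≤-connex j bz
        ... | inj₁ j<b = cut⇒¬tri 𝓑 C j<b (s≤s (c≤m Cz))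
          (subst₂ (Tri 𝓑 y) (sym (w-below j<b)) (sym w-at) (tri-perm 𝓑 t (1st refl) (3rd refl) (2nd refl)))
        ... | inj₂ b≤j = cut⇒¬tri 𝓑 C (s≤s b≤j) (s≤s j<m) (subst₂ (Tri 𝓑 y) (sym w-at) (sym (w-above b≤j)) t)

      -- If `by` were positive, `y` would lie between two points that are still consecutive in `w`,
      -- since `z` comes later, and would have a cut there. So `y` precedes all `xⱼ`; if `z` were
      -- not behind the last of them, `w` would start and end with points of `x`, and `y` could be
      -- put in front.
      by<bz⇒ends : by < bz → by ≡ 0 × bz ≡ suc m
      by<bz⇒ends by<bz = by≡0 (by) refl , bz≡1+m
        where
        by≡0 : ∀ b → b ≡ by → by ≡ 0
        by≡0 zero    e    = sym e
        by≡0 (suc b) refl = ⊥-elim (nonlinear (M⇒cut (ℕ.<-trans by<bz (s≤s (c≤m Cz)))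
          (subst₂ (λ s t → β 𝓑 s y t) (sym (w-below (ℕ.<⇒≤ by<bz))) (sym (w-below by<bz))
            (across Cy (ℕ.n<1+n b) ℕ.≤-refl (ℕ.<-≤-trans by<bz (c≤m Cz))))))
        bz≡1+m : bz ≡ suc m
        bz≡1+m with ℕ.m≤n⇒m<n∨m≡n (c≤m Cz)
        ... | inj₂ e    = e
        ... | inj₁ bz≤m = ⊥-elim (nonlinear (L⇒cut refl
          (subst₂ (β 𝓑 y) (sym (w-below (ℕ.≤-<-trans z≤n by<bz))) (sym (w-above (ℕ.≤-pred bz≤m)))
            (before Cy 0<m (ℕ.≤-reflexive (by≡0 by refl)) (ℕ.n<1+n m)))))

      -- Otherwise y could be inserted into w next to z.
      ¬midᶻ : by ≡ bz → ∀ {j} → j < suc m → ¬ β 𝓑 y z (x j)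
      ¬midᶻ refl {j} j<m yzx with ℕ.<-≤-connex j bz
      ... | inj₂ b≤j = at-right bz refl
        where
        b<m : bz < suc m
        b<m = ℕ.≤-<-trans b≤j j<m
        -- Replaces `x j` by the neighbour of `z` on the same side.
        yzb : β 𝓑 y z (x bz)
        yzb with ℕ.m≤n⇒m<n∨m≡n b≤j
        ... | inj₂ refl = yzx
        ... | inj₁ b<j  =
          P2 𝓑 _ _ _ (proj₂ (P4 𝓑 _ _ _ _ (P2 𝓑 _ _ _ yzx) (P2 𝓑 _ _ _ (before Cz b<j ℕ.≤-refl j<m))))
        l : Is L bz (suc bz)
        l = subst₂ (β 𝓑 y) (sym w-at) (sym (w-above ℕ.≤-refl)) yzb
        -- Now `z` is between `y` and its right neighbour, so `y` belongs immediately to the left of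
        -- `z`: at the very front if `z` is first in `w`, and otherwise in the edge that ends at
        -- `z`.
        at-right : ∀ b → b ≡ bz → ⊥
        at-right zero refl = nonlinear (L⇒cut refl (LL⇒ (s≤s z≤n) (s≤s 0<m) (ℕ.n<1+n _) l
          (before Cy 0<m z≤n (ℕ.n<1+n m))))
        at-right (suc b) refl = nonlinear (M⇒cut (s≤s (c≤m Cz)) (ML⇒ (ℕ.n<1+n b) (ℕ.n<1+n _) (s≤s b<m)
          (subst₂ (λ s t → β 𝓑 s y t) (sym (w-below (ℕ.n<1+n b))) (sym (w-above ℕ.≤-refl)) (across Cy (ℕ.n<1+n b) ℕ.≤-refl b<m)) l))
      ... | inj₁ j<b = at-left bz refl
        where
        at-left : ∀ b → b ≡ bz → ⊥
        at-left (suc b) refl = by-end (ℕ.m≤n⇒m<n∨m≡n (c≤m Cz))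
          where
          bzy : j < b ⊎ j ≡ b → β 𝓑 (x b) z y
          bzy (inj₂ refl) = P2 𝓑 _ _ _ yzx
          bzy (inj₁ j<b′) = proj₂ (P4 𝓑 _ _ _ _ (P2 𝓑 _ _ _ yzx) (after Cz j<b′ (ℕ.n<1+n b)))
          r : Is R b (suc b)
          r =
            subst₂ (λ s t → β 𝓑 s t y) (sym (w-below (ℕ.n<1+n b))) (sym w-at) (bzy (ℕ.m≤n⇒m<n∨m≡n (ℕ.≤-pred j<b)))
          by-end : suc b < suc m ⊎ suc b ≡ suc m → ⊥
          by-end (inj₁ b<m) = nonlinear (M⇒cut (s≤s b<m) (MR⇒ (ℕ.n<1+n b) (ℕ.n<1+n _) (s≤s b<m)
            (subst₂ (λ s t → β 𝓑 s y t) (sym (w-below (ℕ.n<1+n b))) (sym (w-above ℕ.≤-refl)) (across Cy (ℕ.n<1+n b) ℕ.≤-refl b<m)) r))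
          by-end (inj₂ refl) = nonlinear (R⇒cut refl (RR⇒ 0<m (ℕ.n<1+n _) (ℕ.n<1+n _)
            (subst₂ (λ s t → β 𝓑 s t y) (sym (w-below (s≤s z≤n))) (sym (w-below (ℕ.n<1+n m))) (after Cy 0<m (ℕ.n<1+n m))) r))

      -- From `y` and from `z` the points of one side are met in the same order, starting next to
      -- the cut. If another point precedes `x j` on its side, then `x j` between `y` and `z` makes
      -- P4 reverse this order as seen from one of them, against P3.
      midˣ⇒ : by ≡ bz → ∀ {j} → j < suc m → β 𝓑 y (x j) z → suc j ≡ by ⊎ j ≡ by
      midˣ⇒ refl {j} j<m yxz with ℕ.<-cmp j bz
      ... | tri≈ _ e _ = inj₂ e
      ... | tri> _ _ b<j = contradiction
        (P3 𝓑 _ _ _ (proj₂ (P4 𝓑 _ _ _ _ yxz (before Cy b<j ℕ.≤-refl j<m))) (P2 𝓑 _ _ _ (before Cz b<j ℕ.≤-refl j<m)))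
        (distinct P b<j j<m)
      ... | tri< j<b _ _ with ℕ.m≤n⇒m<n∨m≡n j<b
      ...   | inj₂ e = inj₁ e
      ...   | inj₁ j+1<b = contradiction
        (P3 𝓑 _ _ _ (after Cz (ℕ.n<1+n j) j+1<b) (proj₂ (P4 𝓑 _ _ _ _ yxz (P2 𝓑 _ _ _ (after Cy (ℕ.n<1+n j) j+1<b)))))
        (distinct P (ℕ.n<1+n j) (ℕ.<-≤-trans j+1<b (c≤m Cy)))

      module Ends (by≡0 : by ≡ 0) (bz≡1+m : bz ≡ suc m) where

        private
          Ly : ∀ {i j} → i < j → j < suc m → β 𝓑 y (x i) (x j)
          Ly i<j = before Cy i<j (ℕ.≤-trans (ℕ.≤-reflexive by≡0) z≤n)
          Rz : ∀ {i j} → i < j → j < suc m → β 𝓑 (x i) (x j) z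
          Rz i<j j<m = after Cz i<j (subst (_ <_) (sym bz≡1+m) j<m)

        -- If `x j` is between `y` and `z`, then so is `x 0`, which is between `y` and `x j` or
        -- equal to `x j`. As `z` is the last point of `w`, this would allow `y` in front of `w`.
        ¬midˣ : ∀ {j} → j < suc m → ¬ β 𝓑 y (x j) z
        ¬midˣ {j} j<m yxz =
          nonlinear (L⇒cut refl (subst₂ (β 𝓑 y) (sym (w-below (subst (0 <_) (sym bz≡1+m) (s≤s z≤n))))
                                                       (sym (subst (λ c → w c ≡ z) bz≡1+m w-at)) (y0z j yxz j<m)))
          where
          y0z : ∀ j → β 𝓑 y (x j) z → j < suc m → β 𝓑 y (x 0) z
          y0z zero    b _   = b
          y0z (suc j) b j<m = proj₁ (P4 𝓑 _ _ _ _ b (Ly (s≤s z≤n) j<m))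

        -- For `j > 0` the point `x 0` is between `y` and `x j`, hence also between `z` and `x j`,
        -- although `x j` is between `x 0` and `z`.
        midʸ⇒ : ∀ {j} → j < suc m → β 𝓑 z y (x j) → j ≡ 0
        midʸ⇒ {zero}  _   _   = refl
        midʸ⇒ {suc j} j<m zyx = contradiction
          (P3 𝓑 _ _ _ (Rz (s≤s z≤n) j<m) (proj₁ (P4 𝓑 _ _ _ _ (P2 𝓑 _ _ _ zyx) (P2 𝓑 _ _ _ (Ly (s≤s z≤n) j<m)))))
          (distinct P (s≤s z≤n) j<m)

        midᶻ⇒ : ∀ {j} → j < suc m → β 𝓑 y z (x j) → j ≡ m
        midᶻ⇒ {j} j<m yzx with ℕ.m≤n⇒m<n∨m≡n (ℕ.≤-pred j<m)
        ... | inj₂ e    = e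
        ... | inj₁ j<m′ = contradiction
          (P3 𝓑 _ _ _ (proj₁ (P4 𝓑 _ _ _ _ (P2 𝓑 _ _ _ yzx) (Rz j<m′ (ℕ.n<1+n m)))) (P2 𝓑 _ _ _ (Ly j<m′ (ℕ.n<1+n m))))
          (distinct P j<m′ (ℕ.n<1+n m))

-- Structures all of whose triangles contain two common points

module TwoHubs where

  open Triangles
  open PathStates
  open LinearStructures
  open Forms
  open TwoInsertions
  open import Data.Nat using (_+_; _∸_; _≤_; _<_)

  open BetweennessStructure
  open Path
  open Cut

  when : Bool → Middle → Middle
  when true  a = a
  when false _ = missing

  -- For `p ≡ q` the label `a` prevails. `classQ` makes use of this: with both cuts at an end of the
  -- path there is only one candidate.
  mid₂ : ∀ {m} → (p q : Fin m) → Middle → Middle → Fin m → Middle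
  mid₂ p q a b j with j Fin.≟ p | j Fin.≟ q
  ... | yes _ | _     = a
  ... | no _  | yes _ = b
  ... | no _  | no _  = missing

  mid₂-≗ : ∀ {m} {p q : Fin m} {a b} {mid : Fin m → Middle} → mid p ≡ a → (q ≢ p → mid q ≡ b) →
           (∀ j → j ≢ p → j ≢ q → mid j ≡ missing) → ∀ j → mid j ≡ mid₂ p q a b j
  mid₂-≗ {p = p} {q} e f g j with j Fin.≟ p | j Fin.≟ q
  ... | yes refl | _        = e
  ... | no j≢p   | yes refl = f j≢p
  ... | no j≢p   | no j≢q   = g j j≢p j≢q

  -- The flags tell which of the two candidates (the neighbours of y and z on the path, or the
  -- ends of the path) are collinear with y and z; the co-size is n - 2 minus their number.
  data Class {k} (𝓑 : BetweennessStructure (3 + k)) : Set where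
    classQ : ∀ r → Form 𝓑 0 0 (mid₂ zero zero (when r ofˣ) missing) → Class 𝓑
    classR : ∀ (i : Fin k) l r →
      Form 𝓑 (suc (toℕ i)) (suc (toℕ i)) (mid₂ (inject₁ i) (suc i) (when l ofˣ) (when r ofˣ)) → Class 𝓑
    classS : ∀ l r → Form 𝓑 0 (suc k) (mid₂ zero (fromℕ k) (when l ofʸ) (when r ofᶻ)) → Class 𝓑

  flag : ∀ {a m} → (m ≢ missing → m ≡ a) → ∃ λ b → m ≡ when b a
  flag {m = m} only with none? m
  ... | yes e = false , e
  ... | no ¬e = true , only ¬e

  count : Middle → ℕ
  count missing = 0
  count _    = 1

  module _ {k} {𝓑 : BetweennessStructure (3 + k)} where

    -- For `p ≡ q` a second label would be counted although `mid₂` ignores it, whence the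
    -- alternative `b ≡ missing`.
    form₂-τ : ∀ {by bz p q a b} → p ≢ q ⊎ b ≡ missing → Form 𝓑 by bz (mid₂ p q a b) →
      τ 𝓑 + (count a + count b) ≡ suc k
    form₂-τ {p = p} {q} {a} {b} dist F =
      trans (cong (τ 𝓑 +_) (sym (trans (length-++ (pick a p)) (cong₂ _+_ (length-pick a) (length-pick b)))))
      (form-τ F (pick a p ++ pick b q) (Unique.++⁺ (pick! a) (pick! b) disjoint) bad⁺ bad⁻)
      where
      pick : Middle → Fin (suc k) → List (Fin (suc k))
      pick missing j = []
      pick _    j = j ∷ []
      length-pick : ∀ a {j} → length (pick a j) ≡ count a
      length-pick missing = refl
      length-pick ofˣ  = refl
      length-pick ofʸ  = refl
      length-pick ofᶻ  = refl
      pick! : ∀ a {j} → Unique (pick a j)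
      pick! missing = []
      pick! ofˣ  = [] ∷ []
      pick! ofʸ  = [] ∷ []
      pick! ofᶻ  = [] ∷ []
      ∈-pick⁺ : ∀ {a j} → a ≢ missing → j ∈ pick a j
      ∈-pick⁺ {missing} ne = contradiction refl ne
      ∈-pick⁺ {ofˣ} _ = here refl
      ∈-pick⁺ {ofʸ} _ = here refl
      ∈-pick⁺ {ofᶻ} _ = here refl
      ∈-pick⁻ : ∀ {a i j} → i ∈ pick a j → i ≡ j × a ≢ missing
      ∈-pick⁻ {ofˣ} (here e) = e , λ ()
      ∈-pick⁻ {ofʸ} (here e) = e , λ ()
      ∈-pick⁻ {ofᶻ} (here e) = e , λ ()
      disjoint : ∀ {j} → ¬ (j ∈ pick a p × j ∈ pick b q)
      disjoint (i , i′) =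
        Sum.[ (λ p≢q → p≢q (trans (sym (proj₁ (∈-pick⁻ i))) (proj₁ (∈-pick⁻ i′)))) , proj₂ (∈-pick⁻ {b} i′) ] dist
      bad⁺ : ∀ {j} → mid₂ p q a b j ≢ missing → j ∈ pick a p ++ pick b q
      bad⁺ {j} ne with j Fin.≟ p | j Fin.≟ q
      ... | yes refl | _        = ∈-++⁺ˡ (∈-pick⁺ ne)
      ... | no _     | yes refl = ∈-++⁺ʳ (pick a p) (∈-pick⁺ ne)
      ... | no _     | no _     = contradiction refl ne
      bad⁻ : ∀ {j} → j ∈ pick a p ++ pick b q → mid₂ p q a b j ≢ missing
      bad⁻ {j} j∈ with ∈-++⁻ (pick a p) j∈ | j Fin.≟ p | j Fin.≟ q
      ... | inj₁ i | yes _ | _     = proj₂ (∈-pick⁻ i)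
      ... | inj₁ i | no ne | _     = contradiction (proj₁ (∈-pick⁻ i)) ne
      ... | inj₂ i | no _  | yes _ = proj₂ (∈-pick⁻ i)
      ... | inj₂ i | no _  | no ne = contradiction (proj₁ (∈-pick⁻ i)) ne
      ... | inj₂ i | yes refl | _ =
        contradiction i (λ i → Sum.[ (λ p≢q → p≢q (proj₁ (∈-pick⁻ i))) , proj₂ (∈-pick⁻ {b} i) ] dist)

  module _ {k} (𝓑 : BetweennessStructure (3 + k)) where

    middle : Fin (3 + k) → Fin (3 + k) → Fin (3 + k) → Middle
    middle y z x with collinear-or-tri 𝓑 y z x
    ... | inj₁ (1st _) = ofᶻ
    ... | inj₁ (2nd _) = ofʸ
    ... | inj₁ (3rd _) = ofˣ
    ... | inj₂ _       = missing

    Mid : Fin (3 + k) → Fin (3 + k) → Fin (3 + k) → Middle → Set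
    Mid y z x ofˣ  = β 𝓑 y x z
    Mid y z x ofʸ  = β 𝓑 z y x
    Mid y z x ofᶻ  = β 𝓑 y z x
    Mid y z x missing = Tri 𝓑 y z x

    is-middle : ∀ {y z x a} → middle y z x ≡ a → Mid y z x a
    is-middle {y} {z} {x} refl with collinear-or-tri 𝓑 y z x
    ... | inj₁ (1st p) = p
    ... | inj₁ (2nd p) = p
    ... | inj₁ (3rd p) = p
    ... | inj₂ p       = p

    module Assemble {x : ℕ → Fin (3 + k)} (P : Path 𝓑 (suc k) x) {y z : Fin (3 + k)}
      (y∉ : ∀ {j} → j < suc k → y ≢ x j) (z∉ : ∀ {j} → j < suc k → z ≢ x j) (y≢z : y ≢ z) where

      point : V {k} → Fin (3 + k)
      point yᵛ     = y
      point zᵛ     = z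
      point (xᵛ j) = x (toℕ j)

      point-injective : ∀ {u v : V {k}} → point u ≡ point v → u ≡ v
      point-injective {yᵛ}   {yᵛ}   e = refl
      point-injective {yᵛ}   {zᵛ}   e = contradiction e y≢z
      point-injective {yᵛ}   {xᵛ j} e = contradiction e (y∉ (Fin.toℕ<n j))
      point-injective {zᵛ}   {yᵛ}   e = contradiction (sym e) y≢z
      point-injective {zᵛ}   {zᵛ}   e = refl
      point-injective {zᵛ}   {xᵛ j} e = contradiction e (z∉ (Fin.toℕ<n j))
      point-injective {xᵛ i} {yᵛ}   e = contradiction (sym e) (y∉ (Fin.toℕ<n i))
      point-injective {xᵛ i} {zᵛ}   e = contradiction (sym e) (z∉ (Fin.toℕ<n i))
      point-injective {xᵛ i} {xᵛ j} e =
        cong (λ i → suc (suc i)) (Fin.toℕ-injective (path-injective 𝓑 P (Fin.toℕ<n i) (Fin.toℕ<n j) e))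

      -- `point` is an injection between sets of equal size, so the third vertex of a triangle on
      -- `y` and `z` must be a point of the path.
      triangle-on-yz : (∀ {a b c} → Tri 𝓑 a b c → OneOf y a b c) → (∀ {a b c} → Tri 𝓑 a b c → OneOf z a b c) →
                       ∀ {a b c} → Tri 𝓑 a b c → ∃ λ j → j < suc k × Tri 𝓑 y z (x j)
      triangle-on-yz y∈ z∈ {a} {b} {c} t = third (y∈ t) (z∈ t)
        where
        other : ∀ v → Tri 𝓑 y z v → ∃ λ j → j < suc k × Tri 𝓑 y z (x j)
        other v t′ with injective⇒surjective point-injective v
        ... | yᵛ   , refl = contradiction refl (proj₁ (proj₂ (tri-distinct 𝓑 t′)))
        ... | zᵛ   , refl = contradiction refl (proj₂ (proj₂ (tri-distinct 𝓑 t′)))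
        ... | xᵛ j , refl = toℕ j , Fin.toℕ<n j , t′
        third : OneOf y a b c → OneOf z a b c → ∃ λ j → j < suc k × Tri 𝓑 y z (x j)
        third (1st refl) (2nd refl) = other c t
        third (1st refl) (3rd refl) = other b (tri-perm 𝓑 t (1st refl) (3rd refl) (2nd refl))
        third (2nd refl) (1st refl) = other c (tri-perm 𝓑 t (2nd refl) (1st refl) (3rd refl))
        third (2nd refl) (3rd refl) = other a (tri-perm 𝓑 t (3rd refl) (1st refl) (2nd refl))
        third (3rd refl) (1st refl) = other b (tri-perm 𝓑 t (2nd refl) (3rd refl) (1st refl))
        third (3rd refl) (2nd refl) = other a (tri-perm 𝓑 t (3rd refl) (2nd refl) (1st refl))
        third (1st refl) (1st e)    = contradiction (sym e) y≢z
        third (2nd refl) (2nd e)    = contradiction (sym e) y≢z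
        third (3rd refl) (3rd e)    = contradiction (sym e) y≢z

      mid : Fin (suc k) → Middle
      mid j = middle y z (x (toℕ j))

      module _ {by bz : ℕ} (Cy : Cut 𝓑 (suc k) x y by) (Cz : Cut 𝓑 (suc k) x z bz) where

        form : Form 𝓑 by bz mid
        form = mkForm point point-injective chains (is-middle , is-middle , is-middle , is-middle)
          where
          chains : ∀ {u v w : V {k}} → _≺_ by bz u v → _≺_ by bz v w → _≺_ by bz u w →
            β 𝓑 (point u) (point v) (point w)
          chains (x≺x p) (x≺x {j = l} q) _ = ordered P p q (Fin.toℕ<n l)
          chains (x≺x p) (x≺y q) _ = after Cy p q
          chains (x≺x p) (x≺z q) _ = after Cz p q
          chains (x≺y p) (y≺x {l} q) _ = across Cy p q (Fin.toℕ<n l)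
          chains (x≺z p) (z≺x {l} q) _ = across Cz p q (Fin.toℕ<n l)
          chains (y≺x p) (x≺x {j = l} q) _ = before Cy q p (Fin.toℕ<n l)
          chains (z≺x p) (x≺x {j = l} q) _ = before Cz q p (Fin.toℕ<n l)
          chains (y≺x p) (x≺y q) ()
          chains (y≺x p) (x≺z q) ()
          chains (z≺x p) (x≺y q) ()
          chains (z≺x p) (x≺z q) ()

    Twin : ℕ → (Fin (suc k) → Middle) → Set
    Twin b mid = ∀ j → mid j ≢ missing → mid j ≡ ofˣ × (suc (toℕ j) ≡ b ⊎ toℕ j ≡ b)

    twin₀-class : ∀ {mid} → Form 𝓑 0 0 mid → Twin 0 mid → Class 𝓑
    twin₀-class F tw with flag (proj₁ ∘ tw zero)
    ... | r , e = classQ r (form-cong (mid₂-≗ e (λ ne → contradiction refl ne) else) F)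
      where
      else : ∀ j → j ≢ zero → j ≢ zero → _ ≡ missing
      else j j≢0 _ with none? _
      ... | yes e = e
      ... | no ¬e with proj₂ (tw j ¬e)
      ...   | inj₂ e = contradiction (Fin.toℕ-injective e) j≢0

    twin-class : ∀ {b mid} → b ≤ suc k → Form 𝓑 b b mid → Twin b mid → Class 𝓑
    twin-class {zero}  _   F tw = twin₀-class F tw
    twin-class {suc b} {mid} b≤k F tw with ℕ.m≤n⇒m<n∨m≡n (ℕ.≤-pred b≤k)
    -- Both points are behind the last `xⱼ`; reading the path backwards puts them in front of the
    -- first.
    ... | inj₂ refl =
      twin₀-class (subst (λ b → Form 𝓑 b b (mid ∘ opposite)) (ℕ.n∸n≡0 (suc k)) (form-reverse ℕ.≤-refl ℕ.≤-refl F))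
                        (λ j ne → proj₁ (tw (opposite j) ne) , inj₂ (last j (proj₂ (tw (opposite j) ne))))
      where
      last : ∀ j → suc (toℕ (opposite j)) ≡ suc k ⊎ toℕ (opposite j) ≡ suc k → toℕ j ≡ 0
      last j (inj₁ e) = trans (cong toℕ (sym (Fin.opposite-involutive j)))
        (trans (Fin.opposite-prop (opposite j)) (trans (cong (suc k ∸_) e) (ℕ.n∸n≡0 (suc k))))
      last j (inj₂ e) = contradiction e (ℕ.<⇒≢ (Fin.toℕ<n (opposite j)))
    ... | inj₁ b<k with fromℕ< b<k | Fin.toℕ-fromℕ< b<k
    ...   | i | refl with flag (proj₁ ∘ tw (inject₁ i)) | flag (proj₁ ∘ tw (suc i))
    ...     | l , e | r , f = classR i l r (form-cong (mid₂-≗ e (λ _ → f) else) F)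
      where
      else : ∀ j → j ≢ inject₁ i → j ≢ suc i → mid j ≡ missing
      else j j≢l j≢r with none? (mid j)
      ... | yes e = e
      ... | no ¬e with proj₂ (tw j ¬e)
      ...   | inj₁ e = contradiction (Fin.toℕ-injective (trans (ℕ.suc-injective e) (sym (Fin.toℕ-inject₁ i)))) j≢l
      ...   | inj₂ e = contradiction (Fin.toℕ-injective e) j≢r

    module _ (0<k : 0 < k) {x : ℕ → Fin (3 + k)} (P : Path 𝓑 (suc k) x) where

      ends-class : ∀ {y z by bz} → Cut 𝓑 (suc k) x y by → Cut 𝓑 (suc k) x z bz →
        (∀ {j} → j < suc k → y ≢ x j) → (∀ {j} → j < suc k → z ≢ x j) → y ≢ z →
        (∃ λ j → j < suc k × Tri 𝓑 y z (x j)) → by < bz → Class 𝓑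
      ends-class {y} {z} {by} {bz} Cy Cz y∉ z∉ y≢z t by<bz =
        classS (proj₁ l) (proj₁ r) (form-cong (mid₂-≗ (proj₂ l) (λ _ → proj₂ r) else)
          (subst₂ (λ b c → Form 𝓑 b c mid) (proj₁ ends) (proj₂ ends) (form Cy Cz)))
        where
        open TwoCuts 𝓑 P 0<k Cy Cz y∉ z∉ y≢z t
        open Assemble P y∉ z∉ y≢z
        ends = by<bz⇒ends by<bz
        open Ends (proj₁ ends) (proj₂ ends)
        cases : ∀ j → mid j ≢ missing → (mid j ≡ ofʸ × j ≡ zero) ⊎ (mid j ≡ ofᶻ × j ≡ fromℕ k)
        cases j ne with mid j in eq
        ... | missing = contradiction refl ne
        ... | ofˣ = contradiction (is-middle eq) (¬midˣ (Fin.toℕ<n j))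
        ... | ofʸ = inj₁ (refl , Fin.toℕ-injective (midʸ⇒ (Fin.toℕ<n j) (is-middle eq)))
        ... | ofᶻ =
          inj₂ (refl , Fin.toℕ-injective (trans (midᶻ⇒ (Fin.toℕ<n j) (is-middle eq)) (sym (Fin.toℕ-fromℕ k))))
        0≢last : zero ≢ fromℕ k
        0≢last e = ℕ.<⇒≢ 0<k (trans (cong toℕ e) (Fin.toℕ-fromℕ k))
        l : ∃ λ b → mid zero ≡ when b ofʸ
        l = flag λ ne → Sum.[ proj₁ , (λ (_ , e) → contradiction e 0≢last) ] (cases zero ne)
        r : ∃ λ b → mid (fromℕ k) ≡ when b ofᶻ
        r = flag λ ne → Sum.[ (λ (_ , e) → contradiction (sym e) 0≢last) , proj₁ ] (cases (fromℕ k) ne)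
        else : ∀ j → j ≢ zero → j ≢ fromℕ k → mid j ≡ missing
        else j j≢0 j≢k with none? (mid j)
        ... | yes e = e
        ... | no ¬e with cases j ¬e
        ...   | inj₁ (_ , e) = contradiction e j≢0
        ...   | inj₂ (_ , e) = contradiction e j≢k

      same-cut-class : ∀ {y z b} → Cut 𝓑 (suc k) x y b → Cut 𝓑 (suc k) x z b →
        (∀ {j} → j < suc k → y ≢ x j) → (∀ {j} → j < suc k → z ≢ x j) → y ≢ z →
        (∃ λ j → j < suc k × Tri 𝓑 y z (x j)) → Class 𝓑
      same-cut-class {y} {z} {b} Cy Cz y∉ z∉ y≢z t@(j₀ , j₀<m , t₀) = twin-class (c≤m Cy) (form Cy Cz) twin
        where
        open Assemble P y∉ z∉ y≢z
        module YZ′ = TwoCuts 𝓑 P 0<k Cy Cz y∉ z∉ y≢z t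
        -- With `y` and `z` exchanged, `¬midᶻ` excludes the label `ofʸ`.
        module ZY′ = TwoCuts 𝓑 P 0<k Cz Cy z∉ y∉ (y≢z ∘ sym) (j₀ , j₀<m , tri-swap 𝓑 t₀)
        twin : Twin b mid
        twin j ne with mid j in eq
        ... | missing = contradiction refl ne
        ... | ofˣ = refl , YZ′.midˣ⇒ refl (Fin.toℕ<n j) (is-middle eq)
        ... | ofʸ = contradiction (is-middle eq) (ZY′.¬midᶻ refl (Fin.toℕ<n j))
        ... | ofᶻ = contradiction (is-middle eq) (YZ′.¬midᶻ refl (Fin.toℕ<n j))

  module _ {n} (𝓑 : BetweennessStructure n) where

    Hub : Fin n → Set
    Hub p = ∀ {a b c} → Tri 𝓑 a b c → OneOf p a b c

  module _ {n} (𝓑 : BetweennessStructure (suc (suc n))) where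

    hub⇒linear : ∀ {p} → Hub 𝓑 p → NoTri (𝓑 ∖ p)
    hub⇒linear {p} hub t with hub t
    ... | 1st e = Fin.punchInᵢ≢i p _ (sym e)
    ... | 2nd e = Fin.punchInᵢ≢i p _ (sym e)
    ... | 3rd e = Fin.punchInᵢ≢i p _ (sym e)

    linear⇒hub : ∀ {p} → NoTri (𝓑 ∖ p) → Hub 𝓑 p
    linear⇒hub {p} linear {a} {b} {c} t with p Fin.≟ a | p Fin.≟ b | p Fin.≟ c
    ... | yes e | _ | _ = 1st e
    ... | _ | yes e | _ = 2nd e
    ... | _ | _ | yes e = 3rd e
    ... | no p≢a | no p≢b | no p≢c =
      ⊥-elim (linear (subst₃ (sym (Fin.punchIn-punchOut p≢a)) (sym (Fin.punchIn-punchOut p≢b)) (sym (Fin.punchIn-punchOut p≢c)) t))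
      where
      subst₃ : ∀ {a b c a′ b′ c′} → a ≡ a′ → b ≡ b′ → c ≡ c′ → Tri 𝓑 a b c → Tri 𝓑 a′ b′ c′
      subst₃ refl refl refl t = t

    path-of-∖ : ∀ {p m w} → Path (𝓑 ∖ p) m w → Path 𝓑 m (punchIn p ∘ w)
    path-of-∖ {p} P = record
      { distinct = λ i<j j<m → distinct P i<j j<m ∘ Fin.punchIn-injective p _ _
      ; ordered  = ordered P
      }

  module _ {k} (𝓑 : BetweennessStructure (3 + k)) (3≤k : 3 ≤ k) {y z : Fin (3 + k)} (y≢z : y ≢ z)
           (y-hub : Hub 𝓑 y) (z-hub : Hub 𝓑 z) {a b c : Fin (3 + k)} (abc : Tri 𝓑 a b c) where

    two-cuts-class : ∀ {x by bz} → Path 𝓑 (suc k) x → (∀ {j} → j < suc k → y ≢ x j) →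
      (∀ {j} → j < suc k → z ≢ x j) →
                     Cut 𝓑 (suc k) x y by → Cut 𝓑 (suc k) x z bz → Class 𝓑
    two-cuts-class {x} {by} {bz} X y∉ z∉ Cy Cz = by-cuts (ℕ.<-cmp by bz)
      where
      0<k : 0 < k
      0<k = ℕ.≤-trans (s≤s z≤n) 3≤k
      triangle : ∃ λ j → j < suc k × Tri 𝓑 y z (x j)
      triangle = Assemble.triangle-on-yz 𝓑 X y∉ z∉ y≢z y-hub z-hub abc
      triangle′ : ∃ λ j → j < suc k × Tri 𝓑 z y (x j)
      triangle′ = proj₁ triangle , proj₁ (proj₂ triangle) , tri-swap 𝓑 (proj₂ (proj₂ triangle))
      by-cuts : _ → Class 𝓑
      by-cuts (tri< by<bz _ _) = ends-class 𝓑 0<k X Cy Cz y∉ z∉ y≢z triangle by<bz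
      by-cuts (tri> _ _ bz<by) = ends-class 𝓑 0<k X Cz Cy z∉ y∉ (y≢z ∘ sym) triangle′ bz<by
      by-cuts (tri≈ _ e _)     = same-cut-class 𝓑 0<k X (subst (Cut 𝓑 (suc k) x y) e Cy) Cz y∉ z∉ y≢z triangle

    -- Dropping `z` from the path leaves `x` together with the cut of `z`. As every triangle
    -- contains `z`, the point `y` forms none with two points of `x`, and so it has a cut as well.
    path-class : ∀ {w i} → Path 𝓑 (2 + k) w → (∀ {j} → j < 2 + k → y ≢ w j) → i < 2 + k → w i ≡ z → Class 𝓑
    path-class {w} {i} W y∉w i<m refl =
      two-cuts-class X y∉ z∉ (proj₂ (Extension.linear⇒cut 𝓑 X y∉ (s≤s 3≤k) noT)) (proj₂ (remove-path 𝓑 i<m W))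
      where
      x : ℕ → Fin (3 + k)
      x = w ∘ skip i
      X : Path 𝓑 (suc k) x
      X = proj₁ (remove-path 𝓑 i<m W)
      y∉ : ∀ {j} → j < suc k → y ≢ x j
      y∉ j<m = y∉w (skip-bound i j<m)
      z∉ : ∀ {j} → j < suc k → z ≢ x j
      z∉ {j} j<m e = skip≢ i j (path-injective 𝓑 W (skip-bound i j<m) i<m (sym e))
      noT : ∀ {a b} → a < b → b < suc k → ¬ Tri 𝓑 y (x a) (x b)
      noT a<b b<m t with z-hub t
      ... | 1st e = y≢z (sym e)
      ... | 2nd e = z∉ (ℕ.<-trans a<b b<m) e
      ... | 3rd e = z∉ b<m e

    hubs-class : Class 𝓑
    hubs-class = from-path (linear⇒path′ (s≤s (s≤s 3≤k)) (𝓑 ∖ y) (hub⇒linear 𝓑 y-hub))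
      where
      from-path : ∃ (Path (𝓑 ∖ y) (2 + k)) → Class 𝓑
      from-path (w , W) = from-index (path-covers W (punchOut y≢z))
        where
        from-index : (∃ λ i → i < 2 + k × w i ≡ punchOut y≢z) → Class 𝓑
        from-index (i , i<m , e) =
          path-class (path-of-∖ 𝓑 W) (λ _ e → Fin.punchInᵢ≢i y _ (sym e)) i<m (trans (cong (punchIn y) e) (Fin.punchIn-punchOut y≢z))

  countᵇ : Bool → ℕ
  countᵇ true  = 1
  countᵇ false = 0

  count-when : ∀ b {a} → a ≢ missing → count (when b a) ≡ countᵇ b
  count-when false     _  = refl
  count-when true {missing} ne = contradiction refl ne
  count-when true {ofˣ}  _  = refl
  count-when true {ofʸ}  _  = refl
  count-when true {ofᶻ}  _  = refl

  classQ-τ : ∀ {k} {𝓑 : BetweennessStructure (3 + k)} r →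
    Form 𝓑 0 0 (mid₂ zero zero (when r ofˣ) missing) → τ 𝓑 + countᵇ r ≡ suc k
  classQ-τ {𝓑 = 𝓑} r F = trans (cong (τ 𝓑 +_) (sym (trans (ℕ.+-identityʳ _) (count-when r λ ()))))
    (form₂-τ (inj₂ refl) F)

  classR-τ : ∀ {k} {𝓑 : BetweennessStructure (3 + k)} (i : Fin k) l r →
    Form 𝓑 (suc (toℕ i)) (suc (toℕ i)) (mid₂ (inject₁ i) (suc i) (when l ofˣ) (when r ofˣ)) → τ 𝓑 + (countᵇ l + countᵇ r) ≡ suc k
  classR-τ {𝓑 = 𝓑} i l r F = trans (cong (τ 𝓑 +_) (sym (cong₂ _+_ (count-when l λ ()) (count-when r λ ()))))
    (form₂-τ (inj₁ left≢right) F)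
    where
    left≢right : inject₁ i ≢ suc i
    left≢right e = ℕ.1+n≢n (trans (sym (cong toℕ e)) (Fin.toℕ-inject₁ i))

  classS-τ : ∀ {k} {𝓑 : BetweennessStructure (3 + k)} → 0 < k → ∀ l r →
    Form 𝓑 0 (suc k) (mid₂ zero (fromℕ k) (when l ofʸ) (when r ofᶻ)) → τ 𝓑 + (countᵇ l + countᵇ r) ≡ suc k
  classS-τ {suc k} {𝓑} _ l r F = trans (cong (τ 𝓑 +_) (sym (cong₂ _+_ (count-when l λ ()) (count-when r λ ()))))
    (form₂-τ (inj₁ λ ()) F)

  countᵇ₂≤2 : ∀ l r → countᵇ l + countᵇ r ≤ 2
  countᵇ₂≤2 true  true  = ℕ.≤-refl
  countᵇ₂≤2 true  false = s≤s z≤n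
  countᵇ₂≤2 false true  = s≤s z≤n
  countᵇ₂≤2 false false = z≤n

  class-τ : ∀ {k} {𝓑 : BetweennessStructure (3 + k)} → 0 < k → Class 𝓑 → ∃ λ d → d ≤ 2 × τ 𝓑 + d ≡ suc k
  class-τ _   (classQ r F)     =
    _ , countᵇ₂≤2 r false , trans (cong (τ _ +_) (ℕ.+-identityʳ (countᵇ r))) (classQ-τ r F)
  class-τ _   (classR i l r F) = _ , countᵇ₂≤2 l r , classR-τ i l r F
  class-τ 0<k (classS l r F)   = _ , countᵇ₂≤2 l r , classS-τ 0<k l r F

-- Structures with few triangles

module Hubs where

  open Triangles
  open PathStates
  open LinearStructures
  open Forms
  open TwoInsertions
  open TwoHubs
  open import Data.Nat using (_+_; _*_; _≤_; _<_; _≰_)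

  open BetweennessStructure
  open Path

  module _ {A : Set} where

    lookup-injective : ∀ {xs : List A} → Unique xs → ∀ i j → lookup xs i ≡ lookup xs j → i ≡ j
    lookup-injective (_ ∷ _)  zero    zero    _  = refl
    lookup-injective (x∉ ∷ _) zero    (suc j) eq = contradiction eq (All.lookup x∉ (∈-lookup j))
    lookup-injective (x∉ ∷ _) (suc i) zero    eq = contradiction (sym eq) (All.lookup x∉ (∈-lookup i))
    lookup-injective (_ ∷ u)  (suc i) (suc j) eq = cong suc (lookup-injective u i j eq)

  module _ {n} (𝓑 : BetweennessStructure n) where

    Star : Set
    Star = ∃₂ λ y z → y ≢ z × Hub 𝓑 y × Hub 𝓑 z

    Double : Fin n → Set
    Double p = ∃₂ λ e f → e ≢ f × Triangle 𝓑 e × p ∈ˢ e × Triangle 𝓑 f × p ∈ˢ f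

    -- There are `3 τ` incidences of a triangle with a vertex, so two of them share the vertex. They
    -- belong to different triangles, because the three vertices of one triangle are distinct.
    pigeonhole-triangles : n < τ 𝓑 * 3 → ∃ Double
    pigeonhole-triangles n<3τ = found (Fin.pigeonhole n<3τ (uncurry point ∘ remQuot 3))
      where
      tr : ∀ i → Triangle 𝓑 (lookup (triangles 𝓑) i)
      tr i = ∈-triangles⁻ 𝓑 (∈-lookup i)
      point : Fin (τ 𝓑) → Fin 3 → Fin n
      point i j with triangle⇒tri 𝓑 (tr i)
      point i zero             | a , b , c , _ = a
      point i (suc zero)       | a , b , c , _ = b
      point i (suc (suc zero)) | a , b , c , _ = c
      point-∈ : ∀ i j → point i j ∈ˢ lookup (triangles 𝓑) i
      point-∈ i j with triangle⇒tri 𝓑 (tr i)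
      point-∈ i zero             | a , b , c , e , _ = subst (a ∈ˢ_) (sym e) (∈-tset⁺ (1st refl))
      point-∈ i (suc zero)       | a , b , c , e , _ = subst (b ∈ˢ_) (sym e) (∈-tset⁺ (2nd refl))
      point-∈ i (suc (suc zero)) | a , b , c , e , _ = subst (c ∈ˢ_) (sym e) (∈-tset⁺ (3rd refl))
      point-injective : ∀ i j l → point i j ≡ point i l → j ≡ l
      point-injective i j l eq with triangle⇒tri 𝓑 (tr i)
      ... | _ , _ , _ , _ , t with tri-distinct 𝓑 t
      point-injective i zero             zero             eq | _ | _         = refl
      point-injective i zero             (suc zero)       eq | _ | p , _     = contradiction eq p
      point-injective i zero             (suc (suc zero)) eq | _ | _ , p , _ = contradiction eq p
      point-injective i (suc zero)       zero             eq | _ | p , _     = contradiction (sym eq) p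
      point-injective i (suc zero)       (suc zero)       eq | _ | _         = refl
      point-injective i (suc zero)       (suc (suc zero)) eq | _ | _ , _ , p = contradiction eq p
      point-injective i (suc (suc zero)) zero             eq | _ | _ , p , _ = contradiction (sym eq) p
      point-injective i (suc (suc zero)) (suc zero)       eq | _ | _ , _ , p = contradiction (sym eq) p
      point-injective i (suc (suc zero)) (suc (suc zero)) eq | _ | _         = refl
      found : (∃₂ λ i j → i Data.Fin.< j × uncurry point (remQuot 3 i) ≡ uncurry point (remQuot 3 j)) → ∃ Double
      found (i , j , i<j , eq) =
        point i₁ i₂ , _ , _ , (λ e → distinct-triangles (lookup-injective (triangles-unique 𝓑) i₁ j₁ e)) ,
        tr i₁ , point-∈ i₁ i₂ , tr j₁ , subst (_∈ˢ lookup (triangles 𝓑) j₁) (sym eq) (point-∈ j₁ j₂)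
        where
        i₁ = proj₁ (remQuot {τ 𝓑} 3 i)
        i₂ = proj₂ (remQuot {τ 𝓑} 3 i)
        j₁ = proj₁ (remQuot {τ 𝓑} 3 j)
        j₂ = proj₂ (remQuot {τ 𝓑} 3 j)
        distinct-triangles : i₁ ≢ j₁
        distinct-triangles e =
          Fin.<⇒≢ i<j (trans (sym (Fin.combine-remQuot {τ 𝓑} 3 i)) (trans (cong₂ combine e e₂) (Fin.combine-remQuot {τ 𝓑} 3 j)))
          where
          e₂ : i₂ ≡ j₂
          e₂ = point-injective i₁ i₂ j₂ (trans eq (cong (λ i → point i j₂) (sym e)))

    only-triangle : τ 𝓑 ≤ 1 → ∀ {a b c} → Tri 𝓑 a b c → Star
    only-triangle τ≤1 {a} {b} {c} t = a , b , proj₁ (tri-distinct 𝓑 t) , hub (1st refl) , hub (2nd refl)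
      where
      hub : ∀ {p} → OneOf p a b c → Hub 𝓑 p
      hub {p} o {a′} {b′} {c′} t′ with oneOf? p a′ b′ c′
      ... | yes o′ = o′
      ... | no ¬o′ = contradiction (ℕ.≤-trans two τ≤1) λ { (s≤s ()) }
        where
        two : 2 ≤ τ 𝓑
        two = length≤τ 𝓑 {xs = tset a b c ∷ tset a′ b′ c′ ∷ []}
          (((λ e → ¬o′ (∈-tset⁻ (subst (p ∈ˢ_) e (∈-tset⁺ o)))) ∷ []) ∷ [] ∷ [])
          λ { (here refl) → tri⇒triangle 𝓑 t ; (there (here refl)) → tri⇒triangle 𝓑 t′ }

  hubs-bound : ∀ {n} (𝓑 : BetweennessStructure n) → 6 ≤ n → Star 𝓑 → NoTri 𝓑 ⊎ n ≤ τ 𝓑 + 4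
  hubs-bound {suc (suc (suc k))} 𝓑 (s≤s (s≤s (s≤s 3≤k))) (y , z , y≢z , y-hub , z-hub) with τ 𝓑 ℕ.≟ 0
  ... | yes τ≡0 = inj₁ (τ≡0⇒noTri 𝓑 τ≡0)
  ... | no τ≢0 =
    inj₂ (bound (class-τ (ℕ.≤-trans (s≤s z≤n) 3≤k) (hubs-class 𝓑 3≤k y≢z y-hub z-hub (proj₂ (proj₂ (proj₂ (τ≢0⇒tri 𝓑 τ≢0)))))))
    where
    bound : (∃ λ d → d ≤ 2 × τ 𝓑 + d ≡ suc k) → 3 + k ≤ τ 𝓑 + 4
    bound (d , d≤2 , e) = subst₂ _≤_ (cong (2 +_) e) (ℕ.+-comm 4 (τ 𝓑))
      (s≤s (s≤s (subst (τ 𝓑 + d ≤_) (ℕ.+-comm (τ 𝓑) 2) (ℕ.+-monoʳ-≤ (τ 𝓑) d≤2))))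

  module _ {n} (𝓑 : BetweennessStructure (suc (suc n))) where

    -- If the triangles through the hub p had no common point but p, the path of the
    -- other points would extend through p.
    hub⇒double : 5 ≤ suc n → ∀ {p} → Hub 𝓑 p → NoTri 𝓑 ⊎ ∃ λ v → v ≢ p × Double 𝓑 v
    hub⇒double 5≤m {p} hub =
      decide (Fin.any? λ v → Fin.any? λ a → Fin.any? λ b → ¬? (a Fin.≟ b) ×-dec tri? 𝓑 p v a ×-dec tri? 𝓑 p v b)
      where
      Shared : Set
      Shared = ∃ λ v → ∃ λ a → ∃ λ b → a ≢ b × Tri 𝓑 p v a × Tri 𝓑 p v b
      decide : Dec Shared → NoTri 𝓑 ⊎ ∃ λ v → v ≢ p × Double 𝓑 v
      decide (yes (v , a , b , a≢b , t , t′)) =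
        inj₂ (v , proj₁ (tri-distinct 𝓑 t) ∘ sym , tset p v a , tset p v b , differ ,
        tri⇒triangle 𝓑 t , ∈-tset⁺ (2nd refl) , tri⇒triangle 𝓑 t′ , ∈-tset⁺ (2nd refl))
        where
        differ : tset p v a ≢ tset p v b
        differ e with ∈-tset⁻ (subst (a ∈ˢ_) e (∈-tset⁺ (3rd refl)))
        ... | 1st q = proj₁ (proj₂ (tri-distinct 𝓑 t)) (sym q)
        ... | 2nd q = proj₂ (proj₂ (tri-distinct 𝓑 t)) (sym q)
        ... | 3rd q = a≢b q
      decide (no none) = inj₁ (from-path (linear⇒path′ 5≤m (𝓑 ∖ p) (hub⇒linear 𝓑 hub)))
        where
        from-path : ∃ (Path (𝓑 ∖ p) (suc n)) → NoTri 𝓑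
        from-path (w′ , W′) = noTri
          where
          w : ℕ → Fin (suc (suc n))
          w = punchIn p ∘ w′
          W : Path 𝓑 (suc n) w
          W = path-of-∖ 𝓑 W′
          open Extension 𝓑 W {p} (λ _ e → Fin.punchInᵢ≢i p _ (sym e))
          matching : Matching
          matching {i} {j} {k} i<j j<k k<m =
              (λ (s , t) → none (w j , w i , w k , distinct W (ℕ.<-trans i<j j<k) k<m , tri-perm 𝓑 s (1st refl) (3rd refl) (2nd refl) , t))
            , (λ (s , t) → none (w i , w j , w k , distinct W j<k k<m , s , t))
            , (λ (s , t) → none (w k , w j , w i , distinct W i<j (ℕ.<-trans j<k k<m) ∘ sym ,
                                 tri-perm 𝓑 s (1st refl) (3rd refl) (2nd refl) , tri-perm 𝓑 t (1st refl) (3rd refl) (2nd refl)))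
          cut : ∃ (Cut 𝓑 (suc n) w p)
          cut = matching⇒cut 5≤m matching
          index : ∀ {v} → p ≢ v → ∃ λ j → j < suc n × w j ≡ v
          index p≢v with path-covers W′ (punchOut p≢v)
          ... | j , j<m , e = j , j<m , trans (cong (punchIn p) e) (Fin.punchIn-punchOut p≢v)
          noTri-p : ∀ {a b} → ¬ Tri 𝓑 p a b
          noTri-p {a} {b} t with tri-distinct 𝓑 t
          ... | p≢a , p≢b , a≢b with index p≢a | index p≢b
          ...   | i , i<m , refl | j , j<m , refl with ℕ.<-cmp i j
          ...     | tri< i<j _ _ = cut⇒¬tri 𝓑 (proj₂ cut) i<j j<m t
          ...     | tri≈ _ refl _ = a≢b refl
          ...     | tri> _ _ j<i = cut⇒¬tri 𝓑 (proj₂ cut) j<i i<m (tri-perm 𝓑 t (1st refl) (3rd refl) (2nd refl))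
          noTri : NoTri 𝓑
          noTri {a} {b} {c} t with hub t
          ... | 1st refl = noTri-p t
          ... | 2nd refl = noTri-p (tri-swap 𝓑 t)
          ... | 3rd refl = noTri-p (tri-rot 𝓑 (tri-rot 𝓑 t))

  private
    -- The bookkeeping of a deletion: `c` triangles before, at most `a` of the bound's allowance
    -- after, and `b` the number of triangles known to be lost.
    +11 : ∀ {a b c d} → a + b ≤ c → c + 11 ≤ b + d → a + 11 ≤ d
    +11 {a} {b} {c} {d} p q =
      ℕ.+-cancelˡ-≤ b (a + 11) d (ℕ.≤-trans (ℕ.≤-reflexive eq) (ℕ.≤-trans (ℕ.+-monoˡ-≤ 11 p) q))
      where
      eq : b + (a + 11) ≡ a + b + 11
      eq = trans (sym (ℕ.+-assoc b a 11)) (cong (_+ 11) (ℕ.+-comm b a))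

  FewTriangles : ∀ {n} → BetweennessStructure n → Set
  FewTriangles {n} 𝓑 = τ 𝓑 + 11 ≤ n + n

  few-triangles : ∀ m → 4 ≤ m → (𝓑 : BetweennessStructure (2 + m)) → FewTriangles 𝓑 → NoTri 𝓑 ⊎ Star 𝓑

  module Step (m : ℕ) (4≤m : 4 ≤ m) (𝓑 : BetweennessStructure (3 + m)) (few : FewTriangles 𝓑)
    (IH : (𝓒 : BetweennessStructure (2 + m)) → FewTriangles 𝓒 → NoTri 𝓒 ⊎ Star 𝓒) where

    few′ : τ 𝓑 + 11 ≤ 2 + ((2 + m) + (2 + m))
    few′ =
      subst (τ 𝓑 + 11 ≤_) (solve 1 (λ m → (con 3 :+ m) :+ (con 3 :+ m) := con 2 :+ ((con 2 :+ m) :+ (con 2 :+ m))) refl m) few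
      where open +-*-Solver

    IH′ : (𝓒 : BetweennessStructure (2 + m)) → FewTriangles 𝓒 → NoTri 𝓒 ⊎ (Star 𝓒 × 2 + m ≤ τ 𝓒 + 4)
    IH′ 𝓒 few𝓒 with IH 𝓒 few𝓒
    ... | inj₁ none = inj₁ none
    ... | inj₂ star = Sum.map₂ (star ,_) (hubs-bound 𝓒 (s≤s (s≤s 4≤m)) star)

    hub-∖ : ∀ p {z} → Hub (𝓑 ∖ p) z → 2 + m ≤ τ (𝓑 ∖ p) + 4 → Hub 𝓑 (punchIn p z)
    hub-∖ p {z} z-hub bound = linear⇒hub 𝓑 linear
      where
      z′ : Fin (3 + m)
      z′ = punchIn p z
      disjoint : τ (𝓑 ∖ z′) + τ (𝓑 ∖ p) ≤ τ 𝓑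
      disjoint = τ-∖-∖ 𝓑 p z′ λ {e} tr → through (triangle⇒tri (𝓑 ∖ p) tr)
        where
        through : ∀ {e} → (∃ λ a → ∃ λ b → ∃ λ c → e ≡ tset a b c × Tri (𝓑 ∖ p) a b c) → z′ ∈ˢ embed 𝓑 p e
        through (a , b , c , refl , t) = ∈-embed⁺ 𝓑 p {tset a b c} (∈-tset⁺ (z-hub t))
      small : τ (𝓑 ∖ z′) + 5 ≤ 2 + m
      small = ℕ.+-cancelʳ-≤ (τ (𝓑 ∖ p) + 6) _ _ (begin
        τ (𝓑 ∖ z′) + 5 + (τ (𝓑 ∖ p) + 6)  ≡⟨ solve 2 (λ a b → a :+ con 5 :+ (b :+ con 6) := a :+ b :+ con 11) refl (τ (𝓑 ∖ z′)) (τ (𝓑 ∖ p)) ⟩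
        τ (𝓑 ∖ z′) + τ (𝓑 ∖ p) + 11       ≤⟨ ℕ.+-monoˡ-≤ 11 disjoint ⟩
        τ 𝓑 + 11                          ≤⟨ few′ ⟩
        2 + ((2 + m) + (2 + m))           ≡⟨ solve 1 (λ m → con 2 :+ (m :+ m) := m :+ (m :+ con 2)) refl (2 + m) ⟩
        (2 + m) + ((2 + m) + 2)           ≤⟨ ℕ.+-monoʳ-≤ (2 + m) (ℕ.+-monoˡ-≤ 2 bound) ⟩
        (2 + m) + (τ (𝓑 ∖ p) + 4 + 2)     ≡⟨ cong ((2 + m) +_) (ℕ.+-assoc (τ (𝓑 ∖ p)) 4 2) ⟩
        (2 + m) + (τ (𝓑 ∖ p) + 6)         ∎)
        where
        open ℕ.≤-Reasoning
        open +-*-Solver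
      -- The 11 is split as `5 + 6`: `small` supplies the 5, and the 6 is at most the order `2 + m`.
      few-z : FewTriangles (𝓑 ∖ z′)
      few-z = begin
        τ (𝓑 ∖ z′) + 11       ≡⟨ sym (ℕ.+-assoc (τ (𝓑 ∖ z′)) 5 6) ⟩
        τ (𝓑 ∖ z′) + 5 + 6    ≤⟨ ℕ.+-mono-≤ small (s≤s (s≤s 4≤m)) ⟩
        (2 + m) + (2 + m)     ∎
        where open ℕ.≤-Reasoning
      linear : NoTri (𝓑 ∖ z′)
      linear with IH′ (𝓑 ∖ z′) few-z
      ... | inj₁ none    = none
      ... | inj₂ (_ , b) =
        contradiction (ℕ.≤-trans small b) λ q → contradiction (ℕ.+-cancelˡ-≤ (τ (𝓑 ∖ z′)) 5 4 q) λ { (s≤s (s≤s (s≤s (s≤s ())))) }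

    reduce : ∀ p → FewTriangles (𝓑 ∖ p) → Hub 𝓑 p ⊎ Star 𝓑
    reduce p few-p with IH′ (𝓑 ∖ p) few-p
    ... | inj₁ none = inj₁ (linear⇒hub 𝓑 none)
    ... | inj₂ ((y , z , y≢z , y-hub , z-hub) , b) =
      inj₂ (punchIn p y , punchIn p z , y≢z ∘ Fin.punchIn-injective p y z ,
                                                           hub-∖ p y-hub b , hub-∖ p z-hub b)

    double⇒few : ∀ {p} → Double 𝓑 p → FewTriangles (𝓑 ∖ p)
    double⇒few {p} (_ , _ , e≢f , tr , p∈ , tr′ , p∈′) =
      +11 {τ (𝓑 ∖ p)} {2} {τ 𝓑} (τ-∖₂ 𝓑 p e≢f tr p∈ tr′ p∈′) few′

    -- The hypothesis means `2 n ≤ τ + 11` for `n = 3 + m`. Since `n ≥ 7`, it follows that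
    -- `n + 33 < 6 n ≤ 3 τ + 33`.
    many-triangles : τ 𝓑 + 12 ≰ (3 + m) + (3 + m) → 3 + m < τ 𝓑 * 3
    many-triangles ¬fewer = ℕ.+-cancelʳ-≤ 33 _ _ (begin
      suc (3 + m) + 33            ≡⟨ solve 1 (λ m → con 1 :+ (con 3 :+ m) :+ con 33 := m :+ con 37) refl m ⟩
      m + 37                      ≤⟨ ℕ.+-monoʳ-≤ m (ℕ.m≤n+m 37 1) ⟩
      m + 38                      ≤⟨ ℕ.+-monoʳ-≤ m (ℕ.+-monoˡ-≤ 18 (ℕ.*-monoʳ-≤ 5 4≤m)) ⟩
      m + (5 * m + 18)            ≡⟨ solve 1 (λ m → m :+ (con 5 :* m :+ con 18) := ((con 3 :+ m) :+ (con 3 :+ m)) :* con 3) refl m ⟩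
      ((3 + m) + (3 + m)) * 3     ≤⟨ ℕ.*-monoˡ-≤ 3 (ℕ.≤-pred (ℕ.≤-trans (ℕ.≰⇒> ¬fewer) (ℕ.≤-reflexive (ℕ.+-suc (τ 𝓑) 11)))) ⟩
      (τ 𝓑 + 11) * 3              ≡⟨ solve 1 (λ t → (t :+ con 11) :* con 3 := t :* con 3 :+ con 33) refl (τ 𝓑) ⟩
      τ 𝓑 * 3 + 33                ∎)
      where
      open ℕ.≤-Reasoning
      open +-*-Solver

    -- One point less lowers the allowance `2 n - 11` by 2. If `τ` is below the allowance, losing
    -- one triangle is enough, so any vertex of a triangle will do; otherwise a point in two
    -- triangles is required.
    first : NoTri 𝓑 ⊎ ∃ λ p → FewTriangles (𝓑 ∖ p)
    first with τ 𝓑 ℕ.≟ 0 | τ 𝓑 + 12 ℕ.≤? (3 + m) + (3 + m)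
    ... | yes τ≡0 | _ = inj₁ (τ≡0⇒noTri 𝓑 τ≡0)
    ... | no τ≢0 | no ¬fewer = inj₂ (Data.Product.map₂ double⇒few (pigeonhole-triangles 𝓑 (many-triangles ¬fewer)))
    ... | no τ≢0 | yes fewer = inj₂ (on-triangle (τ≢0⇒tri 𝓑 τ≢0))
      where
      on-triangle : (∃ λ a → ∃ λ b → ∃ λ c → Tri 𝓑 a b c) → ∃ λ p → FewTriangles (𝓑 ∖ p)
      on-triangle (a , _ , _ , t) =
        a , +11 {τ (𝓑 ∖ a)} {1} {τ 𝓑} (τ-∖₁ 𝓑 a (tri⇒triangle 𝓑 t) (∈-tset⁺ (1st refl)))
        (ℕ.≤-pred (ℕ.≤-trans (ℕ.≤-reflexive (sym (ℕ.+-suc (τ 𝓑) 11))) (ℕ.≤-trans fewer (ℕ.≤-reflexive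
          (solve 1 (λ m → (con 3 :+ m) :+ (con 3 :+ m) := con 1 :+ (con 1 :+ ((con 2 :+ m) :+ (con 2 :+ m)))) refl m)))))
        where open +-*-Solver

    result : NoTri 𝓑 ⊎ Star 𝓑
    result with first
    ... | inj₁ none = inj₁ none
    ... | inj₂ (p , few-p) with reduce p few-p
    ...   | inj₂ star = inj₂ star
    ...   | inj₁ p-hub with hub⇒double 𝓑 (s≤s (ℕ.≤-trans 4≤m (ℕ.n≤1+n m))) p-hub
    ...     | inj₁ none = inj₁ none
    ...     | inj₂ (v , v≢p , double) with reduce v (double⇒few double)
    ...       | inj₁ v-hub = inj₂ (v , p , v≢p , v-hub , p-hub)
    ...       | inj₂ star  = inj₂ star

  few-triangles (suc m) 4≤1+m 𝓑 few with ℕ.m≤n⇒m<n∨m≡n 4≤1+m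
  ... | inj₁ (s≤s 4≤m) = Step.result m 4≤m 𝓑 few (few-triangles m 4≤m)
  -- At order 6 the bound reads `τ + 11 ≤ 12`, so there is at most one triangle.
  ... | inj₂ refl with τ 𝓑 ℕ.≟ 0
  ...   | yes τ≡0 = inj₁ (τ≡0⇒noTri 𝓑 τ≡0)
  ...   | no τ≢0 = inj₂ (only-triangle 𝓑 (ℕ.+-cancelʳ-≤ 11 (τ 𝓑) 1 few) (proj₂ (proj₂ (proj₂ (τ≢0⇒tri 𝓑 τ≢0)))))

-- Shortest-path distances from a metric on a line

module ShortestPaths where

  open Triangles
  open Forms
  open TwoHubs
  open import Data.Nat using (_+_; _∸_; _≤_; _<_; ∣_-_∣)

  open BetweennessStructure
  open WeightedGraph

  -- A record instead of the bare equation, so that the graph and the ends of the edge can be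
  -- inferred even where `weight G` unfolds.
  record HasEdge {n} (G : WeightedGraph n) (u v : Fin n) (w : ℕ) : Set where
    constructor hasEdge
    field
      weight≡ : weight G u v ≡ just w

  -- The dual certificate of a shortest path: if `D` also satisfies the triangle inequality, no walk
  -- is shorter than `D`, which is `D≤walk`.
  record Dominates {n} (G : WeightedGraph n) (D : Fin n → Fin n → ℕ) : Set where
    constructor dominates
    field
      D≤weight : ∀ {u v w} → weight G u v ≡ just w → D u v ≤ w

  open Dominates

  hasEdge-sym : ∀ {n} {G : WeightedGraph n} {u v w} → HasEdge G u v w → HasEdge G v u w
  hasEdge-sym {G = G} {u} {v} (hasEdge e) = hasEdge (trans (symmetric G v u) e)

  edge-walk : ∀ {n} {G : WeightedGraph n} {u v w} → HasEdge G u v w → Walk G u v w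
  edge-walk {G = G} (hasEdge e) = edge G e

  module _ {n : ℕ} (a b : Fin n) {a≢b : False (a Fin.≟ b)} (w : ℕ) .{{_ : NonZero w}} (G : WeightedGraph n) where

    edge-added : HasEdge (add a b {a≢b} w G) a b w
    edge-added = hasEdge (if-yes (samePair? a b a b) (inj₁ (refl , refl)))

    edge-kept : ∀ {u v w′} → ¬ SamePair a b u v → HasEdge G u v w′ → HasEdge (add a b {a≢b} w G) u v w′
    edge-kept {u} {v} ne (hasEdge e) = hasEdge (trans (if-no (samePair? a b u v) ne) e)

    module _ {D : Fin n → Fin n → ℕ} (D-sym : ∀ u v → D u v ≡ D v u) where

      dominates-add : D a b ≤ w → Dominates G D → Dominates (add a b {a≢b} w G) D
      dominates-add Dab≤w dom = dominates λ {u} {v} {w′} →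
        if-ind (λ m → m ≡ just w′ → D u v ≤ w′) (samePair? a b u v) same (λ _ → D≤weight dom)
        where
        same : ∀ {u v w′} → SamePair a b u v → just w ≡ just w′ → D u v ≤ w′
        same (inj₁ (refl , refl)) refl = Dab≤w
        same (inj₂ (refl , refl)) refl = subst (_≤ w) (D-sym a b) Dab≤w

  module _ {n : ℕ} (a b : Fin n) (G : WeightedGraph n) where

    edge-undeleted : ∀ {u v w} → ¬ SamePair a b u v → HasEdge G u v w → HasEdge (delete a b G) u v w
    edge-undeleted {u} {v} ne (hasEdge e) = hasEdge (trans (if-no (samePair? a b u v) ne) e)

    dominates-delete : ∀ {D} → (∀ {u v w} → ¬ SamePair a b u v → weight G u v ≡ just w → D u v ≤ w) →
                       Dominates (delete a b G) D
    dominates-delete {D} dom = dominates λ {u} {v} {w} →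
      if-ind (λ m → m ≡ just w → D u v ≤ w) (samePair? a b u v) (λ _ ()) dom

  -- The vertices lie at the given positions on a line and have the distances of this
  -- line, except that y and z have distance f.
  module LineMetric {k : ℕ} (pos : V {k} → ℕ) (f : ℕ) where

    D : V {k} → V {k} → ℕ
    D yᵛ zᵛ = f
    D zᵛ yᵛ = f
    D u  v  = ∣ pos u - pos v ∣

    D-sym : ∀ u v → D u v ≡ D v u
    D-sym yᵛ     yᵛ     = refl
    D-sym yᵛ     zᵛ     = refl
    D-sym zᵛ     yᵛ     = refl
    D-sym zᵛ     zᵛ     = refl
    D-sym yᵛ     (xᵛ j) = ℕ.∣-∣-comm (pos yᵛ) (pos (xᵛ j))
    D-sym zᵛ     (xᵛ j) = ℕ.∣-∣-comm (pos zᵛ) (pos (xᵛ j))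
    D-sym (xᵛ i) yᵛ     = ℕ.∣-∣-comm (pos (xᵛ i)) (pos yᵛ)
    D-sym (xᵛ i) zᵛ     = ℕ.∣-∣-comm (pos (xᵛ i)) (pos zᵛ)
    D-sym (xᵛ i) (xᵛ j) = ℕ.∣-∣-comm (pos (xᵛ i)) (pos (xᵛ j))

    D-refl : ∀ u → D u u ≡ 0
    D-refl yᵛ     = ℕ.∣n-n∣≡0 (pos yᵛ)
    D-refl zᵛ     = ℕ.∣n-n∣≡0 (pos zᵛ)
    D-refl (xᵛ j) = ℕ.∣n-n∣≡0 (pos (xᵛ j))

    DMid : Fin (suc k) → Middle → Set
    DMid j ofˣ     = f ≡ D yᵛ (xᵛ j) + D zᵛ (xᵛ j)
    DMid j ofʸ     = D zᵛ (xᵛ j) ≡ f + D yᵛ (xᵛ j)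
    DMid j ofᶻ     = D yᵛ (xᵛ j) ≡ f + D zᵛ (xᵛ j)
    DMid j missing = f ≢ D yᵛ (xᵛ j) + D zᵛ (xᵛ j) × D zᵛ (xᵛ j) ≢ f + D yᵛ (xᵛ j) × D yᵛ (xᵛ j) ≢ f + D zᵛ (xᵛ j)

    module _ (f≤ : ∀ j → f ≤ D yᵛ (xᵛ j) + D zᵛ (xᵛ j)) (y≤ : ∀ j → D yᵛ (xᵛ j) ≤ f + D zᵛ (xᵛ j))
             (z≤ : ∀ j → D zᵛ (xᵛ j) ≤ f + D yᵛ (xᵛ j)) where

      private
        line : ∀ u t v → ∣ pos u - pos v ∣ ≤ ∣ pos u - pos t ∣ + ∣ pos t - pos v ∣
        line u t v = ℕ.∣-∣-triangle (pos u) (pos t) (pos v)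

      -- Triples without `yᵛ` or without `zᵛ` inherit the inequality from the line. The triples
      -- `yᵛ`, `zᵛ`, `xᵛ j` are covered by the three assumptions.
      D-triangle : ∀ u t v → D u v ≤ D u t + D t v
      D-triangle yᵛ     yᵛ     v      = subst (λ d → D yᵛ v ≤ d + D yᵛ v) (sym (D-refl yᵛ)) ℕ.≤-refl
      D-triangle zᵛ     zᵛ     v      = subst (λ d → D zᵛ v ≤ d + D zᵛ v) (sym (D-refl zᵛ)) ℕ.≤-refl
      D-triangle yᵛ     zᵛ     yᵛ     = ℕ.≤-trans (ℕ.≤-reflexive (D-refl yᵛ)) z≤n
      D-triangle yᵛ     zᵛ     zᵛ     = ℕ.m≤m+n f _
      D-triangle yᵛ     zᵛ     (xᵛ j) = y≤ j
      D-triangle zᵛ     yᵛ     yᵛ     = ℕ.m≤m+n f _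
      D-triangle zᵛ     yᵛ     zᵛ     = ℕ.≤-trans (ℕ.≤-reflexive (D-refl zᵛ)) z≤n
      D-triangle zᵛ     yᵛ     (xᵛ j) = z≤ j
      D-triangle yᵛ     (xᵛ i) yᵛ     = ℕ.≤-trans (ℕ.≤-reflexive (D-refl yᵛ)) z≤n
      D-triangle yᵛ     (xᵛ i) zᵛ     = subst (λ d → f ≤ D yᵛ (xᵛ i) + d) (D-sym zᵛ (xᵛ i)) (f≤ i)
      D-triangle yᵛ     (xᵛ i) (xᵛ j) = line yᵛ (xᵛ i) (xᵛ j)
      D-triangle zᵛ     (xᵛ i) yᵛ     =
        subst (f ≤_) (trans (ℕ.+-comm (D yᵛ (xᵛ i)) _) (cong (D zᵛ (xᵛ i) +_) (D-sym yᵛ (xᵛ i)))) (f≤ i)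
      D-triangle zᵛ     (xᵛ i) zᵛ     = ℕ.≤-trans (ℕ.≤-reflexive (D-refl zᵛ)) z≤n
      D-triangle zᵛ     (xᵛ i) (xᵛ j) = line zᵛ (xᵛ i) (xᵛ j)
      D-triangle (xᵛ i) yᵛ     yᵛ     = line (xᵛ i) yᵛ yᵛ
      D-triangle (xᵛ i) yᵛ     zᵛ     =
        subst₂ _≤_ (D-sym zᵛ (xᵛ i)) (trans (ℕ.+-comm f _) (cong (_+ f) (D-sym yᵛ (xᵛ i)))) (z≤ i)
      D-triangle (xᵛ i) yᵛ     (xᵛ j) = line (xᵛ i) yᵛ (xᵛ j)
      D-triangle (xᵛ i) zᵛ     yᵛ     =
        subst₂ _≤_ (D-sym yᵛ (xᵛ i)) (trans (ℕ.+-comm f _) (cong (_+ f) (D-sym zᵛ (xᵛ i)))) (y≤ i)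
      D-triangle (xᵛ i) zᵛ     zᵛ     = line (xᵛ i) zᵛ zᵛ
      D-triangle (xᵛ i) zᵛ     (xᵛ j) = line (xᵛ i) zᵛ (xᵛ j)
      D-triangle (xᵛ i) (xᵛ l) yᵛ     = line (xᵛ i) (xᵛ l) yᵛ
      D-triangle (xᵛ i) (xᵛ l) zᵛ     = line (xᵛ i) (xᵛ l) zᵛ
      D-triangle (xᵛ i) (xᵛ l) (xᵛ j) = line (xᵛ i) (xᵛ l) (xᵛ j)

      module _ {G : WeightedGraph (3 + k)} (dom : Dominates G D) where

        D≤walk : ∀ {u v ℓ} → Walk G u v ℓ → D u v ≤ ℓ
        D≤walk {u} []                          = ℕ.≤-reflexive (D-refl u)
        D≤walk {u} {v} (_∷_ {t = t} e p) = ℕ.≤-trans (D-triangle u t v) (ℕ.+-mono-≤ (D≤weight dom e) (D≤walk p))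

  mid₂-elim : ∀ {m} (P : Fin m → Middle → Set) {p q a b} → P p a → (q ≢ p → P q b) →
              (∀ j → j ≢ p → j ≢ q → P j missing) → ∀ j → P j (mid₂ p q a b j)
  mid₂-elim P {p} {q} Pp Pq P′ j with j Fin.≟ p | j Fin.≟ q
  ... | yes refl | _        = Pp
  ... | no j≢p   | yes refl = Pq j≢p
  ... | no j≢p   | no j≢q   = P′ j j≢p j≢q

  -- d is the shortest-path distance of G.
  module InducedForm {k : ℕ} (G : WeightedGraph (3 + k)) (𝓖 : BetweennessStructure (3 + k)) (d : V {k} → V {k} → ℕ)
    (β⁺ : ∀ {u v w} → d u w ≡ d u v + d v w → β 𝓖 u v w) (β⁻ : ∀ {u v w} → β 𝓖 u v w → d u w ≡ d u v + d v w)
    (d-walk : ∀ u v → Walk G u v (d u v)) (d-least : ∀ {u v ℓ} → Walk G u v ℓ → d u v ≤ ℓ)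
    (pos : V {k} → ℕ) (f : ℕ) (by bz : ℕ) where

    open LineMetric pos f

    d-refl : ∀ u → d u u ≡ 0
    d-refl u = ℕ.n≤0⇒n≡0 (d-least [])

    d-sym : ∀ u v → d u v ≡ d v u
    d-sym u v = ℕ.≤-antisym (d-least (reverse G (d-walk v u))) (d-least (reverse G (d-walk u v)))

    d-triangle : ∀ u v t → d u t ≤ d u v + d v t
    d-triangle u v t = d-least (_⊕_ G (d-walk u v) (d-walk v t))

    -- The upper half of the distance computation, in a form that composes along the path. Against
    -- the lower bound `D≤d` it becomes the equality `≺⇒d`.
    _⇝_ : V → V → Set
    u ⇝ v = pos u + d u v ≤ pos v

    ⇝-refl : ∀ {u} → u ⇝ u
    ⇝-refl {u} = ℕ.≤-reflexive (trans (cong (pos u +_) (d-refl u)) (ℕ.+-identityʳ _))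

    ⇝-trans : ∀ {u v w} → u ⇝ v → v ⇝ w → u ⇝ w
    ⇝-trans {u} {v} {w} p q = begin
      pos u + d u w              ≤⟨ ℕ.+-monoʳ-≤ (pos u) (d-triangle u v w) ⟩
      pos u + (d u v + d v w)    ≡⟨ sym (ℕ.+-assoc (pos u) _ _) ⟩
      pos u + d u v + d v w      ≤⟨ ℕ.+-monoˡ-≤ (d v w) p ⟩
      pos v + d v w              ≤⟨ q ⟩
      pos w                      ∎
      where open ℕ.≤-Reasoning

    ⇝-edge : ∀ {u v w} → HasEdge G u v w → pos u + w ≤ pos v → u ⇝ v
    ⇝-edge {u} e p = ℕ.≤-trans (ℕ.+-monoʳ-≤ (pos u) (d-least (edge-walk e))) p

    module _ (f≤ : ∀ j → f ≤ D yᵛ (xᵛ j) + D zᵛ (xᵛ j)) (y≤ : ∀ j → D yᵛ (xᵛ j) ≤ f + D zᵛ (xᵛ j))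
             (z≤ : ∀ j → D zᵛ (xᵛ j) ≤ f + D yᵛ (xᵛ j)) (dom : Dominates G D)
             (x⇝x : ∀ j → xᵛ (inject₁ j) ⇝ xᵛ (suc j))
             (x⇝y : ∀ j → suc (toℕ j) ≡ by → xᵛ j ⇝ yᵛ) (y⇝x : ∀ j → toℕ j ≡ by → yᵛ ⇝ xᵛ j)
             (x⇝z : ∀ j → suc (toℕ j) ≡ bz → xᵛ j ⇝ zᵛ) (z⇝x : ∀ j → toℕ j ≡ bz → zᵛ ⇝ xᵛ j)
             (by≤ : by ≤ suc k) (bz≤ : bz ≤ suc k) (y-z : Walk G yᵛ zᵛ f) where

      D≤d : ∀ u v → D u v ≤ d u v
      D≤d u v = D≤walk f≤ y≤ z≤ dom (d-walk u v)

      dyz : d yᵛ zᵛ ≡ f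
      dyz = ℕ.≤-antisym (d-least y-z) (D≤d yᵛ zᵛ)

      along : ∀ i j → toℕ i ≤ toℕ j → xᵛ i ⇝ xᵛ j
      along i = <-weakInduction (λ j → toℕ i ≤ toℕ j → xᵛ i ⇝ xᵛ j) base step
        where
        base : toℕ i ≤ 0 → xᵛ i ⇝ xᵛ zero
        base i≤0 = subst (λ l → xᵛ i ⇝ xᵛ l) (Fin.toℕ-injective (ℕ.n≤0⇒n≡0 i≤0)) (⇝-refl {xᵛ i})
        step : ∀ j → (toℕ i ≤ toℕ (inject₁ j) → xᵛ i ⇝ xᵛ (inject₁ j)) → toℕ i ≤ suc (toℕ j) → xᵛ i ⇝ xᵛ (suc j)
        step j ih i≤j with ℕ.m≤n⇒m<n∨m≡n i≤j
        ... | inj₁ i<j = ⇝-trans (ih (subst (toℕ i ≤_) (sym (Fin.toℕ-inject₁ j)) (ℕ.≤-pred i<j))) (x⇝x j)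
        ... | inj₂ e   = subst (λ l → xᵛ i ⇝ xᵛ l) (Fin.toℕ-injective e) (⇝-refl {xᵛ i})

      into : ∀ {v c} → c ≤ suc k → (∀ j → suc (toℕ j) ≡ c → xᵛ j ⇝ v) → ∀ {i} → toℕ i < c → xᵛ i ⇝ v
      into {c = suc c} c≤k x⇝v {i} i<c =
        ⇝-trans (along i l (subst (toℕ i ≤_) (sym l≡c) (ℕ.≤-pred i<c))) (x⇝v l (cong suc l≡c))
        where
        l : Fin (suc k)
        l = fromℕ< c≤k
        l≡c : toℕ l ≡ c
        l≡c = Fin.toℕ-fromℕ< c≤k

      outof : ∀ {v c} → (∀ j → toℕ j ≡ c → v ⇝ xᵛ j) → ∀ {i} → c ≤ toℕ i → v ⇝ xᵛ i
      outof {c = c} v⇝x {i} c≤i = ⇝-trans (v⇝x l l≡c) (along l i (subst (_≤ toℕ i) (sym l≡c) c≤i))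
        where
        l : Fin (suc k)
        l = fromℕ< (ℕ.≤-<-trans c≤i (Fin.toℕ<n i))
        l≡c : toℕ l ≡ c
        l≡c = Fin.toℕ-fromℕ< (ℕ.≤-<-trans c≤i (Fin.toℕ<n i))

      ≺⇒⇝ : ∀ {u v} → _≺_ by bz u v → u ⇝ v
      ≺⇒⇝ (x≺x {i} {j} p) = along i j (ℕ.<⇒≤ p)
      ≺⇒⇝ (x≺y p)         = into by≤ x⇝y p
      ≺⇒⇝ (y≺x p)         = outof y⇝x p
      ≺⇒⇝ (x≺z p)         = into bz≤ x⇝z p
      ≺⇒⇝ (z≺x p)         = outof z⇝x p

      ≺⇒D≡ : ∀ {u v} → _≺_ by bz u v → D u v ≡ ∣ pos u - pos v ∣
      ≺⇒D≡ (x≺x _) = refl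
      ≺⇒D≡ (x≺y _) = refl
      ≺⇒D≡ (y≺x _) = refl
      ≺⇒D≡ (x≺z _) = refl
      ≺⇒D≡ (z≺x _) = refl

      ≺⇒d : ∀ {u v} → _≺_ by bz u v → pos u + d u v ≡ pos v
      ≺⇒d {u} {v} p = ℕ.≤-antisym (≺⇒⇝ p) (ℕ.≤-trans (ℕ.m≤n+∣n-m∣ (pos v) (pos u))
        (ℕ.+-monoʳ-≤ (pos u) (subst (_≤ d u v) (≺⇒D≡ p) (D≤d u v))))

      ≺⇒d≡D : ∀ {u v} → _≺_ by bz u v → d u v ≡ D u v
      ≺⇒d≡D {u} {v} p = trans (sym (ℕ.m+n∸m≡n (pos u) (d u v))) (trans (cong (_∸ pos u) (≺⇒d p))
        (sym (trans (≺⇒D≡ p) (ℕ.m≤n⇒∣m-n∣≡n∸m (ℕ.≤-trans (ℕ.m≤m+n (pos u) (d u v)) (≺⇒⇝ p))))))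

      dyx : ∀ j → d yᵛ (xᵛ j) ≡ D yᵛ (xᵛ j)
      dyx j with ℕ.≤-<-connex by (toℕ j)
      ... | inj₁ b≤j = ≺⇒d≡D (y≺x b≤j)
      ... | inj₂ j<b = trans (d-sym yᵛ (xᵛ j)) (trans (≺⇒d≡D (x≺y j<b)) (D-sym (xᵛ j) yᵛ))

      dzx : ∀ j → d zᵛ (xᵛ j) ≡ D zᵛ (xᵛ j)
      dzx j with ℕ.≤-<-connex bz (toℕ j)
      ... | inj₁ b≤j = ≺⇒d≡D (z≺x b≤j)
      ... | inj₂ j<b = trans (d-sym zᵛ (xᵛ j)) (trans (≺⇒d≡D (x≺z j<b)) (D-sym (xᵛ j) zᵛ))

      -- Along a chain the differences of positions add up. For `yᵛ`, `zᵛ`, `xᵛ j` all three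
      -- distances agree with `D`, so the condition `DMid` carries over.
      induced-form : ∀ {mid} → (∀ j → DMid j (mid j)) → Form 𝓖 by bz mid
      induced-form {mid} mids = mkForm id id chains λ {j} → ofx j , ofy j , ofz j , tri j
        where
        chains : ∀ {u v w} → _≺_ by bz u v → _≺_ by bz v w → _≺_ by bz u w → β 𝓖 u v w
        chains {u} {v} {w} p q r = β⁺ (ℕ.+-cancelˡ-≡ (pos u) _ _ (begin
          pos u + d u w              ≡⟨ ≺⇒d r ⟩
          pos w                      ≡⟨ sym (≺⇒d q) ⟩
          pos v + d v w              ≡⟨ cong (_+ d v w) (sym (≺⇒d p)) ⟩
          pos u + d u v + d v w      ≡⟨ ℕ.+-assoc (pos u) _ _ ⟩
          pos u + (d u v + d v w)    ∎))
          where open ≡-Reasoning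
        at : ∀ j {a} → mid j ≡ a → DMid j a
        at j e = subst (DMid j) e (mids j)
        dxz : ∀ j → d (xᵛ j) zᵛ ≡ D zᵛ (xᵛ j)
        dxz j = trans (d-sym (xᵛ j) zᵛ) (dzx j)
        dzy : d zᵛ yᵛ ≡ f
        dzy = trans (d-sym zᵛ yᵛ) dyz
        x-eq : ∀ j → d yᵛ (xᵛ j) + d (xᵛ j) zᵛ ≡ D yᵛ (xᵛ j) + D zᵛ (xᵛ j)
        x-eq j = cong₂ _+_ (dyx j) (dxz j)
        y-eq : ∀ j → d zᵛ yᵛ + d yᵛ (xᵛ j) ≡ f + D yᵛ (xᵛ j)
        y-eq j = cong₂ _+_ dzy (dyx j)
        z-eq : ∀ j → d yᵛ zᵛ + d zᵛ (xᵛ j) ≡ f + D zᵛ (xᵛ j)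
        z-eq j = cong₂ _+_ dyz (dzx j)
        ofx : ∀ j → mid j ≡ ofˣ → β 𝓖 yᵛ (xᵛ j) zᵛ
        ofx j e = β⁺ (trans dyz (trans (at j e) (sym (x-eq j))))
        ofy : ∀ j → mid j ≡ ofʸ → β 𝓖 zᵛ yᵛ (xᵛ j)
        ofy j e = β⁺ (trans (dzx j) (trans (at j e) (sym (y-eq j))))
        ofz : ∀ j → mid j ≡ ofᶻ → β 𝓖 yᵛ zᵛ (xᵛ j)
        ofz j e = β⁺ (trans (dyx j) (trans (at j e) (sym (z-eq j))))
        tri : ∀ j → mid j ≡ missing → Tri 𝓖 yᵛ zᵛ (xᵛ j)
        tri j e = (λ b → proj₂ (proj₂ (at j e)) (trans (sym (dyx j)) (trans (β⁻ b) (z-eq j))))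
                , (λ b → proj₁ (proj₂ (at j e)) (trans (sym (dzx j)) (trans (β⁻ b) (y-eq j))))
                , (λ b → proj₁ (at j e) (trans (sym dyz) (trans (β⁻ b) (x-eq j))))

-- Coordinates for the graphs Q, R and S

module Positions where

  open Triangles
  open Forms
  open TwoHubs
  open ShortestPaths
  open import Data.Nat using (_+_; _∸_; _≤_; _<_; ∣_-_∣)

  open BetweennessStructure
  open WeightedGraph

  -- Leaves room for a point at position b, at distance 1 from its predecessor and at
  -- distance a from its successor.
  spread : ℕ → ℕ → ℕ → ℕ
  spread b a j = if does (j ℕ.<? b) then j else j + a

  spread-lo : ∀ {b a j} → j < b → spread b a j ≡ j
  spread-lo {b} {a} {j} = if-yes (j ℕ.<? b)

  spread-hi : ∀ {b a j} → b ≤ j → spread b a j ≡ j + a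
  spread-hi {b} {a} {j} b≤j = if-no (j ℕ.<? b) (ℕ.≤⇒≯ b≤j)

  spread-suc : ∀ {b a j} → suc j ≢ b → spread b a (suc j) ≡ suc (spread b a j)
  spread-suc {b} {a} {j} ne with ℕ.<-≤-connex (suc j) b
  ... | inj₁ j+1<b = trans (spread-lo {a = a} j+1<b) (cong suc (sym (spread-lo {a = a} (ℕ.<⇒≤ j+1<b))))
  ... | inj₂ b≤j+1 =
    trans (spread-hi {a = a} b≤j+1) (cong suc (sym (spread-hi {a = a} (ℕ.≤-pred (ℕ.≤∧≢⇒< b≤j+1 (ne ∘ sym))))))

  gap-lo : ∀ {b a j} → j < b → ∣ b - spread b a j ∣ ≡ b ∸ j
  gap-lo {b} {a} {j} j<b = trans (cong (∣ b -_∣) (spread-lo {a = a} j<b)) (ℕ.m≤n⇒∣n-m∣≡n∸m (ℕ.<⇒≤ j<b))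

  gap-hi : ∀ {b a j} → b ≤ j → ∣ b - spread b a j ∣ ≡ j ∸ b + a
  gap-hi {b} {a} {j} b≤j = trans (cong (∣ b -_∣) (spread-hi {a = a} b≤j))
    (trans (ℕ.m≤n⇒∣m-n∣≡n∸m (ℕ.≤-trans b≤j (ℕ.m≤m+n j a))) (ℕ.+-∸-comm a b≤j))

  module _ {k : ℕ} where

    linePos : (b a pz : ℕ) → V {k} → ℕ
    linePos b a pz yᵛ     = b
    linePos b a pz zᵛ     = pz
    linePos b a pz (xᵛ j) = spread b a (toℕ j)

    PathEdge : V {k} → V {k} → ℕ → Set
    PathEdge u v w = ∃₂ λ i j → u ≡ xᵛ i × v ≡ xᵛ j × Graphs.Consecutive k i j × w ≡ 1

    pathWeight⁻ : ∀ {u v w} → weight (Graphs.path k) u v ≡ just w → PathEdge u v w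
    pathWeight⁻ {yᵛ}   {_}    ()
    pathWeight⁻ {zᵛ}   {_}    ()
    pathWeight⁻ {xᵛ i} {yᵛ}   ()
    pathWeight⁻ {xᵛ i} {zᵛ}   ()
    pathWeight⁻ {xᵛ i} {xᵛ j} {w} =
      if-ind (λ m → m ≡ just w → PathEdge (xᵛ i) (xᵛ j) w) (Graphs.consecutive? k i j)
      (λ c e → i , j , refl , refl , c , sym (just-injective e)) (λ _ ())

    path-edge : ∀ j → HasEdge (Graphs.path k) (xᵛ (inject₁ j)) (xᵛ (suc j)) 1
    path-edge j =
      hasEdge (if-yes (Graphs.consecutive? k (inject₁ j) (suc j)) (inj₁ (cong suc (Fin.toℕ-inject₁ j))))

    module _ {b a pz f : ℕ} where

      open LineMetric (linePos b a pz) f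

      unit-step : ∀ i j → suc (toℕ i) ≡ toℕ j → toℕ j ≢ b → D (xᵛ i) (xᵛ j) ≤ 1
      unit-step i j s j≢b = ℕ.≤-reflexive (trans (cong (∣ spread b a (toℕ i) -_∣)
        (trans (cong (spread b a) (sym s)) (trans (spread-suc {b} {a} {toℕ i} (λ e → j≢b (trans (sym s) e))) (sym (ℕ.+-comm (spread b a (toℕ i)) 1)))))
        (ℕ.∣m-m+n∣≡n (spread b a (toℕ i)) 1))

      -- Positions jump only where the gap at `b` is crossed, so all other path edges have length 1.
      -- The hypothesis `avoid` takes care of the crossing edge: it is deleted in R, and there is
      -- none for `b = 0`.
      path-dominated : ∀ {u v w} → (∀ {i j} → suc (toℕ i) ≡ toℕ j → toℕ j ≡ b → ¬ SamePair (xᵛ i) (xᵛ j) u v) →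
                       weight (Graphs.path k) u v ≡ just w → D u v ≤ w
      path-dominated {u} {v} avoid e with pathWeight⁻ {u} {v} e
      ... | i , j , refl , refl , inj₁ s , refl = unit-step i j s (λ j≡b → avoid s j≡b (inj₁ (refl , refl)))
      ... | i , j , refl , refl , inj₂ s , refl =
        subst (_≤ 1) (D-sym (xᵛ j) (xᵛ i)) (unit-step j i s (λ i≡b → avoid s i≡b (inj₂ (refl , refl))))

  -- The graphs Q and R: y and z are both at position b.
  module TwinForm {k : ℕ} (b a f : ℕ) (1≤a : 1 ≤ a) (1≤f : 1 ≤ f) (f≤2 : f ≤ 2) (b≤ : b ≤ suc k) where

    pos : V {k} → ℕ
    pos = linePos b a b

    open LineMetric pos f

    gap : Fin (suc k) → ℕ
    gap j = ∣ b - spread b a (toℕ j) ∣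

    1≤gap : ∀ j → 1 ≤ gap j
    1≤gap j with ℕ.<-≤-connex (toℕ j) b
    ... | inj₁ j<b = subst (1 ≤_) (sym (gap-lo {a = a} j<b)) (ℕ.m<n⇒0<n∸m j<b)
    ... | inj₂ b≤j = subst (1 ≤_) (sym (gap-hi {a = a} b≤j)) (ℕ.≤-trans 1≤a (ℕ.m≤n+m a (toℕ j ∸ b)))

    -- `yᵛ` and `zᵛ` have the same distance to `xᵛ j` and a positive distance to each other, so only
    -- `xᵛ j` could be in the middle, and this needs `f` to be twice the gap.
    far : ∀ {j} → 2 ≤ gap j ⊎ f ≤ 1 → DMid j missing
    far {j} h = (λ e → ℕ.<⇒≢ (f<2gap h) e) , (λ e → ℕ.m≢1+n+m (gap j) (trans e (cong (_+ gap j) (sym 1+f′≡f)))) ,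
                (λ e → ℕ.m≢1+n+m (gap j) (trans e (cong (_+ gap j) (sym 1+f′≡f))))
      where
      1+f′≡f : suc (f ∸ 1) ≡ f
      1+f′≡f = ℕ.m+[n∸m]≡n 1≤f
      f<2gap : 2 ≤ gap j ⊎ f ≤ 1 → f < gap j + gap j
      f<2gap (inj₁ 2≤gap) = ℕ.≤-trans (s≤s f≤2) (ℕ.+-mono-≤ (1≤gap j) 2≤gap)
      f<2gap (inj₂ f≤1)   = ℕ.≤-trans (s≤s f≤1) (ℕ.+-mono-≤ (1≤gap j) (1≤gap j))

    far-gap : ∀ {j} → suc (toℕ j) ≢ b → toℕ j ≢ b → 2 ≤ gap j
    far-gap {j} l r with ℕ.<-≤-connex (toℕ j) b
    ... | inj₁ j<b = subst (2 ≤_) (sym (gap-lo {a = a} j<b)) (ℕ.m+n≤o⇒m≤o∸n 2 (ℕ.≤∧≢⇒< j<b l))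
    ... | inj₂ b≤j = subst (2 ≤_) (sym (gap-hi {a = a} b≤j)) (ℕ.+-mono-≤ (ℕ.m<n⇒0<n∸m (ℕ.≤∧≢⇒< b≤j (r ∘ sym))) 1≤a)

    gap-left : ∀ {j} → suc (toℕ j) ≡ b → gap j ≡ 1
    gap-left {j} e =
      trans (gap-lo {a = a} (ℕ.≤-reflexive e)) (trans (cong (_∸ toℕ j) (sym e)) (ℕ.m+n∸n≡m 1 (toℕ j)))

    gap-right : ∀ {j} → toℕ j ≡ b → gap j ≡ a
    gap-right {j} e =
      trans (gap-hi {a = a} (ℕ.≤-reflexive (sym e))) (cong (_+ a) (trans (cong (_∸ b) e) (ℕ.n∸n≡0 b)))

    near : ∀ {j} → f ≡ 2 → gap j ≡ 1 → DMid j ofˣ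
    near f≡2 e = trans f≡2 (sym (cong₂ _+_ e e))

    module _ (G : WeightedGraph (3 + k)) (𝓖 : BetweennessStructure (3 + k)) (d : V {k} → V {k} → ℕ)
      (β⁺ : ∀ {u v w} → d u w ≡ d u v + d v w → β 𝓖 u v w) (β⁻ : ∀ {u v w} → β 𝓖 u v w → d u w ≡ d u v + d v w)
      (d-walk : ∀ u v → Walk G u v (d u v)) (d-least : ∀ {u v ℓ} → Walk G u v ℓ → d u v ≤ ℓ) where

      open InducedForm G 𝓖 d β⁺ β⁻ d-walk d-least pos f b b

      twin-form : Dominates G D →
        (∀ j → suc (toℕ j) ≢ b → HasEdge G (xᵛ (inject₁ j)) (xᵛ (suc j)) 1) →
        (∀ j → suc (toℕ j) ≡ b → HasEdge G (xᵛ j) yᵛ 1 × HasEdge G (xᵛ j) zᵛ 1) →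
        (∀ j → toℕ j ≡ b → HasEdge G yᵛ (xᵛ j) a × HasEdge G zᵛ (xᵛ j) a) →
        Walk G yᵛ zᵛ f → ∀ {mid} → (∀ j → DMid j (mid j)) → Form 𝓖 b b mid
      twin-form dom xx xyz yzx y-z = induced-form
        (λ j → ℕ.≤-trans f≤2 (ℕ.+-mono-≤ (1≤gap j) (1≤gap j))) (λ j → ℕ.m≤n+m (gap j) f) (λ j → ℕ.m≤n+m (gap j) f) dom
        x⇝x (λ j e → ⇝-edge (proj₁ (xyz j e)) (lo e)) (λ j e → ⇝-edge (proj₁ (yzx j e)) (hi e))
        (λ j e → ⇝-edge (proj₂ (xyz j e)) (lo e)) (λ j e → ⇝-edge (proj₂ (yzx j e)) (hi e)) b≤ b≤ y-z
        where
        lo : ∀ {j} → suc (toℕ j) ≡ b → spread b a (toℕ j) + 1 ≤ b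
        lo {j} e = ℕ.≤-reflexive (trans (ℕ.+-comm _ 1) (trans (cong suc (spread-lo {a = a} (ℕ.≤-reflexive e))) e))
        hi : ∀ {j} → toℕ j ≡ b → b + a ≤ spread b a (toℕ j)
        hi {j} e = ℕ.≤-reflexive (sym (trans (spread-hi {a = a} (ℕ.≤-reflexive (sym e))) (cong (_+ a) e)))
        x⇝x : ∀ j → xᵛ (inject₁ j) ⇝ xᵛ (suc j)
        x⇝x j with suc (toℕ j) ℕ.≟ b
        ... | yes e =
          ⇝-trans {v = yᵛ} (⇝-edge (proj₁ (xyz (inject₁ j) e′)) (lo e′)) (⇝-edge (proj₁ (yzx (suc j) e)) (hi {suc j} e))
          where
          e′ : suc (toℕ (inject₁ j)) ≡ b
          e′ = trans (cong suc (Fin.toℕ-inject₁ j)) e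
        ... | no ne = ⇝-edge (xx j ne) (ℕ.≤-reflexive (trans (cong (λ i → spread b a i + 1) (Fin.toℕ-inject₁ j))
                        (trans (ℕ.+-comm _ 1) (sym (spread-suc {a = a} ne)))))

  -- The graphs S: a path y x₀ x₁ … x_k z whose last edge has weight e, closed by an edge of
  -- weight f.
  module EndsForm {k : ℕ} (e f : ℕ) (e+k≤f+1 : e + k ≤ f + 1) (k+1≤f+e : suc k ≤ f + e) (f≤1+e+k : f < suc (e + k)) where

    pos : V {k} → ℕ
    pos = linePos 0 1 (suc (e + k))

    open LineMetric pos f

    j≤k : ∀ (j : Fin (suc k)) → toℕ j ≤ k
    j≤k j = ℕ.≤-pred (Fin.toℕ<n j)

    Dyx : ∀ j → D yᵛ (xᵛ j) ≡ suc (toℕ j)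
    Dyx j = ℕ.+-comm (toℕ j) 1

    Dzx : ∀ j → D zᵛ (xᵛ j) ≡ e + (k ∸ toℕ j)
    Dzx j = trans (cong (∣ suc (e + k) -_∣) (ℕ.+-comm (toℕ j) 1))
      (trans (ℕ.m≤n⇒∣n-m∣≡n∸m (ℕ.≤-trans (j≤k j) (ℕ.m≤n+m k e))) (ℕ.+-∸-assoc e (j≤k j)))

    Dyx+Dzx : ∀ j → D yᵛ (xᵛ j) + D zᵛ (xᵛ j) ≡ suc (e + k)
    Dyx+Dzx j = trans (cong₂ _+_ (Dyx j) (Dzx j)) (cong suc (trans (ℕ.+-comm (toℕ j) _)
      (trans (ℕ.+-assoc e _ _) (cong (e +_) (ℕ.m∸n+n≡m (j≤k j))))))

    Dyx≤ : ∀ j → D yᵛ (xᵛ j) ≤ f + D zᵛ (xᵛ j)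
    Dyx≤ j = subst₂ (λ s t → s ≤ f + t) (sym (Dyx j)) (sym (Dzx j))
      (ℕ.≤-trans (s≤s (j≤k j)) (ℕ.≤-trans k+1≤f+e (ℕ.+-monoʳ-≤ f (ℕ.m≤m+n e _))))

    Dzx≤ : ∀ j → D zᵛ (xᵛ j) ≤ f + D yᵛ (xᵛ j)
    Dzx≤ j = subst₂ (λ s t → s ≤ f + t) (sym (Dzx j)) (sym (Dyx j))
      (ℕ.≤-trans (ℕ.+-monoʳ-≤ e (ℕ.m∸n≤m k (toℕ j))) (ℕ.≤-trans e+k≤f+1 (ℕ.+-monoʳ-≤ f (s≤s z≤n))))

    -- The three kinds of collinearity correspond to equality in the three assumptions on `e`, `f`
    -- and `k`. The first two can be attained only at the first and at the last point of the path
    -- respectively; the third is strict, so no `xᵛ j` is between `yᵛ` and `zᵛ`.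
    no-mid : ∀ {j} → (0 < toℕ j ⊎ e + k < f + 1) → (toℕ j < k ⊎ suc k < f + e) → DMid j missing
    no-mid {j} h h′ =
      (λ q → ℕ.<⇒≢ f≤1+e+k (trans q (Dyx+Dzx j))) , (λ q → ℕ.<⇒≢ (z< h) (trans (sym (Dzx j)) (trans q (cong (f +_) (Dyx j))))) ,
      (λ q → ℕ.<⇒≢ (y< h′) (trans (sym (Dyx j)) (trans q (cong (f +_) (Dzx j)))))
      where
      z< : 0 < toℕ j ⊎ e + k < f + 1 → e + (k ∸ toℕ j) < f + suc (toℕ j)
      z< (inj₁ 0<j) = ℕ.≤-<-trans (ℕ.≤-trans (ℕ.+-monoʳ-≤ e (ℕ.m∸n≤m k (toℕ j))) e+k≤f+1) (ℕ.+-monoʳ-< f (s≤s 0<j))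
      z< (inj₂ lt)  = ℕ.≤-<-trans (ℕ.+-monoʳ-≤ e (ℕ.m∸n≤m k (toℕ j))) (ℕ.<-≤-trans lt (ℕ.+-monoʳ-≤ f (s≤s z≤n)))
      y< : toℕ j < k ⊎ suc k < f + e → suc (toℕ j) < f + (e + (k ∸ toℕ j))
      y< (inj₁ j<k) = ℕ.<-≤-trans (s≤s j<k) (ℕ.≤-trans k+1≤f+e (ℕ.+-monoʳ-≤ f (ℕ.m≤m+n e _)))
      y< (inj₂ lt)  = ℕ.≤-<-trans (s≤s (j≤k j)) (ℕ.<-≤-trans lt (ℕ.+-monoʳ-≤ f (ℕ.m≤m+n e _)))

    first-mid : ∀ {j} → toℕ j ≡ 0 → e + k ≡ f + 1 → DMid j ofʸ
    first-mid {j} j≡0 eq =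
      trans (Dzx j) (trans (cong (λ i → e + (k ∸ i)) j≡0) (trans eq (cong (f +_) (sym (trans (Dyx j) (cong suc j≡0))))))

    last-mid : ∀ {j} → toℕ j ≡ k → suc k ≡ f + e → DMid j ofᶻ
    last-mid {j} j≡k eq = trans (Dyx j) (trans (cong suc j≡k) (trans eq (cong (f +_) (sym (trans (Dzx j)
      (trans (cong (λ i → e + (k ∸ i)) j≡k) (trans (cong (e +_) (ℕ.n∸n≡0 k)) (ℕ.+-identityʳ e))))))))

    module _ (G : WeightedGraph (3 + k)) (𝓖 : BetweennessStructure (3 + k)) (d : V {k} → V {k} → ℕ)
      (β⁺ : ∀ {u v w} → d u w ≡ d u v + d v w → β 𝓖 u v w) (β⁻ : ∀ {u v w} → β 𝓖 u v w → d u w ≡ d u v + d v w)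
      (d-walk : ∀ u v → Walk G u v (d u v)) (d-least : ∀ {u v ℓ} → Walk G u v ℓ → d u v ≤ ℓ) where

      open InducedForm G 𝓖 d β⁺ β⁻ d-walk d-least pos f 0 (suc k)

      ends-form : Dominates G D →
        (∀ j → HasEdge G (xᵛ (inject₁ j)) (xᵛ (suc j)) 1) →
        HasEdge G yᵛ (xᵛ zero) 1 → HasEdge G (xᵛ (fromℕ k)) zᵛ e → HasEdge G yᵛ zᵛ f →
        ∀ {mid} → (∀ j → DMid j (mid j)) → Form 𝓖 0 (suc k) mid
      ends-form dom xx yx xz y-z = induced-form
        (λ j → subst (f ≤_) (sym (Dyx+Dzx j)) (ℕ.<⇒≤ f≤1+e+k)) Dyx≤ Dzx≤ dom
        (λ j → ⇝-edge (xx j) (ℕ.≤-reflexive (trans (cong (λ i → i + 1 + 1) (Fin.toℕ-inject₁ j)) (cong (_+ 1) (ℕ.+-comm (toℕ j) 1)))))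
        (λ j ()) (λ { zero _ → ⇝-edge yx ℕ.≤-refl })
        (λ j q → ⇝-edge (subst (λ i → HasEdge G (xᵛ i) zᵛ e) (sym (last j q)) xz)
          (ℕ.≤-reflexive (trans (cong (_+ e) (trans (ℕ.+-comm (toℕ j) 1) q)) (cong suc (ℕ.+-comm k e)))))
        (λ j q → contradiction q (ℕ.<⇒≢ (Fin.toℕ<n j))) z≤n ℕ.≤-refl (edge-walk y-z)
        where
        last : ∀ j → suc (toℕ j) ≡ suc k → j ≡ fromℕ k
        last j q = Fin.toℕ-injective (trans (ℕ.suc-injective q) (sym (Fin.toℕ-fromℕ k)))

-- Normal forms of the graph families

module FamilyGraphs where

  open Triangles
  open Forms
  open TwoHubs
  open ShortestPaths
  open Positions
  open import Data.Nat using (_+_; _∸_; _≤_; _<_; >-nonZero⁻¹)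

  open BetweennessStructure
  open WeightedGraph

  module _ {k : ℕ} where

    x-x≢y-x : ∀ {i j l : Fin (suc k)} → ¬ SamePair {3 + k} yᵛ (xᵛ l) (xᵛ i) (xᵛ j)
    x-x≢y-x (inj₁ (() , _))
    x-x≢y-x (inj₂ (_ , ()))

    x-x≢z-x : ∀ {i j l : Fin (suc k)} → ¬ SamePair {3 + k} zᵛ (xᵛ l) (xᵛ i) (xᵛ j)
    x-x≢z-x (inj₁ (() , _))
    x-x≢z-x (inj₂ (_ , ()))

    y-x≢z-x : ∀ {j l : Fin (suc k)} → ¬ SamePair {3 + k} zᵛ (xᵛ l) yᵛ (xᵛ j)
    y-x≢z-x (inj₁ (() , _))
    y-x≢z-x (inj₂ (() , _))

    z-x≢y-x : ∀ {j l : Fin (suc k)} → ¬ SamePair {3 + k} yᵛ (xᵛ l) zᵛ (xᵛ j)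
    z-x≢y-x (inj₁ (() , _))
    z-x≢y-x (inj₂ (() , _))

    v-x≢v-x : ∀ {v : V {k}} {j l : Fin (suc k)} → j ≢ l → ¬ SamePair {3 + k} v (xᵛ l) v (xᵛ j)
    v-x≢v-x j≢l (inj₁ (_ , refl)) = j≢l refl
    v-x≢v-x j≢l (inj₂ (refl , refl)) = j≢l refl

    v-x≢y-z : ∀ {v : V {k}} {j : Fin (suc k)} → ¬ SamePair {3 + k} yᵛ zᵛ v (xᵛ j)
    v-x≢y-z (inj₁ (_ , ()))
    v-x≢y-z (inj₂ (_ , ()))

  module RGraph {k : ℕ} (i : Fin k) (a : ℕ) .{{_ : NonZero a}} (a≤2 : a ≤ 2) where

    b : ℕ
    b = suc (toℕ i)

    l r : Fin (suc k)
    l = inject₁ i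
    r = suc i

    l≢r : l ≢ r
    l≢r e = ℕ.1+n≢n (trans (sym (cong toℕ e)) (Fin.toℕ-inject₁ i))

    l-left : suc (toℕ l) ≡ b
    l-left = cong suc (Fin.toℕ-inject₁ i)

    -- For `a = 1` the graph `G₄` is R⁴ and `G₅` is R²; for `a = 2` the graph `G₄` is R³.
    G₀ G₁ G₂ G₃ G₄ G₅ : WeightedGraph (3 + k)
    G₀ = delete (xᵛ l) (xᵛ r) (Graphs.path k)
    G₁ = add yᵛ (xᵛ l) 1 G₀
    G₂ = add zᵛ (xᵛ l) 1 G₁
    G₃ = add yᵛ (xᵛ r) a G₂
    G₄ = add zᵛ (xᵛ r) a G₃
    G₅ = add yᵛ zᵛ 1 G₄

    y-l : HasEdge G₄ yᵛ (xᵛ l) 1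
    y-l = edge-kept zᵛ (xᵛ r) a G₃ y-x≢z-x (edge-kept yᵛ (xᵛ r) a G₂ (v-x≢v-x l≢r)
      (edge-kept zᵛ (xᵛ l) 1 G₁ y-x≢z-x (edge-added yᵛ (xᵛ l) 1 G₀)))

    z-l : HasEdge G₄ zᵛ (xᵛ l) 1
    z-l = edge-kept zᵛ (xᵛ r) a G₃ (v-x≢v-x l≢r) (edge-kept yᵛ (xᵛ r) a G₂ z-x≢y-x (edge-added zᵛ (xᵛ l) 1 G₁))

    y-r : HasEdge G₄ yᵛ (xᵛ r) a
    y-r = edge-kept zᵛ (xᵛ r) a G₃ y-x≢z-x (edge-added yᵛ (xᵛ r) a G₂)

    z-r : HasEdge G₄ zᵛ (xᵛ r) a
    z-r = edge-added zᵛ (xᵛ r) a G₃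

    x-x : ∀ j → suc (toℕ j) ≢ b → HasEdge G₄ (xᵛ (inject₁ j)) (xᵛ (suc j)) 1
    x-x j j≢i = edge-kept zᵛ (xᵛ r) a G₃ x-x≢z-x (edge-kept yᵛ (xᵛ r) a G₂ x-x≢y-x
      (edge-kept zᵛ (xᵛ l) 1 G₁ x-x≢z-x (edge-kept yᵛ (xᵛ l) 1 G₀ x-x≢y-x
        (edge-undeleted (xᵛ l) (xᵛ r) (Graphs.path k) other (path-edge j)))))
      where
      other : ¬ SamePair (xᵛ l) (xᵛ r) (xᵛ (inject₁ j)) (xᵛ (suc j))
      other (inj₁ (_ , refl)) = j≢i refl
      other (inj₂ (p , q)) = ℕ.<-asym {toℕ i} {toℕ j}
        (ℕ.≤-reflexive (trans (sym (cong toℕ (Fin.suc-injective (Fin.suc-injective p)))) (Fin.toℕ-inject₁ j)))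
        (ℕ.≤-reflexive (trans (cong toℕ (Fin.suc-injective (Fin.suc-injective q))) (Fin.toℕ-inject₁ i)))

    y-l-z : Walk G₄ yᵛ zᵛ 2
    y-l-z = _⊕_ G₄ (edge-walk y-l) (edge-walk (hasEdge-sym z-l))

    module RForm (f : ℕ) (1≤f : 1 ≤ f) (f≤2 : f ≤ 2) where

      open TwinForm {k} b a f (>-nonZero⁻¹ a) 1≤f f≤2 (s≤s (ℕ.<⇒≤ (Fin.toℕ<n i))) public
      open LineMetric {k} pos f public

      dominates₄ : Dominates G₄ D
      dominates₄ = dominates-add zᵛ (xᵛ r) a G₃ D-sym (ℕ.≤-reflexive (gap-right {r} refl))
        (dominates-add yᵛ (xᵛ r) a G₂ D-sym (ℕ.≤-reflexive (gap-right {r} refl))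
        (dominates-add zᵛ (xᵛ l) 1 G₁ D-sym (ℕ.≤-reflexive (gap-left {l} l-left))
        (dominates-add yᵛ (xᵛ l) 1 G₀ D-sym (ℕ.≤-reflexive (gap-left {l} l-left))
        -- A path edge across the gap would have to be the deleted one.
        (dominates-delete (xᵛ l) (xᵛ r) (Graphs.path k) λ {u} {v} ¬same → path-dominated {u = u} {v} λ {p} {q} s q≡b same →
          ¬same (subst₂ (λ p q → SamePair (xᵛ p) (xᵛ q) u v)
            (Fin.toℕ-injective {i = p} {l} (ℕ.suc-injective (trans s (trans q≡b (sym l-left)))))
            (Fin.toℕ-injective {i = q} {r} q≡b) same)))))

      module _ (G : WeightedGraph (3 + k)) (conn : Connected G)
               (keep : ∀ {v j w} → HasEdge G₄ v (xᵛ j) w → HasEdge G v (xᵛ j) w) where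

        r-form : Dominates G D → Walk G yᵛ zᵛ f → ∀ {mid} → (∀ j → DMid j (mid j)) →
                 Form (Induced.structure G conn) b b mid
        r-form dom =
          twin-form G (Induced.structure G conn) (Induced.d G conn) id id (Induced.d-walk G conn) (Induced.d-least G conn)
          dom (λ j ne → keep (x-x j ne))
          (λ j e → subst (λ j → HasEdge G (xᵛ j) yᵛ 1 × HasEdge G (xᵛ j) zᵛ 1) (is-l e) (hasEdge-sym (keep y-l) , hasEdge-sym (keep z-l)))
          (λ j e → subst (λ j → HasEdge G yᵛ (xᵛ j) a × HasEdge G zᵛ (xᵛ j) a) (is-r e) (keep y-r , keep z-r))
          where
          is-l : ∀ {j} → suc (toℕ j) ≡ b → l ≡ j
          is-l e = Fin.toℕ-injective (ℕ.suc-injective (trans l-left (sym e)))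
          is-r : ∀ {j} → toℕ j ≡ b → r ≡ j
          is-r e = Fin.toℕ-injective (sym e)

    not-ends : ∀ {j} → j ≢ l → j ≢ r → suc (toℕ j) ≢ b × toℕ j ≢ b
    not-ends j≢l j≢r =
      (λ e → j≢l (Fin.toℕ-injective (ℕ.suc-injective (trans e (sym l-left))))) , (λ e → j≢r (Fin.toℕ-injective e))

  module _ {k : ℕ} (i : Fin k) where

    R⁴-form : Form (Induced.structure (Graphs.R⁴ k i) (Graphs.R-connected k i 1)) (suc (toℕ i)) (suc (toℕ i))
                   (mid₂ (inject₁ i) (suc i) (when true ofˣ) (when true ofˣ))
    R⁴-form = r-form (Graphs.R⁴ k i) (Graphs.R-connected k i 1) id dominates₄ y-l-z mids
      where
      open RGraph i 1 (s≤s z≤n)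
      open RForm 2 (s≤s z≤n) ℕ.≤-refl
      mids : ∀ j → DMid j (mid₂ l r ofˣ ofˣ j)
      mids =
        mid₂-elim DMid {l} {r} (near {l} refl (gap-left {l} l-left)) (λ _ → near {r} refl (gap-right {r} refl))
        (λ j j≢l j≢r → far {j} (inj₁ (uncurry (far-gap {j}) (not-ends j≢l j≢r))))

    R³-form : Form (Induced.structure (Graphs.R³ k i) (Graphs.R-connected k i 2)) (suc (toℕ i)) (suc (toℕ i))
                   (mid₂ (inject₁ i) (suc i) (when true ofˣ) (when false ofˣ))
    R³-form = r-form (Graphs.R³ k i) (Graphs.R-connected k i 2) id dominates₄ y-l-z mids
      where
      open RGraph i 2 ℕ.≤-refl
      open RForm 2 (s≤s z≤n) ℕ.≤-refl
      mids : ∀ j → DMid j (mid₂ l r ofˣ missing j)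
      mids = mid₂-elim DMid {l} {r} (near {l} refl (gap-left {l} l-left))
        (λ _ → far {r} (inj₁ (ℕ.≤-reflexive (sym (gap-right {r} refl)))))
        (λ j j≢l j≢r → far {j} (inj₁ (uncurry (far-gap {j}) (not-ends j≢l j≢r))))

    R²-connected : Connected (Graphs.R² k i)
    R²-connected = Graphs.add-connected k _ _ 1 _ (Graphs.R-connected k i 1)

    R²-form : Form (Induced.structure (Graphs.R² k i) R²-connected) (suc (toℕ i)) (suc (toℕ i))
                   (mid₂ (inject₁ i) (suc i) (when false ofˣ) (when false ofˣ))
    R²-form = r-form (Graphs.R² k i) R²-connected (edge-kept yᵛ zᵛ 1 G₄ v-x≢y-z)
      (dominates-add yᵛ zᵛ 1 G₄ D-sym ℕ.≤-refl dominates₄) (edge-walk (edge-added yᵛ zᵛ 1 G₄)) mids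
      where
      open RGraph i 1 (s≤s z≤n)
      open RForm 1 (s≤s z≤n) (s≤s z≤n)
      mids : ∀ j → DMid j (mid₂ l r missing missing j)
      mids =
        mid₂-elim DMid {l} {r} (far {l} (inj₂ ℕ.≤-refl)) (λ _ → far {r} (inj₂ ℕ.≤-refl)) (λ j _ _ → far {j} (inj₂ ℕ.≤-refl))

  module _ (k : ℕ) where

    private
      G₁ G₂ : WeightedGraph (3 + k)
      G₁ = add yᵛ (xᵛ zero) 1 (Graphs.path k)
      G₂ = add zᵛ (xᵛ zero) 1 G₁

      y-x : HasEdge G₂ yᵛ (xᵛ zero) 1
      y-x = edge-kept zᵛ (xᵛ zero) 1 G₁ y-x≢z-x (edge-added yᵛ (xᵛ zero) 1 (Graphs.path k))

      z-x : HasEdge G₂ zᵛ (xᵛ zero) 1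
      z-x = edge-added zᵛ (xᵛ zero) 1 G₁

      x-x : ∀ j → HasEdge G₂ (xᵛ (inject₁ j)) (xᵛ (suc j)) 1
      x-x j = edge-kept zᵛ (xᵛ zero) 1 G₁ x-x≢z-x (edge-kept yᵛ (xᵛ zero) 1 (Graphs.path k) x-x≢y-x (path-edge j))

      module QForm (f : ℕ) (1≤f : 1 ≤ f) (f≤2 : f ≤ 2) where

        open TwinForm {k} 0 1 f ℕ.≤-refl 1≤f f≤2 z≤n public
        open LineMetric {k} pos f public

        dominates₂ : Dominates G₂ D
        dominates₂ = dominates-add zᵛ (xᵛ zero) 1 G₁ D-sym ℕ.≤-refl
          (dominates-add yᵛ (xᵛ zero) 1 (Graphs.path k) D-sym ℕ.≤-refl
          (dominates λ {u} {v} → path-dominated {u = u} {v} λ {p} {q} s q≡0 _ → contradiction (trans s q≡0) λ ()))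

        module _ (G : WeightedGraph (3 + k)) (conn : Connected G)
                 (keep : ∀ {v j w} → HasEdge G₂ v (xᵛ j) w → HasEdge G v (xᵛ j) w) where

          q-form : Dominates G D → Walk G yᵛ zᵛ f → ∀ {mid} → (∀ j → DMid j (mid j)) →
                   Form (Induced.structure G conn) 0 0 mid
          q-form dom =
            twin-form G (Induced.structure G conn) (Induced.d G conn) id id (Induced.d-walk G conn) (Induced.d-least G conn)
            dom (λ j _ → keep (x-x j)) (λ _ ()) (λ { zero _ → keep y-x , keep z-x })

    Q³-form : Form (Induced.structure (Graphs.Q³ k) (Graphs.pendant-connected k zero zero 1 1)) 0 0
                   (mid₂ zero zero (when true ofˣ) missing)
    Q³-form = q-form (Graphs.Q³ k) (Graphs.pendant-connected k zero zero 1 1) id dominates₂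
      (_⊕_ G₂ (edge-walk y-x) (edge-walk (hasEdge-sym z-x))) mids
      where
      open QForm 2 (s≤s z≤n) ℕ.≤-refl
      mids : ∀ j → DMid j (mid₂ zero zero ofˣ missing j)
      mids = mid₂-elim DMid {zero} {zero} (near {zero} refl (gap-right {zero} refl)) (λ ne → contradiction refl ne)
        (λ j j≢0 _ → far {j} (inj₁ (far-gap {j} (λ ()) (λ e → j≢0 (Fin.toℕ-injective e)))))

    Q²-connected : Connected (Graphs.Q² k)
    Q²-connected = Graphs.add-connected k _ _ 1 _ (Graphs.pendant-connected k zero zero 1 1)

    Q²-form : Form (Induced.structure (Graphs.Q² k) Q²-connected) 0 0 (mid₂ zero zero (when false ofˣ) missing)
    Q²-form = q-form (Graphs.Q² k) Q²-connected (edge-kept yᵛ zᵛ 1 G₂ v-x≢y-z)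
      (dominates-add yᵛ zᵛ 1 G₂ D-sym ℕ.≤-refl dominates₂) (edge-walk (edge-added yᵛ zᵛ 1 G₂)) mids
      where
      open QForm 1 (s≤s z≤n) (s≤s z≤n)
      mids : ∀ j → DMid j (mid₂ zero zero missing missing j)
      mids =
        mid₂-elim DMid {zero} {zero} (far {zero} (inj₂ ℕ.≤-refl)) (λ _ → far {zero} (inj₂ ℕ.≤-refl)) (λ j _ _ → far {j} (inj₂ ℕ.≤-refl))

  -- S⁴, S³ and S² are the cases `(1 , k)`, `(2 , k + 1)` and `(1 , k + 1)` of the pair `(e , f)`.
  module SGraph (k e f : ℕ) .{{_ : NonZero e}} .{{_ : NonZero f}}
    (e+k≤f+1 : e + k ≤ f + 1) (k+1≤f+e : suc k ≤ f + e) (f≤1+e+k : f < suc (e + k)) where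

    G₁ G₂ G₃ : WeightedGraph (3 + k)
    G₁ = add yᵛ (xᵛ zero) 1 (Graphs.path k)
    G₂ = add zᵛ (xᵛ (fromℕ k)) e G₁
    G₃ = add yᵛ zᵛ f G₂

    open EndsForm {k} e f e+k≤f+1 k+1≤f+e f≤1+e+k public
    open LineMetric {k} pos f public

    private
      keep : ∀ {v j w} → HasEdge G₂ v (xᵛ j) w → HasEdge G₃ v (xᵛ j) w
      keep = edge-kept yᵛ zᵛ f G₂ v-x≢y-z

      z-last : D zᵛ (xᵛ (fromℕ k)) ≡ e
      z-last =
        trans (Dzx (fromℕ k)) (trans (cong (λ i → e + (k ∸ i)) (Fin.toℕ-fromℕ k)) (trans (cong (e +_) (ℕ.n∸n≡0 k)) (ℕ.+-identityʳ e)))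

    dominates₃ : Dominates G₃ D
    dominates₃ = dominates-add yᵛ zᵛ f G₂ D-sym ℕ.≤-refl
      (dominates-add zᵛ (xᵛ (fromℕ k)) e G₁ D-sym (ℕ.≤-reflexive z-last)
      (dominates-add yᵛ (xᵛ zero) 1 (Graphs.path k) D-sym ℕ.≤-refl
      (dominates λ {u} {v} → path-dominated {u = u} {v} λ {p} {q} s q≡0 _ → contradiction (trans s q≡0) λ ())))

    x-x : ∀ j → HasEdge G₃ (xᵛ (inject₁ j)) (xᵛ (suc j)) 1
    x-x j =
      keep (edge-kept zᵛ (xᵛ (fromℕ k)) e G₁ x-x≢z-x (edge-kept yᵛ (xᵛ zero) 1 (Graphs.path k) x-x≢y-x (path-edge j)))

    y-x : HasEdge G₃ yᵛ (xᵛ zero) 1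
    y-x = keep (edge-kept zᵛ (xᵛ (fromℕ k)) e G₁ y-x≢z-x (edge-added yᵛ (xᵛ zero) 1 (Graphs.path k)))

    x-z : HasEdge G₃ (xᵛ (fromℕ k)) zᵛ e
    x-z = hasEdge-sym (keep (edge-added zᵛ (xᵛ (fromℕ k)) e G₁))

    y-z : HasEdge G₃ yᵛ zᵛ f
    y-z = edge-added yᵛ zᵛ f G₂

    module _ (G : WeightedGraph (3 + k)) (conn : Connected G) (same : ∀ {u v w} → HasEdge G₃ u v w → HasEdge G u v w) where

      s-form : Dominates G D → ∀ {mid} → (∀ j → DMid j (mid j)) → Form (Induced.structure G conn) 0 (suc k) mid
      s-form dom =
        ends-form G (Induced.structure G conn) (Induced.d G conn) id id (Induced.d-walk G conn) (Induced.d-least G conn)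
        dom (λ j → same (x-x j)) (same y-x) (same x-z) (same y-z)

    interior : ∀ {j} → j ≢ zero → j ≢ fromℕ k → 0 < toℕ j × toℕ j < k
    interior {j} j≢0 j≢k = ℕ.n≢0⇒n>0 (λ q → j≢0 (Fin.toℕ-injective q)) ,
                         ℕ.≤∧≢⇒< (j≤k j) (λ q → j≢k (Fin.toℕ-injective (trans q (sym (Fin.toℕ-fromℕ k)))))

  module _ (k : ℕ) where

    S⁴-connected : Connected (Graphs.S⁴ (suc k))
    S⁴-connected =
      Graphs.add-connected (suc k) _ _ (suc k) _ (Graphs.pendant-connected (suc k) zero (fromℕ (suc k)) 1 1)

    -- Stated for order `4 + k`, so that the path has two distinct ends and the edge between `yᵛ`
    -- and `zᵛ` has positive weight.
    S⁴-form : Form (Induced.structure (Graphs.S⁴ (suc k)) S⁴-connected) 0 (2 + k) (mid₂ zero (fromℕ (suc k)) (when true ofʸ) (when true ofᶻ))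
    S⁴-form =
      s-form (Graphs.S⁴ (suc k)) S⁴-connected id dominates₃ (mid₂-elim DMid {zero} {fromℕ (suc k)} (first-mid {zero} refl (ℕ.+-comm 1 (suc k)))
      (λ _ → last-mid {fromℕ (suc k)} (Fin.toℕ-fromℕ (suc k)) (ℕ.+-comm 1 (suc k)))
      (λ j p q → no-mid {j} (inj₁ (proj₁ (interior p q))) (inj₁ (proj₂ (interior p q)))))
      where open SGraph (suc k) 1 (suc k) (ℕ.≤-reflexive (ℕ.+-comm 1 (suc k))) (ℕ.≤-reflexive (ℕ.+-comm 1 (suc k))) (ℕ.n≤1+n _)

    S³-connected : Connected (Graphs.S³ (suc k))
    S³-connected =
      Graphs.add-connected (suc k) _ _ (1 + suc k) _ (Graphs.pendant-connected (suc k) zero (fromℕ (suc k)) 1 2)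

    S³-form : Form (Induced.structure (Graphs.S³ (suc k)) S³-connected) 0 (2 + k) (mid₂ zero (fromℕ (suc k)) (when true ofʸ) (when false ofᶻ))
    S³-form =
      s-form (Graphs.S³ (suc k)) S³-connected id dominates₃ (mid₂-elim DMid {zero} {fromℕ (suc k)} (first-mid {zero} refl (ℕ.+-comm 1 (2 + k)))
      (λ _ → no-mid {fromℕ (suc k)} (inj₁ (subst (0 <_) (sym (Fin.toℕ-fromℕ (suc k))) (s≤s z≤n))) (inj₂ (ℕ.m<m+n (2 + k) (s≤s z≤n))))
      (λ j p q → no-mid {j} (inj₁ (proj₁ (interior p q))) (inj₁ (proj₂ (interior p q)))))
      where open SGraph (suc k) 2 (2 + k) (ℕ.≤-reflexive (ℕ.+-comm 1 (2 + k))) (ℕ.m≤m+n (2 + k) 2) (ℕ.n≤1+n _)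

    S²-connected : Connected (Graphs.S² (suc k))
    S²-connected =
      Graphs.add-connected (suc k) _ _ (1 + suc k) _ (Graphs.pendant-connected (suc k) zero (fromℕ (suc k)) 1 1)

    S²-form : Form (Induced.structure (Graphs.S² (suc k)) S²-connected) 0 (2 + k) (mid₂ zero (fromℕ (suc k)) (when false ofʸ) (when false ofᶻ))
    S²-form =
      s-form (Graphs.S² (suc k)) S²-connected id dominates₃ (mid₂-elim DMid {zero} {fromℕ (suc k)} (anywhere zero) (λ _ → anywhere (fromℕ (suc k))) (λ j _ _ → anywhere j))
      where
      open SGraph (suc k) 1 (2 + k) (ℕ.m≤m+n (2 + k) 1) (ℕ.m≤m+n (2 + k) 1) ℕ.≤-refl
      anywhere : ∀ j → DMid j missing
      anywhere j = no-mid {j} (inj₂ (ℕ.m<m+n (2 + k) (s≤s z≤n))) (inj₂ (ℕ.m<m+n (2 + k) (s≤s z≤n)))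

-- Metrics from levels: linear structures and the extremal example

module LevelStructures where

  open Triangles
  open import Data.Nat using (_+_; _∸_; _≤_; _<_; ∣_-_∣)

  open BetweennessStructure

  module _ {n : ℕ} {{_ : NonZero n}} (d : Fin n → Fin n → ℕ) (d-refl : ∀ u → d u u ≡ 0) (d-sym : ∀ u v → d u v ≡ d v u)
           (d-triangle : ∀ u v t → d u t ≤ d u v + d v t) (d-zero : ∀ u v → d u v ≡ 0 → u ≡ v) where

    metricStructure : BetweennessStructure n
    metricStructure = record
      { nonEmpty = it
      ; β  = λ x y z → d x z ≡ d x y + d y z
      ; β? = λ x y z → d x z ℕ.≟ d x y + d y z
      ; P1 = λ x z → sym (cong (_+ d x z) (d-refl x))
      ; P2 =
        λ x y z b → trans (d-sym z x) (trans b (trans (ℕ.+-comm (d x y) (d y z)) (cong₂ _+_ (d-sym y z) (d-sym x y))))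
      ; P3 = λ x y z b c → d-zero x y (ℕ.m+n≡0⇒m≡0 (d x y) (ℕ.+-cancelʳ-≡ (d x z) (d x y + d x y) 0 (begin
          d x y + d x y + d x z    ≡⟨ ℕ.+-assoc (d x y) _ _ ⟩
          d x y + (d x y + d x z)  ≡⟨ cong (λ s → d x y + (s + d x z)) (d-sym x y) ⟩
          d x y + (d y x + d x z)  ≡⟨ cong (d x y +_) (sym c) ⟩
          d x y + d y z            ≡⟨ sym b ⟩
          d x z                    ∎)))
      ; P4 = λ x y z w b c → between x y z w b c
      }
      where
      open import Function using (it)
      open ≡-Reasoning
      between : ∀ x y z w → d x z ≡ d x y + d y z → d x y ≡ d x w + d w y →
        d x z ≡ d x w + d w z × d w z ≡ d w y + d y z
      between x y z w b c = trans split (cong (d x w +_) (sym wyz)) , wyz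
        where
        split : d x z ≡ d x w + (d w y + d y z)
        split = trans b (trans (cong (_+ d y z) c) (ℕ.+-assoc (d x w) _ _))
        wyz : d w z ≡ d w y + d y z
        wyz = ℕ.≤-antisym (d-triangle w y z)
          (ℕ.+-cancelˡ-≤ (d x w) _ _ (subst (_≤ d x w + d w z) split (d-triangle x w z)))

  -- Points at the same position have distance 2, so that precisely the points at the
  -- adjacent positions are between them.
  module Levels {n : ℕ} {{_ : NonZero n}} (pos : Fin n → ℕ) where

    δ : Fin n → Fin n → ℕ
    δ u v with u Fin.≟ v | ∣ pos u - pos v ∣
    ... | yes _ | _     = 0
    ... | no _  | zero  = 2
    ... | no _  | suc m = suc m

    δ-refl : ∀ u → δ u u ≡ 0
    δ-refl u with u Fin.≟ u
    ... | yes _ = refl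
    ... | no ne = contradiction refl ne

    δ-same : ∀ {u v} → u ≢ v → pos u ≡ pos v → δ u v ≡ 2
    δ-same {u} {v} u≢v e with u Fin.≟ v | ∣ pos u - pos v ∣ | ℕ.m≡n⇒∣m-n∣≡0 e
    ... | yes q | _ | _    = contradiction q u≢v
    ... | no _  | _ | refl = refl

    δ-different : ∀ {u v} → pos u ≢ pos v → δ u v ≡ ∣ pos u - pos v ∣
    δ-different {u} {v} ne with u Fin.≟ v | ∣ pos u - pos v ∣ in eq
    ... | yes refl | _     = contradiction refl ne
    ... | no _     | zero  = contradiction (ℕ.∣m-n∣≡0⇒m≡n eq) ne
    ... | no _     | suc m = refl

    line≤δ : ∀ u v → ∣ pos u - pos v ∣ ≤ δ u v
    line≤δ u v with pos u ℕ.≟ pos v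
    ... | yes e = subst (_≤ δ u v) (sym (ℕ.m≡n⇒∣m-n∣≡0 e)) z≤n
    ... | no ne = ℕ.≤-reflexive (sym (δ-different ne))

    δ-zero : ∀ u v → δ u v ≡ 0 → u ≡ v
    δ-zero u v with u Fin.≟ v | ∣ pos u - pos v ∣
    ... | yes e | _     = λ _ → e
    ... | no _  | zero  = λ ()
    ... | no _  | suc _ = λ ()

    1≤δ : ∀ {u v} → u ≢ v → 1 ≤ δ u v
    1≤δ {u} {v} ne = ℕ.n≢0⇒n>0 (ne ∘ δ-zero u v)

    δ-sym : ∀ u v → δ u v ≡ δ v u
    δ-sym u v = by-cases (u Fin.≟ v) (pos u ℕ.≟ pos v)
      where
      by-cases : Dec (u ≡ v) → Dec (pos u ≡ pos v) → δ u v ≡ δ v u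
      by-cases (yes refl) _ = refl
      by-cases (no u≢v) (yes e) = trans (δ-same u≢v e) (sym (δ-same (u≢v ∘ sym) (sym e)))
      by-cases (no u≢v) (no ne) =
        trans (δ-different ne) (trans (ℕ.∣-∣-comm (pos u) (pos v)) (sym (δ-different (ne ∘ sym))))

    -- If `u` and `t` have different positions, the inequality comes from the line. Otherwise their
    -- distance is at most 2, and a detour through a third point consists of two steps of length at
    -- least 1.
    δ-triangle : ∀ u v t → δ u t ≤ δ u v + δ v t
    δ-triangle u v t with pos u ℕ.≟ pos t
    ... | no ne = subst (_≤ δ u v + δ v t) (sym (δ-different ne))
      (ℕ.≤-trans (ℕ.∣-∣-triangle (pos u) (pos v) (pos t)) (ℕ.+-mono-≤ (line≤δ u v) (line≤δ v t)))
    ... | yes e = by-cases (u Fin.≟ t) (u Fin.≟ v) (v Fin.≟ t)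
      where
      by-cases : Dec (u ≡ t) → Dec (u ≡ v) → Dec (v ≡ t) → δ u t ≤ δ u v + δ v t
      by-cases (yes refl) _ _ = ℕ.≤-trans (ℕ.≤-reflexive (δ-refl u)) z≤n
      by-cases (no _) (yes refl) _ = ℕ.m≤n+m (δ u t) (δ u u)
      by-cases (no _) (no _) (yes refl) = ℕ.m≤m+n (δ u t) (δ t t)
      by-cases (no u≢t) (no u≢v) (no v≢t) =
        subst (_≤ δ u v + δ v t) (sym (δ-same u≢t e)) (ℕ.+-mono-≤ (1≤δ u≢v) (1≤δ v≢t))

    levels : BetweennessStructure n
    levels = metricStructure δ δ-refl δ-sym δ-triangle δ-zero

    levels-ordered : ∀ {a b c} → pos a < pos b → pos b < pos c → β levels a b c
    levels-ordered {a} {b} {c} p q = begin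
      δ a c                                      ≡⟨ up (ℕ.<-trans p q) ⟩
      pos c ∸ pos a                              ≡⟨ cong (_∸ pos a) (sym (ℕ.m+[n∸m]≡n (ℕ.<⇒≤ q))) ⟩
      pos b + (pos c ∸ pos b) ∸ pos a            ≡⟨ ℕ.+-∸-comm (pos c ∸ pos b) (ℕ.<⇒≤ p) ⟩
      (pos b ∸ pos a) + (pos c ∸ pos b)          ≡⟨ sym (cong₂ _+_ (up p) (up q)) ⟩
      δ a b + δ b c                              ∎
      where
      open ≡-Reasoning
      up : ∀ {u v} → pos u < pos v → δ u v ≡ pos v ∸ pos u
      up p = trans (δ-different (ℕ.<⇒≢ p)) (ℕ.m≤n⇒∣m-n∣≡n∸m (ℕ.<⇒≤ p))

    different-levels : ∀ {a b c} → pos a ≢ pos b → pos a ≢ pos c → pos b ≢ pos c → ¬ Tri levels a b c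
    different-levels {a} {b} {c} a≢b a≢c b≢c (t₁ , t₂ , t₃) with ℕ.<-cmp (pos a) (pos b) | ℕ.<-cmp (pos b) (pos c) | ℕ.<-cmp (pos a) (pos c)
    ... | tri≈ _ e _ | _ | _ = a≢b e
    ... | _ | tri≈ _ e _ | _ = b≢c e
    ... | _ | _ | tri≈ _ e _ = a≢c e
    ... | tri< p _ _ | tri< q _ _ | _ = t₁ (levels-ordered p q)
    ... | tri> _ _ p | tri> _ _ q | _ = t₁ (P2 levels _ _ _ (levels-ordered q p))
    ... | tri< p _ _ | tri> _ _ q | tri< r _ _ = t₃ (levels-ordered r q)
    ... | tri< p _ _ | tri> _ _ q | tri> _ _ r = t₂ (P2 levels _ _ _ (levels-ordered r p))
    ... | tri> _ _ p | tri< q _ _ | tri< r _ _ = t₂ (levels-ordered p r)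
    ... | tri> _ _ p | tri< q _ _ | tri> _ _ r = t₃ (P2 levels _ _ _ (levels-ordered q r))

    module _ {a b c : Fin n} (a≢b : a ≢ b) (same : pos a ≡ pos b) where

      private
        b-to-c : pos a ≢ pos c → δ c b ≡ ∣ pos a - pos c ∣
        b-to-c ne =
          trans (δ-different (λ e → ne (trans same (sym e)))) (trans (ℕ.∣-∣-comm (pos c) (pos b)) (cong (∣_- pos c ∣) (sym same)))

      twins-next : ∣ pos a - pos c ∣ ≡ 1 → ¬ Tri levels a b c
      twins-next e (_ , _ , t) =
        t (trans (δ-same a≢b same) (sym (cong₂ _+_ (trans (δ-different ne) e) (trans (b-to-c ne) e))))
        where
        ne : pos a ≢ pos c
        ne q = contradiction (trans (sym (ℕ.m≡n⇒∣m-n∣≡0 q)) e) λ ()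

      -- Twins are equally far from `c`, so neither of them is between the other and `c`. And `c` is
      -- between them only if twice its distance is 2, the distance of the twins.
      twins-far : 2 ≤ ∣ pos a - pos c ∣ → Tri levels a b c
      twins-far 2≤ =
        (λ e → ℕ.m≢1+n+m (δ a c) (trans e (cong₂ _+_ (δ-same a≢b same) (trans (δ-sym b c) (trans (b-to-c ne) (sym (δ-different ne)))))))
        , (λ e → ℕ.m≢1+n+m (δ b c) (trans e (cong₂ _+_ (trans (δ-sym b a) (δ-same a≢b same)) (trans (δ-different ne) (sym (trans (δ-sym b c) (b-to-c ne)))))))
        , (λ e → ℕ.<⇒≢ (ℕ.≤-trans (s≤s (s≤s (s≤s z≤n))) (ℕ.+-mono-≤ 2≤ 2≤))
                   (trans (sym (δ-same a≢b same)) (trans e (cong₂ _+_ (δ-different ne) (b-to-c ne)))))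
        where
        ne : pos a ≢ pos c
        ne q = contradiction (subst (2 ≤_) (ℕ.m≡n⇒∣m-n∣≡0 q) 2≤) λ ()

  linear : ∀ n {{_ : NonZero n}} → BetweennessStructure n
  linear n = Levels.levels toℕ

  linear-noTri : ∀ n {{_ : NonZero n}} → NoTri (linear n)
  linear-noTri n {a} {b} {c} t with tri-distinct (linear n) {a} {b} {c} t
  ... | p , q , r =
    Levels.different-levels toℕ (p ∘ Fin.toℕ-injective) (q ∘ Fin.toℕ-injective) (r ∘ Fin.toℕ-injective) t

  -- Each of the pairs t₁ t₂ and s₁ s₂ forms a triangle with every point at neither its own
  -- nor an adjacent position: these are 2 (r + 1) = 2 n - 10 triangles, some of them disjoint.
  module TwoTwins (r : ℕ) where

    pattern v    = zero
    pattern t₁   = suc zero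
    pattern t₂   = suc (suc zero)
    pattern s₁   = suc (suc (suc zero))
    pattern s₂   = suc (suc (suc (suc zero)))
    pattern w j  = suc (suc (suc (suc (suc j))))

    pos : Fin (6 + r) → ℕ
    pos v     = 0
    pos t₁    = 1
    pos t₂    = 1
    pos s₁    = 2
    pos s₂    = 2
    pos (w j) = 3 + toℕ j

    open Levels pos

    twoTwins : BetweennessStructure (6 + r)
    twoTwins = levels

    -- The points at least two levels away from `s₁` and `s₂`. The point `w zero` is on the adjacent
    -- level 3, and `v` on level 0 takes its place.
    beyond : Fin (suc r) → Fin (6 + r)
    beyond zero    = v
    beyond (suc j) = w (suc j)

    beyond-injective : ∀ {i j} → beyond i ≡ beyond j → i ≡ j
    beyond-injective {zero}  {zero}  _    = refl
    beyond-injective {suc _} {suc _} refl = refl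

    half : Fin (suc r) ⊎ Fin (suc r) → Subset (6 + r)
    half (inj₁ j) = tset t₁ t₂ (w j)
    half (inj₂ j) = tset s₁ s₂ (beyond j)

    t₁-apart : ∀ j → ¬ OneOf t₁ s₁ s₂ (beyond j)
    t₁-apart zero    (3rd ())
    t₁-apart (suc _) (3rd ())

    half-injective : ∀ {i j} → half i ≡ half j → i ≡ j
    half-injective {inj₁ i} {inj₁ j} e =
      go (∈-tset⁻ {a = t₁} {t₂} {w j} (subst (w i ∈ˢ_) e (∈-tset⁺ {a = t₁} {t₂} (3rd refl))))
      where
      go : OneOf (w i) t₁ t₂ (w j) → inj₁ i ≡ inj₁ j
      go (3rd refl) = refl
    half-injective {inj₁ i} {inj₂ j} e =
      contradiction (∈-tset⁻ {a = s₁} {s₂} {beyond j} (subst (t₁ ∈ˢ_) e (∈-tset⁺ {a = t₁} {t₂} {w i} (1st refl))))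
      (t₁-apart j)
    half-injective {inj₂ i} {inj₁ j} e =
      contradiction (∈-tset⁻ {a = s₁} {s₂} {beyond i} (subst (t₁ ∈ˢ_) (sym e) (∈-tset⁺ {a = t₁} {t₂} {w j} (1st refl))))
      (t₁-apart i)
    half-injective {inj₂ i} {inj₂ j} e =
      go i (∈-tset⁻ {a = s₁} {s₂} {beyond j} (subst (beyond i ∈ˢ_) e (∈-tset⁺ {a = s₁} {s₂} (3rd refl))))
      where
      go : ∀ i → OneOf (beyond i) s₁ s₂ (beyond j) → inj₂ i ≡ inj₂ j
      go i       (3rd q)  = cong inj₂ (beyond-injective q)
      go zero    (1st ())
      go (suc _) (1st ())
      go zero    (2nd ())
      go (suc _) (2nd ())

    half-triangle : ∀ i → Triangle twoTwins (half i)
    half-triangle (inj₁ j)       =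
      tri⇒triangle twoTwins {t₁} {t₂} {w j} (twins-far {t₁} {t₂} {w j} (λ ()) refl (s≤s (s≤s z≤n)))
    half-triangle (inj₂ zero)    =
      tri⇒triangle twoTwins {s₁} {s₂} {v} (twins-far {s₁} {s₂} {v} (λ ()) refl (s≤s (s≤s z≤n)))
    half-triangle (inj₂ (suc j)) =
      tri⇒triangle twoTwins {s₁} {s₂} {w (suc j)} (twins-far {s₁} {s₂} {w (suc j)} (λ ()) refl (s≤s (s≤s z≤n)))

    -- Indexing by the position lets a match on two points of one level discard the pairs on
    -- different levels.
    data Level : Fin (6 + r) → ℕ → Set where
      at-v  : Level v 0
      at-t₁ : Level t₁ 1
      at-t₂ : Level t₂ 1
      at-s₁ : Level s₁ 2
      at-s₂ : Level s₂ 2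
      at-w  : ∀ j {ℓ} → ℓ ≡ 3 + toℕ j → Level (w j) ℓ

    level : ∀ u → Level u (pos u)
    level v     = at-v
    level t₁    = at-t₁
    level t₂    = at-t₂
    level s₁    = at-s₁
    level s₂    = at-s₂
    level (w j) = at-w j refl

    Listed : Fin (6 + r) → Fin (6 + r) → Fin (6 + r) → Set
    Listed a b c = ∃ λ i → tset a b c ≡ half i

    t-listed : ∀ c → Tri twoTwins t₁ t₂ c → Listed t₁ t₂ c
    t-listed v     t = contradiction t (twins-next {t₁} {t₂} {v} (λ ()) refl refl)
    t-listed t₁    t = contradiction refl (proj₁ (proj₂ (tri-distinct twoTwins {t₁} {t₂} {t₁} t)))
    t-listed t₂    t = contradiction refl (proj₂ (proj₂ (tri-distinct twoTwins {t₁} {t₂} {t₂} t)))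
    t-listed s₁    t = contradiction t (twins-next {t₁} {t₂} {s₁} (λ ()) refl refl)
    t-listed s₂    t = contradiction t (twins-next {t₁} {t₂} {s₂} (λ ()) refl refl)
    t-listed (w j) t = inj₁ j , refl

    s-listed : ∀ c → Tri twoTwins s₁ s₂ c → Listed s₁ s₂ c
    s-listed v           t = inj₂ zero , refl
    s-listed t₁          t = contradiction t (twins-next {s₁} {s₂} {t₁} (λ ()) refl refl)
    s-listed t₂          t = contradiction t (twins-next {s₁} {s₂} {t₂} (λ ()) refl refl)
    s-listed s₁          t = contradiction refl (proj₁ (proj₂ (tri-distinct twoTwins {s₁} {s₂} {s₁} t)))
    s-listed s₂          t = contradiction refl (proj₂ (proj₂ (tri-distinct twoTwins {s₁} {s₂} {s₂} t)))
    s-listed (w zero)    t = contradiction t (twins-next {s₁} {s₂} {w zero} (λ ()) refl refl)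
    s-listed (w (suc j)) t = inj₂ (suc j) , refl

    swap-listed : ∀ {a b c} → Listed b a c → Listed a b c
    swap-listed (i , e) = i , trans (tset-≡ (2nd refl) (1st refl) (3rd refl) (2nd refl) (1st refl) (3rd refl)) e

    rot-listed : ∀ {a b c} → Listed b c a → Listed a b c
    rot-listed (i , e) = i , trans (tset-≡ (3rd refl) (1st refl) (2nd refl) (2nd refl) (3rd refl) (1st refl)) e

    twins-listed : ∀ {a b ℓ} → Level a ℓ → Level b ℓ → ∀ c → Tri twoTwins a b c → Listed a b c
    twins-listed at-t₁ at-t₂ c t = t-listed c t
    twins-listed at-t₂ at-t₁ c t = swap-listed {t₂} {t₁} {c} (t-listed c (tri-swap twoTwins {t₂} {t₁} {c} t))
    twins-listed at-s₁ at-s₂ c t = s-listed c t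
    twins-listed at-s₂ at-s₁ c t = swap-listed {s₂} {s₁} {c} (s-listed c (tri-swap twoTwins {s₂} {s₁} {c} t))
    twins-listed at-v  at-v  c t = contradiction refl (proj₁ (tri-distinct twoTwins {v} {v} {c} t))
    twins-listed at-t₁ at-t₁ c t = contradiction refl (proj₁ (tri-distinct twoTwins {t₁} {t₁} {c} t))
    twins-listed at-t₂ at-t₂ c t = contradiction refl (proj₁ (tri-distinct twoTwins {t₂} {t₂} {c} t))
    twins-listed at-s₁ at-s₁ c t = contradiction refl (proj₁ (tri-distinct twoTwins {s₁} {s₁} {c} t))
    twins-listed at-s₂ at-s₂ c t = contradiction refl (proj₁ (tri-distinct twoTwins {s₂} {s₂} {c} t))
    twins-listed (at-w i e) (at-w j e′) c t =
      contradiction (cong (λ j → w j) (Fin.toℕ-injective (ℕ.+-cancelˡ-≡ 3 _ _ (trans (sym e) e′)))) (proj₁ (tri-distinct twoTwins {w i} {w j} {c} t))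
    twins-listed at-v  (at-w _ ())
    twins-listed at-t₁ (at-w _ ())
    twins-listed at-t₂ (at-w _ ())
    twins-listed at-s₁ (at-w _ ())
    twins-listed at-s₂ (at-w _ ())
    twins-listed (at-w _ ()) at-v
    twins-listed (at-w _ ()) at-t₁
    twins-listed (at-w _ ()) at-t₂
    twins-listed (at-w _ ()) at-s₁
    twins-listed (at-w _ ()) at-s₂

    -- Points on three different levels are collinear, so a triangle contains two points of one
    -- level, and these are a pair of twins.
    all-listed : ∀ a b c → Tri twoTwins a b c → Listed a b c
    all-listed a b c t with pos a ℕ.≟ pos b | pos a ℕ.≟ pos c | pos b ℕ.≟ pos c
    ... | yes e | _     | _     = twins-listed (level a) (subst (Level b) (sym e) (level b)) c t
    ... | no _  | _     | yes e =
      rot-listed {a} {b} {c} (twins-listed (level b) (subst (Level c) (sym e) (level c)) a (tri-rot twoTwins {a} {b} {c} t))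
    ... | no _  | yes e | _     =
      rot-listed {a} {b} {c} (rot-listed {b} {c} {a} (twins-listed (subst (Level c) (sym e) (level c)) (level a) b (tri-rot twoTwins {b} {c} {a} (tri-rot twoTwins {a} {b} {c} t))))
    ... | no p  | no q  | no r  = contradiction t (different-levels {a} {b} {c} p q r)

    twoTwins-τ : τ twoTwins + 0 ≡ suc r + suc r
    twoTwins-τ = partition-length {f = half ∘ splitAt (suc r)} injective {bs = []} (triangles-unique twoTwins) []
      (listed ∘ ∈-triangles⁻ twoTwins) (λ _ ()) (λ j → inj₁ (∈-triangles⁺ twoTwins (half-triangle (splitAt (suc r) j))))
      where
      injective : ∀ {i j} → half (splitAt (suc r) i) ≡ half (splitAt (suc r) j) → i ≡ j
      injective {i} {j} e = trans (sym (Fin.join-splitAt (suc r) (suc r) i))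
        (trans (cong (Data.Fin.join (suc r) (suc r)) (half-injective {splitAt (suc r) i} {splitAt (suc r) j} e)) (Fin.join-splitAt (suc r) (suc r) j))
      listed : ∀ {p} → Triangle twoTwins p → ∃ λ j → p ≡ half (splitAt (suc r) j)
      listed tr = from (triangle⇒tri twoTwins tr)
        where
        from : ∀ {p} → (∃ λ a → ∃ λ b → ∃ λ c → p ≡ tset a b c × Tri twoTwins a b c) → ∃ λ j →
          p ≡ half (splitAt (suc r) j)
        from (a , b , c , refl , t) with all-listed a b c t
        ... | i , e =
          Data.Fin.join (suc r) (suc r) i , trans e (cong half (sym (Fin.splitAt-join (suc r) (suc r) i)))

    -- The triangles `t₁ t₂ (w zero)` and `s₁ s₂ v` are disjoint, so a kernel would have to be
    -- empty.
    twoTwins-notTight : ¬ (∃ λ K → IsKernel (ℋ twoTwins) K × ∣ K ∣ ≡ 2)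
    twoTwins-notTight (K , kernel , ∣K∣≡2) = nonempty (elements K) ∈-elements⁻ (trans (length-elements K) ∣K∣≡2)
      where
      E F : Subset (6 + r)
      E = half (inj₁ zero)
      F = half (inj₂ zero)
      disjoint : ∀ {u} → OneOf u t₁ t₂ (w zero) → ¬ OneOf u s₁ s₂ v
      disjoint (1st refl) (1st ())
      disjoint (1st refl) (2nd ())
      disjoint (1st refl) (3rd ())
      disjoint (2nd refl) (1st ())
      disjoint (2nd refl) (2nd ())
      disjoint (2nd refl) (3rd ())
      disjoint (3rd refl) (1st ())
      disjoint (3rd refl) (2nd ())
      disjoint (3rd refl) (3rd ())
      K⊆E∩F : ∀ {u} → u ∈ˢ K → u ∈ˢ E × u ∈ˢ F
      K⊆E∩F {u} u∈ = Subset.x∈p∩q⁻ E F (subst (u ∈ˢ_)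
        (sym (kernel E F (half-triangle (inj₁ zero)) (half-triangle (inj₂ zero)) λ e → contradiction (half-injective {inj₁ zero} {inj₂ zero} e) λ ())) u∈)
      nonempty : (us : List (Fin (6 + r))) → (∀ {u} → u ∈ us → u ∈ˢ K) → length us ≡ 2 → ⊥
      nonempty (u ∷ _) us⊆K _ = disjoint (∈-tset⁻ {a = t₁} {t₂} {w zero} (proj₁ (K⊆E∩F (us⊆K (here refl)))))
                                         (∈-tset⁻ {a = s₁} {s₂} {v} (proj₂ (K⊆E∩F (us⊆K (here refl)))))

-- From normal forms to the families

module Families where

  open Triangles
  open Forms
  open TwoHubs
  open Hubs
  open ShortestPaths
  open FamilyGraphs
  open LevelStructures
  open import Data.Integer using (+_)
  open import Data.Nat using (_+_; _∸_; _≤_; _<_; ⌈_/2⌉; ⌊_/2⌋)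

  open BetweennessStructure
  open _≅_

  module _ {m : ℕ} (p q : Fin m) (a b : Middle) where

    mid₂-first : mid₂ p q a b p ≡ a
    mid₂-first with p Fin.≟ p | p Fin.≟ q
    ... | yes _ | _ = refl
    ... | no ne | _ = contradiction refl ne

    mid₂-second : q ≢ p → mid₂ p q a b q ≡ b
    mid₂-second q≢p with q Fin.≟ p | q Fin.≟ q
    ... | yes e | _     = contradiction e q≢p
    ... | no _  | yes _ = refl
    ... | no _  | no ne = contradiction refl ne

    mid₂-other : ∀ {j} → j ≢ p → j ≢ q → mid₂ p q a b j ≡ missing
    mid₂-other {j} j≢p j≢q with j Fin.≟ p | j Fin.≟ q
    ... | yes e | _     = contradiction e j≢p
    ... | no _  | yes e = contradiction e j≢q
    ... | no _  | no _  = refl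

  module _ {k : ℕ} where

    form-≅ : ∀ {𝓐 𝓑 : BetweennessStructure (3 + k)} {by bz mid} → 𝓐 ≅ 𝓑 → Form 𝓑 by bz mid → Form 𝓐 by bz mid
    form-≅ {𝓐} {𝓑} iso F = record
      { σ = Form.σ F Perm.∘ₚ Perm.flip (bijection iso)
      ; sound =
        λ s → Equivalence.from (preserves iso _ _ _) (β-subst (sym (back _)) (sym (back _)) (sym (back _)) (Form.sound F s))
      ; complete =
        λ b → Form.complete F (β-subst (back _) (back _) (back _) (Equivalence.to (preserves iso _ _ _) b))
      }
      where
      back : ∀ v → bijection iso ⟨$⟩ʳ (bijection iso ⟨$⟩ˡ v) ≡ v
      back v = Perm.inverseʳ (bijection iso)
      β-subst : ∀ {a a′ b b′ c c′} → a ≡ a′ → b ≡ b′ → c ≡ c′ → β 𝓑 a b c → β 𝓑 a′ b′ c′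
      β-subst refl refl refl p = p

    -- Reversal exchanges the two neighbours of the cut. With equal labels it identifies `i` with
    -- `opposite i`, hence the halved range of `I²` and `I⁴`. With a single label it moves this
    -- label to the other side, so one orientation with the full range `I³` suffices.
    form-R-reverse : ∀ {𝓑} (i : Fin k) {a b} → Form 𝓑 (suc (toℕ i)) (suc (toℕ i)) (mid₂ (inject₁ i) (suc i) a b) →
      Form 𝓑 (suc (toℕ (opposite i))) (suc (toℕ (opposite i))) (mid₂ (inject₁ (opposite i)) (suc (opposite i)) b a)
    form-R-reverse {𝓑} i {a} {b} F = form-cong (mid₂-≗ at-left at-right other)
      (subst (λ c → Form 𝓑 c c (mid ∘ opposite)) cut (form-reverse (s≤s (ℕ.<⇒≤ (Fin.toℕ<n i))) (s≤s (ℕ.<⇒≤ (Fin.toℕ<n i))) F))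
      where
      mid : Fin (suc k) → Middle
      mid = mid₂ (inject₁ i) (suc i) a b
      cut : k ∸ toℕ i ≡ suc (toℕ (opposite i))
      cut = trans (ℕ.+-∸-assoc 1 (Fin.toℕ<n i)) (cong suc (sym (Fin.opposite-prop i)))
      op-suc : opposite (suc (opposite i)) ≡ inject₁ i
      op-suc = cong inject₁ (Fin.opposite-involutive i)
      op-inject₁ : opposite (inject₁ (opposite i)) ≡ suc i
      op-inject₁ =
        Fin.toℕ-injective (trans (Fin.opposite-prop (inject₁ (opposite i))) (trans (cong (k ∸_) (Fin.toℕ-inject₁ (opposite i)))
        (trans (cong (k ∸_) (Fin.opposite-prop i)) (ℕ.m∸[m∸n]≡n (Fin.toℕ<n i)))))
      left≢right : suc i ≢ inject₁ i
      left≢right e = ℕ.1+n≢n (trans (cong toℕ e) (Fin.toℕ-inject₁ i))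
      at-left : mid (opposite (inject₁ (opposite i))) ≡ b
      at-left = trans (cong mid op-inject₁) (mid₂-second (inject₁ i) (suc i) a b left≢right)
      at-right : suc (opposite i) ≢ inject₁ (opposite i) → mid (opposite (suc (opposite i))) ≡ a
      at-right _ = trans (cong mid op-suc) (mid₂-first (inject₁ i) (suc i) a b)
      other : ∀ j → j ≢ inject₁ (opposite i) → j ≢ suc (opposite i) → mid (opposite j) ≡ missing
      other j j≢l j≢r =
        mid₂-other (inject₁ i) (suc i) a b (λ e → j≢r (back j (suc (opposite i)) (trans e (sym op-suc))))
        (λ e → j≢l (back j (inject₁ (opposite i)) (trans e (sym op-inject₁))))
        where
        back : ∀ (i j : Fin (suc k)) → opposite i ≡ opposite j → i ≡ j
        back i j e = trans (sym (Fin.opposite-involutive i)) (trans (cong opposite e) (Fin.opposite-involutive j))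

    -- Reversal puts `y` behind the path and `z` in front of it. Exchanging their names restores the
    -- cuts `0` and `suc k`, and `ofʸ` at one end becomes `ofᶻ` at the other.
    form-S-reverse : ∀ {𝓑} → 0 < k → ∀ {a b} → Form 𝓑 0 (suc k) (mid₂ zero (fromℕ k) a b) →
                     Form 𝓑 0 (suc k) (mid₂ zero (fromℕ k) (swapʸᶻ b) (swapʸᶻ a))
    form-S-reverse {𝓑} 0<k {a} {b} F = form-cong (mid₂-≗ at-first at-last other)
      (subst (λ c → Form 𝓑 c (suc k) (swapʸᶻ ∘ mid ∘ opposite)) (ℕ.n∸n≡0 (suc k)) (form-reverse ℕ.≤-refl z≤n (form-exchange F)))
      where
      mid : Fin (suc k) → Middle
      mid = mid₂ zero (fromℕ k) a b
      op-last : opposite (fromℕ k) ≡ zero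
      op-last =
        Fin.toℕ-injective (trans (Fin.opposite-prop (fromℕ k)) (trans (cong (k ∸_) (Fin.toℕ-fromℕ k)) (ℕ.n∸n≡0 k)))
      last≢0 : fromℕ k ≢ zero
      last≢0 e = ℕ.<⇒≢ 0<k (trans (cong toℕ (sym e)) (Fin.toℕ-fromℕ k))
      at-first : swapʸᶻ (mid (opposite zero)) ≡ swapʸᶻ b
      at-first = cong swapʸᶻ (mid₂-second zero (fromℕ k) a b last≢0)
      at-last : fromℕ k ≢ zero → swapʸᶻ (mid (opposite (fromℕ k))) ≡ swapʸᶻ a
      at-last _ = cong swapʸᶻ (trans (cong mid op-last) (mid₂-first zero (fromℕ k) a b))
      other : ∀ j → j ≢ zero → j ≢ fromℕ k → swapʸᶻ (mid (opposite j)) ≡ missing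
      other j j≢0 j≢k =
        cong swapʸᶻ (mid₂-other zero (fromℕ k) a b (λ e → j≢k (trans (sym (Fin.opposite-involutive j)) (cong opposite e)))
                                                (λ e → j≢0 (trans (sym (Fin.opposite-involutive j)) (trans (cong opposite e) op-last))))

    lower-half : ∀ (P : Fin k → Set) → (∀ i → P i → P (opposite i)) → ∀ i → P i → ∃ λ i →
      suc (toℕ i) ≤ ⌈ k /2⌉ × P i
    lower-half P reverse i p with ℕ.≤-<-connex (suc (toℕ i)) ⌈ k /2⌉
    ... | inj₁ i<h = i , i<h , p
    ... | inj₂ h≤i = opposite i , opposite<h , reverse i p
      where
      open ℕ.≤-Reasoning
      opposite<h : suc (toℕ (opposite i)) ≤ ⌈ k /2⌉
      opposite<h = begin
        suc (toℕ (opposite i))              ≡⟨ cong suc (Fin.opposite-prop i) ⟩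
        suc (k ∸ suc (toℕ i))               ≡⟨ sym (ℕ.+-∸-assoc 1 (Fin.toℕ<n i)) ⟩
        k ∸ toℕ i                           ≤⟨ ℕ.∸-monoʳ-≤ k (ℕ.≤-pred h≤i) ⟩
        k ∸ ⌈ k /2⌉                         ≡⟨ cong (_∸ ⌈ k /2⌉) (sym (ℕ.⌊n/2⌋+⌈n/2⌉≡n k)) ⟩
        ⌊ k /2⌋ + ⌈ k /2⌉ ∸ ⌈ k /2⌉         ≡⟨ ℕ.m+n∸n≡m ⌊ k /2⌋ ⌈ k /2⌉ ⟩
        ⌊ k /2⌋                             ≤⟨ ℕ.⌊n/2⌋≤⌈n/2⌉ k ⟩
        ⌈ k /2⌉                             ∎

  module _ {n : ℕ} (𝓑 : BetweennessStructure n) where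

    Family⁴ Family³ Family² : Set
    Family⁴ = (∃₂ λ n≥5 i → 𝓑 ≅ 𝓡⁴ n n≥5 i) ⊎ (∃ λ n≥5 → 𝓑 ≅ 𝓢⁴ n n≥5)
    Family³ = (∃ λ n≥4 → 𝓑 ≅ 𝓠³ n n≥4) ⊎ (∃₂ λ n≥4 i → 𝓑 ≅ 𝓡³ n n≥4 i) ⊎ (∃ λ n≥4 → 𝓑 ≅ 𝓢³ n n≥4)
    Family² = (∃ λ n≥3 → 𝓑 ≅ 𝓠² n n≥3) ⊎ (∃₂ λ n≥4 i → 𝓑 ≅ 𝓡² n n≥4 i) ⊎ (∃ λ n≥3 → 𝓑 ≅ 𝓢² n n≥3)

  private
    -- Forms count from the `k + 1 = n - 2` candidates, so `d` collinear ones mean `n - τ = 2 + d`.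
    +3+ : ∀ {t k} d → t + d ≡ suc k → t + (2 + d) ≡ 3 + k
    +3+ {t} d e = trans (ℕ.+-suc t (suc d)) (cong suc (trans (ℕ.+-suc t d) (cong suc e)))

  𝓡⁴-form : ∀ {k} n≥5 i →
    Form (𝓡⁴ (3 + k) n≥5 i) (suc (toℕ (index² i))) (suc (toℕ (index² i))) (mid₂ (inject₁ (index² i)) (suc (index² i)) ofˣ ofˣ)
  𝓡⁴-form (s≤s (s≤s (s≤s _))) i = R⁴-form (index² i)

  𝓡³-form : ∀ {k} n≥4 i →
    Form (𝓡³ (3 + k) n≥4 i) (suc (toℕ (index³ i))) (suc (toℕ (index³ i))) (mid₂ (inject₁ (index³ i)) (suc (index³ i)) ofˣ missing)
  𝓡³-form (s≤s (s≤s (s≤s _))) i = R³-form (index³ i)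

  𝓡²-form : ∀ {k} n≥4 i →
    Form (𝓡² (3 + k) n≥4 i) (suc (toℕ (index² i))) (suc (toℕ (index² i))) (mid₂ (inject₁ (index² i)) (suc (index² i)) missing missing)
  𝓡²-form (s≤s (s≤s (s≤s _))) i = R²-form (index² i)

  𝓠³-form : ∀ {k} n≥4 → Form (𝓠³ (3 + k) n≥4) 0 0 (mid₂ zero zero ofˣ missing)
  𝓠³-form {k} (s≤s (s≤s (s≤s _))) = Q³-form k

  𝓠²-form : ∀ {k} n≥3 → Form (𝓠² (3 + k) n≥3) 0 0 (mid₂ zero zero missing missing)
  𝓠²-form {k} (s≤s (s≤s (s≤s _))) = Q²-form k

  𝓢⁴-form : ∀ {k} n≥5 → Form (𝓢⁴ (4 + k) n≥5) 0 (2 + k) (mid₂ zero (fromℕ (suc k)) ofʸ ofᶻ)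
  𝓢⁴-form {k} (s≤s (s≤s (s≤s _))) = S⁴-form k

  𝓢³-form : ∀ {k} n≥4 → Form (𝓢³ (4 + k) n≥4) 0 (2 + k) (mid₂ zero (fromℕ (suc k)) ofʸ missing)
  𝓢³-form {k} (s≤s (s≤s (s≤s _))) = S³-form k

  𝓢²-form : ∀ {k} n≥3 → Form (𝓢² (4 + k) n≥3) 0 (2 + k) (mid₂ zero (fromℕ (suc k)) missing missing)
  𝓢²-form {k} (s≤s (s≤s (s≤s _))) = S²-form k

  Family⁴-τ : ∀ {n} {𝓑 : BetweennessStructure n} → Family⁴ 𝓑 → τ 𝓑 + 4 ≡ n
  Family⁴-τ {suc (suc (suc k))} {𝓑} (inj₁ (p , i , iso)) =
    +3+ {τ 𝓑} 2 (classR-τ (index² i) true true (form-≅ iso (𝓡⁴-form p i)))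
  Family⁴-τ {suc (suc (suc (suc k)))} {𝓑} (inj₂ (p , iso)) =
    +3+ {τ 𝓑} 2 (classS-τ (s≤s z≤n) true true (form-≅ iso (𝓢⁴-form p)))
  Family⁴-τ {suc (suc (suc zero))} (inj₂ (s≤s (s≤s (s≤s ())) , _))
  Family⁴-τ {suc (suc zero)} (inj₁ (s≤s (s≤s ()) , _))
  Family⁴-τ {suc (suc zero)} (inj₂ (s≤s (s≤s ()) , _))
  Family⁴-τ {suc zero} (inj₁ (s≤s () , _))
  Family⁴-τ {suc zero} (inj₂ (s≤s () , _))

  Family³-τ : ∀ {n} {𝓑 : BetweennessStructure n} → 4 ≤ n → Family³ 𝓑 → τ 𝓑 + 3 ≡ n
  Family³-τ {suc (suc (suc k))} {𝓑} _ (inj₁ (p , iso)) =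
    +3+ {τ 𝓑} 1 (classQ-τ true (form-≅ iso (𝓠³-form p)))
  Family³-τ {suc (suc (suc k))} {𝓑} _ (inj₂ (inj₁ (p , i , iso))) =
    +3+ {τ 𝓑} 1 (classR-τ (index³ i) true false (form-≅ iso (𝓡³-form p i)))
  Family³-τ {suc (suc (suc (suc k)))} {𝓑} _ (inj₂ (inj₂ (p , iso))) =
    +3+ {τ 𝓑} 1 (classS-τ (s≤s z≤n) true false (form-≅ iso (𝓢³-form p)))
  Family³-τ {suc (suc (suc zero))} (s≤s (s≤s (s≤s ())))
  Family³-τ {suc (suc zero)} (s≤s (s≤s ()))
  Family³-τ {suc zero} (s≤s ())

  Family²-τ : ∀ {n} {𝓑 : BetweennessStructure n} → 4 ≤ n → Family² 𝓑 → τ 𝓑 + 2 ≡ n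
  Family²-τ {suc (suc (suc k))} {𝓑} _ (inj₁ (p , iso)) =
    +3+ {τ 𝓑} 0 (classQ-τ false (form-≅ iso (𝓠²-form p)))
  Family²-τ {suc (suc (suc k))} {𝓑} _ (inj₂ (inj₁ (p , i , iso))) =
    +3+ {τ 𝓑} 0 (classR-τ (index² i) false false (form-≅ iso (𝓡²-form p i)))
  Family²-τ {suc (suc (suc (suc k)))} {𝓑} _ (inj₂ (inj₂ (p , iso))) =
    +3+ {τ 𝓑} 0 (classS-τ (s≤s z≤n) false false (form-≅ iso (𝓢²-form p)))
  Family²-τ {suc (suc (suc zero))} (s≤s (s≤s (s≤s ())))
  Family²-τ {suc (suc zero)} (s≤s (s≤s ()))
  Family²-τ {suc zero} (s≤s ())

  module _ {k : ℕ} (𝓑 : BetweennessStructure (3 + k)) (3≤k : 3 ≤ k) where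

    private
      RForm : Middle → Middle → Fin k → Set
      RForm a b i = Form 𝓑 (suc (toℕ i)) (suc (toℕ i)) (mid₂ (inject₁ i) (suc i) a b)

      n≥5 : 5 ≤ 3 + k
      n≥5 = s≤s (s≤s (s≤s (ℕ.≤-trans (s≤s (s≤s z≤n)) 3≤k)))
      n≥4 : 4 ≤ 3 + k
      n≥4 = s≤s (s≤s (s≤s (ℕ.≤-trans (s≤s z≤n) 3≤k)))

      half-index : (i : Fin k) → suc (toℕ i) ≤ ⌈ k /2⌉ → ∃ λ (j : I² (3 + k)) → index² j ≡ i
      half-index i i<h = (suc (toℕ i) , s≤s z≤n , i<h) , Fin.fromℕ<-toℕ i _

      full-index : (i : Fin k) → ∃ λ (j : I³ (3 + k)) → index³ j ≡ i
      full-index i = (suc (toℕ i) , s≤s z≤n , Fin.toℕ<n i) , Fin.fromℕ<-toℕ i _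

    toR⁴ : ∀ {i} → RForm ofˣ ofˣ i → Family⁴ 𝓑
    toR⁴ {i} F with lower-half (RForm ofˣ ofˣ) (λ i → form-R-reverse i) i F
    ... | i , i<h , F with half-index i i<h
    ...   | j , refl = inj₁ (n≥5 , j , form⇒≅ F (𝓡⁴-form n≥5 j))

    toR² : ∀ {i} → RForm missing missing i → Family² 𝓑
    toR² {i} F with lower-half (RForm missing missing) (λ i → form-R-reverse i) i F
    ... | i , i<h , F with half-index i i<h
    ...   | j , refl = inj₂ (inj₁ (n≥4 , j , form⇒≅ F (𝓡²-form n≥4 j)))

    toR³ : ∀ {i} → RForm ofˣ missing i → Family³ 𝓑
    toR³ {i} F with full-index i
    ... | j , refl = inj₂ (inj₁ (n≥4 , j , form⇒≅ F (𝓡³-form n≥4 j)))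

  toS⁴ : ∀ {k} (𝓑 : BetweennessStructure (3 + k)) → 3 ≤ k →
    Form 𝓑 0 (suc k) (mid₂ zero (fromℕ k) ofʸ ofᶻ) → Family⁴ 𝓑
  toS⁴ {suc k} 𝓑 (s≤s 2≤k) F = inj₂ (n≥5 , form⇒≅ F (𝓢⁴-form n≥5))
    where
    n≥5 : 5 ≤ 4 + k
    n≥5 = s≤s (s≤s (s≤s (s≤s (ℕ.≤-trans (s≤s z≤n) 2≤k))))

  toS³ : ∀ {k} (𝓑 : BetweennessStructure (3 + k)) → 3 ≤ k →
    Form 𝓑 0 (suc k) (mid₂ zero (fromℕ k) ofʸ missing) → Family³ 𝓑
  toS³ {suc k} 𝓑 (s≤s 2≤k) F = inj₂ (inj₂ (n≥4 , form⇒≅ F (𝓢³-form n≥4)))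
    where
    n≥4 : 4 ≤ 4 + k
    n≥4 = ℕ.m≤m+n 4 k

  toS² : ∀ {k} (𝓑 : BetweennessStructure (3 + k)) → 3 ≤ k →
    Form 𝓑 0 (suc k) (mid₂ zero (fromℕ k) missing missing) → Family² 𝓑
  toS² {suc k} 𝓑 (s≤s 2≤k) F = inj₂ (inj₂ (n≥3 , form⇒≅ F (𝓢²-form n≥3)))
    where
    n≥3 : 3 ≤ 4 + k
    n≥3 = ℕ.m≤m+n 3 (suc k)

  Classified : ∀ {n} → BetweennessStructure n → Set
  Classified {n} 𝓑 = (Family⁴ 𝓑 × τ 𝓑 + 4 ≡ n) ⊎ (Family³ 𝓑 × τ 𝓑 + 3 ≡ n) ⊎ (Family² 𝓑 × τ 𝓑 + 2 ≡ n)

  class⇒family : ∀ {k} (𝓑 : BetweennessStructure (3 + k)) → 3 ≤ k → Class 𝓑 → Classified 𝓑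
  class⇒family {k} 𝓑 3≤k = go
    where
    n≥4 : 4 ≤ 3 + k
    n≥4 = s≤s (s≤s (s≤s (ℕ.≤-trans (s≤s z≤n) 3≤k)))
    n≥3 : 3 ≤ 3 + k
    n≥3 = ℕ.m≤m+n 3 k
    fam⁴ : Family⁴ 𝓑 → Classified 𝓑
    fam⁴ f = 1st (f , Family⁴-τ f)
    fam³ : Family³ 𝓑 → Classified 𝓑
    fam³ f = 2nd (f , Family³-τ n≥4 f)
    fam² : Family² 𝓑 → Classified 𝓑
    fam² f = 3rd (f , Family²-τ n≥4 f)
    go : Class 𝓑 → Classified 𝓑
    go (classQ true  F)         = fam³ (inj₁ (n≥4 , form⇒≅ F (𝓠³-form n≥4)))
    go (classQ false F)         = fam² (inj₁ (n≥3 , form⇒≅ F (𝓠²-form n≥3)))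
    go (classR i true  true  F) = fam⁴ (toR⁴ 𝓑 3≤k {i} F)
    go (classR i true  false F) = fam³ (toR³ 𝓑 3≤k {i} F)
    go (classR i false true  F) = fam³ (toR³ 𝓑 3≤k {opposite i} (form-R-reverse i F))
    go (classR i false false F) = fam² (toR² 𝓑 3≤k {i} F)
    go (classS true  true  F)   = fam⁴ (toS⁴ 𝓑 3≤k F)
    go (classS true  false F)   = fam³ (toS³ 𝓑 3≤k F)
    go (classS false true  F)   = fam³ (toS³ 𝓑 3≤k (form-S-reverse (ℕ.≤-trans (s≤s z≤n) 3≤k) F))
    go (classS false false F)   = fam² (toS² 𝓑 3≤k F)

  classification : ∀ {n} (𝓑 : BetweennessStructure n) → 6 ≤ n → FewTriangles 𝓑 → τ 𝓑 ≡ 0 ⊎ Classified 𝓑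
  classification {suc (suc (suc k))} 𝓑 (s≤s (s≤s (s≤s 3≤k))) few =
    go (few-triangles (suc k) (s≤s 3≤k) 𝓑 few) (τ 𝓑 ℕ.≟ 0)
    where
    go : NoTri 𝓑 ⊎ Star 𝓑 → Dec (τ 𝓑 ≡ 0) → τ 𝓑 ≡ 0 ⊎ Classified 𝓑
    go (inj₁ linear) _ = inj₁ (noTri⇒τ≡0 𝓑 linear)
    go (inj₂ _) (yes τ≡0) = inj₁ τ≡0
    go (inj₂ (y , z , y≢z , y-hub , z-hub)) (no τ≢0) =
      inj₂ (class⇒family 𝓑 3≤k (hubs-class 𝓑 3≤k y≢z y-hub z-hub (proj₂ (proj₂ (proj₂ (τ≢0⇒tri 𝓑 τ≢0))))))

-- Integer co-sizes and the four parts of the theorem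

open Triangles
open Forms
open TwoHubs
open Hubs
open LevelStructures
open Families
open import Data.Integer using (ℤ; +_; -[1+_]; _-_; +≤+; +<+; _≤_; _<_; _≥_; _>_)
open import Data.Nat using (_+_)

+t≡n-d⇒t+d≡n : ∀ {t n d} → + t ≡ + n - + d → t + d ≡ n
+t≡n-d⇒t+d≡n {t} {n} {d} e = ℤ.+-injective (begin
  + t ℤ.+ + d              ≡⟨ cong (ℤ._+ + d) e ⟩
  + n - + d ℤ.+ + d        ≡⟨ ℤ.+-assoc (+ n) (ℤ.- + d) (+ d) ⟩
  + n ℤ.+ (ℤ.- + d ℤ.+ + d) ≡⟨ cong (λ i → + n ℤ.+ i) (ℤ.+-inverseˡ (+ d)) ⟩
  + n ℤ.+ + 0              ≡⟨ ℤ.+-identityʳ (+ n) ⟩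
  + n                      ∎)
  where open ≡-Reasoning

t+d≡n⇒+t≡n-d : ∀ {t n d} → t + d ≡ n → + t ≡ + n - + d
t+d≡n⇒+t≡n-d {t} {n} {d} refl = sym (begin
  + t ℤ.+ + d - + d           ≡⟨ ℤ.+-assoc (+ t) (+ d) (ℤ.- + d) ⟩
  + t ℤ.+ (+ d - + d)         ≡⟨ cong (λ i → + t ℤ.+ i) (ℤ.+-inverseʳ (+ d)) ⟩
  + t ℤ.+ + 0                 ≡⟨ ℤ.+-identityʳ (+ t) ⟩
  + t                         ∎)
  where open ≡-Reasoning

+n≥m-d⇒m≤n+d : ∀ {m n d} → + n ≥ + m - + d → m ℕ.≤ n + d
+n≥m-d⇒m≤n+d {m} {n} {d} h = ℤ.drop‿+≤+ (subst (_≤ + n ℤ.+ + d) eq (ℤ.+-monoˡ-≤ (+ d) h))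
  where
  eq : + m - + d ℤ.+ + d ≡ + m
  eq =
    trans (ℤ.+-assoc (+ m) (ℤ.- + d) (+ d)) (trans (cong (λ i → + m ℤ.+ i) (ℤ.+-inverseˡ (+ d))) (ℤ.+-identityʳ (+ m)))

module _ {n : ℕ} (𝓑 : BetweennessStructure n) where

  hasCoSize⇒τ : ∀ d → HasCoSize 𝓑 (+ n - + d) → τ 𝓑 + d ≡ n
  hasCoSize⇒τ d e = subst (λ t → t + d ≡ n) (coSize≡∣triangles∣ 𝓑) (+t≡n-d⇒t+d≡n {d = d} e)

  τ⇒hasCoSize : ∀ d → τ 𝓑 + d ≡ n → HasCoSize 𝓑 (+ n - + d)
  τ⇒hasCoSize d e = t+d≡n⇒+t≡n-d {d = d} (trans (cong (_+ d) (coSize≡∣triangles∣ 𝓑)) e)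

  hasCoSize-n⇔linear : HasCoSize 𝓑 (+ n - + n) ⇔ Linear 𝓑
  hasCoSize-n⇔linear =
    mk⇔ (λ e → ℤ.+-injective (trans e (ℤ.+-inverseʳ (+ n)))) (λ e → trans (cong ℤ.+_ e) (sym (ℤ.+-inverseʳ (+ n))))

  -- A structure within the bound that has a triangle satisfies `n - τ ≥ 2`, by the classification;
  -- a linear one would have `n ≤ 1`.
  ¬between-bounds : 10 ℕ.≤ n → FewTriangles 𝓑 → ¬ n ℕ.≤ τ 𝓑 + 1
  ¬between-bounds 10≤n few n≤τ+1 = go (classification 𝓑 (ℕ.≤-trans (ℕ.m≤m+n 6 4) 10≤n) few)
    where
    clash : ∀ d → τ 𝓑 + (2 + d) ≡ n → ⊥
    clash d e = ℕ.<⇒≱ (ℕ.+-monoʳ-< (τ 𝓑) (s≤s (s≤s z≤n))) (subst (ℕ._≤ τ 𝓑 + 1) (sym e) n≤τ+1)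
    go : τ 𝓑 ≡ 0 ⊎ Classified 𝓑 → ⊥
    go (inj₁ e) = contradiction (ℕ.≤-trans 10≤n (subst (λ t → n ℕ.≤ t + 1) e n≤τ+1)) λ { (s≤s ()) }
    go (inj₂ (1st (_ , e))) = clash 2 e
    go (inj₂ (2nd (_ , e))) = clash 1 e
    go (inj₂ (3rd (_ , e))) = clash 0 e

  -- For `n ≢ d` there is a triangle, so `n ≥ 6`. Then `τ ≤ n - 5` is within the bound, and the
  -- classification gives `n - τ ≤ 4`.
  ¬below-n-4 : ∀ d → 5 ℕ.≤ d → τ 𝓑 + d ≡ n → n ≢ d → ⊥
  ¬below-n-4 d 5≤d e n≢d = go (classification 𝓑 6≤n few)
    where
    τ≢0 : τ 𝓑 ≢ 0
    τ≢0 z = n≢d (trans (sym e) (cong (_+ d) z))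
    6≤n : 6 ℕ.≤ n
    6≤n = subst (6 ℕ.≤_) e (ℕ.+-mono-≤ (ℕ.n≢0⇒n>0 τ≢0) 5≤d)
    few : FewTriangles 𝓑
    few =
      subst (ℕ._≤ n + n) (ℕ.+-assoc (τ 𝓑) 5 6) (ℕ.+-mono-≤ (subst (τ 𝓑 + 5 ℕ.≤_) e (ℕ.+-monoʳ-≤ (τ 𝓑) 5≤d)) 6≤n)
    clash : ∀ d′ → d′ ℕ.< 5 → τ 𝓑 + d′ ≡ n → ⊥
    clash d′ d′<5 e′ = ℕ.<⇒≢ (ℕ.<-≤-trans d′<5 5≤d) (ℕ.+-cancelˡ-≡ (τ 𝓑) d′ d (trans e′ (sym e)))
    go : τ 𝓑 ≡ 0 ⊎ Classified 𝓑 → ⊥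
    go (inj₁ z) = τ≢0 z
    go (inj₂ (1st (_ , e′))) = clash 4 (ℕ.m≤m+n 5 0) e′
    go (inj₂ (2nd (_ , e′))) = clash 3 (ℕ.m≤m+n 4 1) e′
    go (inj₂ (3rd (_ , e′))) = clash 2 (ℕ.m≤m+n 3 2) e′

  module _ (d : ℕ) (d≤4 : d ℕ.≤ 4) (11≤n+d : 11 ℕ.≤ n + d) where

    7≤n : 7 ℕ.≤ n
    7≤n = ℕ.+-cancelʳ-≤ 4 7 n (ℕ.≤-trans 11≤n+d (ℕ.+-monoʳ-≤ n d≤4))

    -- Adding `τ` to `11 ≤ n + d` gives the bound, because `τ + d` is `n`. The linear case is
    -- impossible, as it would mean `n ≡ d` with `n ≥ 7` and `d ≤ 4`.
    classified : τ 𝓑 + d ≡ n → Classified 𝓑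
    classified e = go (classification 𝓑 (ℕ.≤-trans (ℕ.n≤1+n 6) 7≤n) few)
      where
      few : FewTriangles 𝓑
      few =
        ℕ.≤-trans (ℕ.+-monoʳ-≤ (τ 𝓑) 11≤n+d) (ℕ.≤-reflexive (trans (cong (λ s → τ 𝓑 + s) (ℕ.+-comm n d)) (trans (sym (ℕ.+-assoc (τ 𝓑) d n)) (cong (_+ n) e))))
      go : τ 𝓑 ≡ 0 ⊎ Classified 𝓑 → Classified 𝓑
      go (inj₂ c) = c
      go (inj₁ z) =
        contradiction (ℕ.≤-trans 7≤n (subst (ℕ._≤ 4) (trans (cong (_+ d) (sym z)) e) d≤4)) λ { (s≤s (s≤s (s≤s (s≤s ())))) }

  coSize⇔Family⁴ : + n ≥ + 11 - + 4 → HasCoSize 𝓑 (+ n - + 4) ⇔ Family⁴ 𝓑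
  coSize⇔Family⁴ big =
    mk⇔ (λ h → pick (hasCoSize⇒τ 4 h) (classified 4 ℕ.≤-refl (+n≥m-d⇒m≤n+d {d = 4} big) (hasCoSize⇒τ 4 h))) (τ⇒hasCoSize 4 ∘ Family⁴-τ)
    where
    pick : τ 𝓑 + 4 ≡ n → Classified 𝓑 → Family⁴ 𝓑
    pick e (1st (f , _))  = f
    pick e (2nd (_ , e′)) = contradiction (ℕ.+-cancelˡ-≡ (τ 𝓑) 4 3 (trans e (sym e′))) λ ()
    pick e (3rd (_ , e′)) = contradiction (ℕ.+-cancelˡ-≡ (τ 𝓑) 4 2 (trans e (sym e′))) λ ()

  coSize⇔Family³ : + n ≥ + 11 - + 3 → HasCoSize 𝓑 (+ n - + 3) ⇔ Family³ 𝓑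
  coSize⇔Family³ big = mk⇔ (λ h → pick (hasCoSize⇒τ 3 h) (classified 3 (ℕ.n≤1+n 3) 11≤n+3 (hasCoSize⇒τ 3 h)))
    (τ⇒hasCoSize 3 ∘ Family³-τ (ℕ.≤-trans (ℕ.m≤m+n 4 3) (7≤n 3 (ℕ.n≤1+n 3) 11≤n+3)))
    where
    11≤n+3 = +n≥m-d⇒m≤n+d {d = 3} big
    pick : τ 𝓑 + 3 ≡ n → Classified 𝓑 → Family³ 𝓑
    pick e (1st (_ , e′)) = contradiction (ℕ.+-cancelˡ-≡ (τ 𝓑) 3 4 (trans e (sym e′))) λ ()
    pick e (2nd (f , _))  = f
    pick e (3rd (_ , e′)) = contradiction (ℕ.+-cancelˡ-≡ (τ 𝓑) 3 2 (trans e (sym e′))) λ ()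

  coSize⇔Family² : + n ≥ + 11 - + 2 → HasCoSize 𝓑 (+ n - + 2) ⇔ Family² 𝓑
  coSize⇔Family² big = mk⇔ (λ h → pick (hasCoSize⇒τ 2 h) (classified 2 (ℕ.m≤m+n 2 2) 11≤n+2 (hasCoSize⇒τ 2 h)))
    (τ⇒hasCoSize 2 ∘ Family²-τ (ℕ.≤-trans (ℕ.m≤m+n 4 3) (7≤n 2 (ℕ.m≤m+n 2 2) 11≤n+2)))
    where
    11≤n+2 = +n≥m-d⇒m≤n+d {d = 2} big
    pick : τ 𝓑 + 2 ≡ n → Classified 𝓑 → Family² 𝓑
    pick e (1st (_ , e′)) = contradiction (ℕ.+-cancelˡ-≡ (τ 𝓑) 2 4 (trans e (sym e′))) λ ()
    pick e (2nd (_ , e′)) = contradiction (ℕ.+-cancelˡ-≡ (τ 𝓑) 2 3 (trans e (sym e′))) λ ()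
    pick e (3rd (f , _))  = f

linear-B : ∀ n → 0 ℕ.< n → B n (+ 0)
linear-B (suc n) _ =
  linear (suc n) , cong ℤ.+_ (trans (coSize≡∣triangles∣ (linear (suc n))) (noTri⇒τ≡0 (linear (suc n)) (linear-noTri (suc n))))

linear-B′ : ∀ n → 0 ℕ.< n → B n (+ n - + n)
linear-B′ n 0<n = subst (B n) (sym (ℤ.+-inverseʳ (+ n))) (linear-B n 0<n)

≅-refl : ∀ {n} {𝓑 : BetweennessStructure n} → 𝓑 ≅ 𝓑
≅-refl = record { bijection = Perm.id ; preserves = λ _ _ _ → mk⇔ id id }
  where import Data.Fin.Permutation as Perm

-- At `n ≡ d` the co-size is 0 and a linear structure is the witness. Only for larger `n` is a
-- member of the families needed.
nonempty⇔ : ∀ d {n} → 0 ℕ.< d → (d ℕ.< n → B n (+ n - + d)) → B n (+ n - + d) ⇔ + n ≥ + d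
nonempty⇔ d {n} 0<d above =
  mk⇔ (λ (𝓑 , h) → +≤+ (subst (d ℕ.≤_) (hasCoSize⇒τ 𝓑 d h) (ℕ.m≤n+m d (τ 𝓑)))) λ { (+≤+ d≤n) → from (ℕ.m≤n⇒m<n∨m≡n d≤n) }
  where
  from : d ℕ.< n ⊎ d ≡ n → B n (+ n - + d)
  from (inj₁ d<n)  = above d<n
  from (inj₂ refl) = linear-B′ d 0<d

-- Covers order 3 as well, which `Family²-τ` leaves out and the nonemptiness for `c = 2` requires.
Q²-τ : ∀ {n} (n≥3 : 3 ℕ.≤ n) → τ (𝓠² n n≥3) + 2 ≡ n
Q²-τ {suc (suc (suc k))} n≥3 =
  trans (ℕ.+-suc _ 1) (cong suc (trans (ℕ.+-suc _ 0) (cong suc (classQ-τ false (𝓠²-form n≥3)))))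
Q²-τ {suc zero} (s≤s ())
Q²-τ {suc (suc zero)} (s≤s (s≤s ()))

module _ (n : ℕ) where

  nonempty⁴ : B n (+ n - + 4) ⇔ + n ≥ + 4
  nonempty⁴ =
    nonempty⇔ 4 (s≤s z≤n) λ n≥5 → 𝓢⁴ n n≥5 , τ⇒hasCoSize (𝓢⁴ n n≥5) 4 (Family⁴-τ {𝓑 = 𝓢⁴ n n≥5} (inj₂ (n≥5 , ≅-refl)))

  nonempty³ : B n (+ n - + 3) ⇔ + n ≥ + 3
  nonempty³ =
    nonempty⇔ 3 (s≤s z≤n) λ n≥4 → 𝓠³ n n≥4 , τ⇒hasCoSize (𝓠³ n n≥4) 3 (Family³-τ {𝓑 = 𝓠³ n n≥4} n≥4 (inj₁ (n≥4 , ≅-refl)))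

  nonempty² : B n (+ n - + 2) ⇔ + n ≥ + 2
  nonempty² = nonempty⇔ 2 (s≤s z≤n) λ n≥3 → 𝓠² n n≥3 , τ⇒hasCoSize (𝓠² n n≥3) 2 (Q²-τ n≥3)

NotTight : ℕ → ℤ → Set₁
NotTight n m = B n m × (Σ[ 𝓑 ∈ BetweennessStructure n ] (HasCoSize 𝓑 m × ¬ TightStar (ℋ 𝓑)))

-- `t ≢ 1` because a single triangle counts as a tight star even without a kernel of size 2.
notTight-B : ∀ {n t} (𝓑 : BetweennessStructure n) → τ 𝓑 ≡ t → t ≢ 1 →
             ¬ (∃ λ K → IsKernel (ℋ 𝓑) K × ∣ K ∣ ≡ 2) → NotTight n (+ t)
notTight-B 𝓑 refl t≢1 no-kernel = (𝓑 , hasCoSize) , 𝓑 , hasCoSize , λ where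
    (inj₁ kernel) → no-kernel kernel
    (inj₂ one)    → t≢1 (trans (sym (coSize≡∣triangles∣ 𝓑)) one)
  where
  hasCoSize : HasCoSize 𝓑 (+ τ 𝓑)
  hasCoSize = cong ℤ.+_ (coSize≡∣triangles∣ 𝓑)

twoTwins-B : ∀ r m → + (suc r + suc r) ≡ m → NotTight (6 + r) m
twoTwins-B r m refl = notTight-B twoTwins (trans (sym (ℕ.+-identityʳ _)) twoTwins-τ)
  (λ e → contradiction (trans (sym (ℕ.+-suc r r)) (ℕ.suc-injective e)) λ ()) twoTwins-notTight
  where open TwoTwins r

-- For `n = 10 - c` the co-size `n - c` equals `2 n - 10`, which is that of `twoTwins` with
-- `r = 4 - c`.
part⁴ : ∀ c n → c ≤ + 4 → + n ≡ + 11 - c - + 1 → NotTight n (+ n - c)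
part⁴ (+ 0) _ _ refl = twoTwins-B 4 _ refl
part⁴ (+ 1) _ _ refl = twoTwins-B 3 _ refl
part⁴ (+ 2) _ _ refl = twoTwins-B 2 _ refl
part⁴ (+ 3) _ _ refl = twoTwins-B 1 _ refl
part⁴ (+ 4) _ _ refl = twoTwins-B 0 _ refl
part⁴ (+ suc (suc (suc (suc (suc _))))) _ (+≤+ (s≤s (s≤s (s≤s (s≤s ()))))) _
part⁴ -[1+ m ] _ _ refl =
  twoTwins-B (5 + m) _ (cong ℤ.+_ (solve 1 (λ m → (con 6 :+ m) :+ (con 6 :+ m) := con 11 :+ m :+ (con 1 :+ m)) refl m))
  where open +-*-Solver

-- By `n ≥ 11 - c` the co-size `n - c` is within the bound `2 n - 11`, while `c ≤ 1` means
-- `n ≤ τ + 1`.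
part³ : ∀ c n → c < + 2 → + n ≥ + 11 - c → ¬ B n (+ n - c)
part³ (+ 0) n _ big (𝓑 , h) =
  ¬between-bounds 𝓑 (ℕ.≤-trans (ℕ.n≤1+n 10) 11≤n) few (ℕ.≤-trans (ℕ.≤-reflexive (sym e)) (ℕ.+-monoʳ-≤ (τ 𝓑) z≤n))
  where
  e : τ 𝓑 + 0 ≡ n
  e = hasCoSize⇒τ 𝓑 0 h
  11≤n : 11 ℕ.≤ n
  11≤n = subst (11 ℕ.≤_) (ℕ.+-identityʳ n) (+n≥m-d⇒m≤n+d {d = 0} big)
  few : FewTriangles 𝓑
  few = ℕ.+-mono-≤ (ℕ.≤-reflexive (trans (sym (ℕ.+-identityʳ _)) e)) 11≤n
part³ (+ 1) n _ big (𝓑 , h) = ¬between-bounds 𝓑 10≤n few (ℕ.≤-reflexive (sym e))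
  where
  e : τ 𝓑 + 1 ≡ n
  e = hasCoSize⇒τ 𝓑 1 h
  10≤n : 10 ℕ.≤ n
  10≤n = ℕ.+-cancelʳ-≤ 1 10 n (+n≥m-d⇒m≤n+d {d = 1} big)
  few : FewTriangles 𝓑
  few = subst (ℕ._≤ n + n) (ℕ.+-assoc (τ 𝓑) 1 10) (ℕ.+-mono-≤ (ℕ.≤-reflexive e) 10≤n)
part³ (+ suc (suc _)) n (+<+ (s≤s (s≤s ()))) _
part³ -[1+ m ] n _ (+≤+ big) (𝓑 , h) =
  ¬between-bounds 𝓑 (ℕ.≤-trans (ℕ.m≤m+n 10 (1 + suc m)) (subst (ℕ._≤ n) (ℕ.+-suc 10 (suc m)) big)) few
  (subst (λ t → n ℕ.≤ t + 1) (sym e) (ℕ.≤-trans (ℕ.m≤m+n n (suc m)) (ℕ.m≤m+n (n + suc m) 1)))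
  where
  e : τ 𝓑 ≡ n + suc m
  e = trans (sym (coSize≡∣triangles∣ 𝓑)) (ℤ.+-injective h)
  few : FewTriangles 𝓑
  few =
    subst (λ t → t + 11 ℕ.≤ n + n) (sym e) (ℕ.≤-trans (ℕ.≤-reflexive (trans (ℕ.+-assoc n (suc m) 11) (cong (λ s → n + s) (ℕ.+-comm (suc m) 11)))) (ℕ.+-monoʳ-≤ n big))

part¹ : ∀ c n → c > + 4 → (+ n ≢ c → ¬ B n (+ n - c)) ×
  (+ n ≡ c → B n (+ 0) × (∀ (𝓑 : BetweennessStructure n) → HasCoSize 𝓑 (+ n - c) ⇔ Linear 𝓑))
part¹ (+ d) n (+<+ 5≤d) = (λ n≢c (𝓑 , h) → ¬below-n-4 𝓑 d 5≤d (hasCoSize⇒τ 𝓑 d h) (λ e → n≢c (cong ℤ.+_ e))) ,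
  λ { refl → linear-B n (ℕ.≤-trans (s≤s z≤n) 5≤d) , hasCoSize-n⇔linear }

theorem4 : (c : ℤ) (n : ℕ) → .{{NonZero n}} →
    let N = + 11 - c in
    (c > + 4 →
    (+ n ≢ c → ¬ B n (+ n - c)) ×
    (+ n ≡ c → B n (+ 0) × (∀ (𝓑 : BetweennessStructure n) → HasCoSize 𝓑 (+ n - c) ⇔ Linear 𝓑))) ×
    (+ 2 ≤ c → c ≤ + 4 →
    (B n (+ n - c) ⇔ + n ≥ c) ×
    (+ n ≥ N → ∀ (𝓑 : BetweennessStructure n) →
    (c ≡ + 4 → HasCoSize 𝓑 (+ n - c) ⇔
    ((∃₂ λ n≥5 i → 𝓑 ≅ 𝓡⁴ n n≥5 i) ⊎ (∃ λ n≥5 → 𝓑 ≅ 𝓢⁴ n n≥5))) ×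
    (c ≡ + 3 → HasCoSize 𝓑 (+ n - c) ⇔
    ((∃ λ n≥4 → 𝓑 ≅ 𝓠³ n n≥4) ⊎ (∃₂ λ n≥4 i → 𝓑 ≅ 𝓡³ n n≥4 i) ⊎ (∃ λ n≥4 → 𝓑 ≅ 𝓢³ n n≥4))) ×
    (c ≡ + 2 → HasCoSize 𝓑 (+ n - c) ⇔
    ((∃ λ n≥3 → 𝓑 ≅ 𝓠² n n≥3) ⊎ (∃₂ λ n≥4 i → 𝓑 ≅ 𝓡² n n≥4 i) ⊎ (∃ λ n≥3 → 𝓑 ≅ 𝓢² n n≥3))))) ×
    (c < + 2 → + n ≥ N → ¬ B n (+ n - c)) ×
    (c ≤ + 4 → + n ≡ N - + 1 →
    B n (+ n - c) ×
    (Σ[ 𝓑 ∈ BetweennessStructure n ] (HasCoSize 𝓑 (+ n - c) × ¬ TightStar (ℋ 𝓑))))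
theorem4 c n = part¹ c n ,
  (λ 2≤c c≤4 → part² c 2≤c c≤4 ,
    λ big 𝓑 → (λ { refl → coSize⇔Family⁴ 𝓑 big }) , (λ { refl → coSize⇔Family³ 𝓑 big }) , (λ { refl → coSize⇔Family² 𝓑 big })) ,
  part³ c n , part⁴ c n
  where
  part² : ∀ c → + 2 ≤ c → c ≤ + 4 → B n (+ n - c) ⇔ + n ≥ c
  part² (+ 2) _ _ = nonempty² n
  part² (+ 3) _ _ = nonempty³ n
  part² (+ 4) _ _ = nonempty⁴ n
  part² (+ 0) (+≤+ ()) _
  part² (+ 1) (+≤+ (s≤s ())) _
  part² (+ suc (suc (suc (suc (suc _))))) _ (+≤+ (s≤s (s≤s (s≤s (s≤s ())))))
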